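{- Let $k$ be a perfect field of characteristic $p>0$, $K=W(k)[1/p]$ and $\mathcal{O}_K=W(k)$. Let $$\cdots\subseteq \mathrm{Fil}_0^{\mathrm{conj}}\subseteq\cdots\subseteq\mathrm{Fil}_i^{\mathrm{conj}}\subseteq\cdots\qquad(i\in\mathbf{Z})$$ be an increasing filtration of finite free $\mathcal{O}_K$-modules which is finite, i.e. $\mathrm{Fil}_i^{\mathrm{conj}}$ stabilizes for $i\gg0$ and $\mathrm{Fil}_i^{\mathrm{conj}}=0$ for $i\ll0$. Put $\mathrm{gr}_i^{\mathrm{conj}}=\mathrm{Fil}_i^{\mathrm{conj}}/\mathrm{Fil}_{i-1}^{\mathrm{conj}}$. Assume there is a filtered ($\mathcal{O}_K$-linear) endomorphism $\Theta:\mathrm{Fil}_{\bullet}^{\mathrm{conj}}\to\mathrm{Fil}_{\bullet}^{\mathrm{conj}}$ which acts on $\mathrm{gr}_i^{\mathrm{conj}}$ as multiplication by $-i$ for every $i$. Let $\mathrm{HT}=\{i\in\mathbf{Z} : \mathrm{gr}_i^{\mathrm{conj}}[1/p]\neq0\}$. Then for every $i\in\mathbf{Z}$, if the torsion submodule $(\mathrm{gr}_i^{\mathrm{conj}})_{\mathrm{tor}}$ is nonzero, then $i=r+mp$ for some $r\in\mathrm{HT}$ and some integer $m>0$.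
   Context: A filtered endomorphism means an endomorphism $\Theta$ of the modules $\mathrm{Fil}_i^{\mathrm{conj}}$ compatible with the inclusions, i.e. $\Theta(\mathrm{Fil}_i^{\mathrm{conj}})\subseteq\mathrm{Fil}_i^{\mathrm{conj}}$ for all $i$. -}

module Defs where

open import Algebra.Apartness.Bundles using (HeytingField; HeytingCommutativeRing)
open import Algebra.Bundles using (CommutativeMonoid; CommutativeRing)
open import Algebra.Module.Bundles using (Module)
open import Algebra.Module.Morphism.Structures using (IsModuleHomomorphism; IsModuleMonomorphism)
open import Algebra.Module.Structures.Biased using (IsModuleFromLeft)
import Algebra.Properties.Semiring.Exp
import Algebra.Properties.Semiring.Mult
open import Data.Empty using (⊥; ⊥-elim)
open import Data.Fin.Base as Fin using (Fin)
import Data.Fin.Properties as Fin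
open import Data.Integer.Base as ℤ using (ℤ; +_; -[1+_])
import Data.Integer.Properties as ℤ
open import Data.List.Base using (List; []; _∷_; _++_)
open import Data.List.Membership.Propositional using (_∈_)
open import Data.List.Membership.Propositional.Properties using (∈-++⁺ˡ; ∈-++⁺ʳ)
open import Data.List.Relation.Unary.Any using (here; there)
open import Data.Maybe.Base using (Maybe; just; nothing)
open import Data.Nat.Base as ℕ using (ℕ; zero; suc; NonZero; _!)
open import Data.Nat.Combinatorics using (_C_; nCn≡1; nCk≡n!/k![n-k]!; k![n∸k]!∣n!)
open import Data.Nat.Divisibility using (_∣_; divides; m∣m*n; ∣⇒≤; ∣1⇒≡1)
import Data.Nat.DivMod as ℕ
open import Data.Nat.Primality using (Prime; euclidsLemma; prime⇒nonZero; prime⇒nonTrivial)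
import Data.Nat.Properties as ℕ
open import Data.Nat.Tactic.RingSolver using (solve-∀)
open import Data.Product.Base using (Σ; ∃; _,_; proj₂; _×_)
open import Data.Product.Properties using (≡-dec)
open import Data.Sum.Base using ([_,_]′)
import Data.Vec.Functional as Vector
open import Function.Base using (_∘_)
open import Function.Bundles using (_⇔_)
open import Function.Definitions using (Surjective)
open import Level using (Level; 0ℓ; _⊔_) renaming (suc to lsuc)
open import Relation.Binary.Definitions using (DecidableEquality)
open import Relation.Binary.PropositionalEquality as ≡ using (_≡_)
open import Relation.Nullary.Decidable.Core using (yes; no)
open import Relation.Nullary.Negation.Core using (¬_)

private
  variable
    c ℓ ℓ₁ ℓ₂ m ℓm : Level

infix  4 _≃_
infixl 6 _:+_
infixl 7 _:*_
infix  8 :-_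

-- ℤ[V], presented as the free commutative ring on V: terms modulo the ring axioms.
data Poly (V : Set) : Set where
  var       : V → Poly V
  :0 :1     : Poly V
  _:+_ _:*_ : Poly V → Poly V → Poly V
  :-_       : Poly V → Poly V

data _≃_ {V : Set} : Poly V → Poly V → Set where
  ≃-refl       : ∀ {a} → a ≃ a
  ≃-sym        : ∀ {a b} → a ≃ b → b ≃ a
  ≃-trans      : ∀ {a b c} → a ≃ b → b ≃ c → a ≃ c
  :+-cong      : ∀ {a b c d} → a ≃ b → c ≃ d → a :+ c ≃ b :+ d
  :*-cong      : ∀ {a b c d} → a ≃ b → c ≃ d → a :* c ≃ b :* d
  :-‿cong      : ∀ {a b} → a ≃ b → :- a ≃ :- b
  :+-assoc     : ∀ a b c → (a :+ b) :+ c ≃ a :+ (b :+ c)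
  :+-comm      : ∀ a b → a :+ b ≃ b :+ a
  :+-identityˡ : ∀ a → :0 :+ a ≃ a
  :-‿inverseˡ  : ∀ a → (:- a) :+ a ≃ :0
  :*-assoc     : ∀ a b c → (a :* b) :* c ≃ a :* (b :* c)
  :*-comm      : ∀ a b → a :* b ≃ b :* a
  :*-identityˡ : ∀ a → :1 :* a ≃ a
  :-distribʳ   : ∀ a b c → (b :+ c) :* a ≃ b :* a :+ c :* a

ℤ[_] : Set → CommutativeRing 0ℓ 0ℓ
ℤ[ V ] = record
  { Carrier = Poly V
  ; _≈_ = _≃_
  ; _+_ = _:+_
  ; _*_ = _:*_
  ; -_  = :-_
  ; 0#  = :0
  ; 1#  = :1
  ; isCommutativeRing = record
    { isRing = record
      { +-isAbelianGroup = record
        { isGroup = record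
          { isMonoid = record
            { isSemigroup = record
              { isMagma = record
                { isEquivalence = record { refl = ≃-refl ; sym = ≃-sym ; trans = ≃-trans }
                ; ∙-cong = :+-cong
                }
              ; assoc = :+-assoc
              }
            ; identity = :+-identityˡ , λ a → ≃-trans (:+-comm a :0) (:+-identityˡ a)
            }
          ; inverse = :-‿inverseˡ , λ a → ≃-trans (:+-comm a (:- a)) (:-‿inverseˡ a)
          ; ⁻¹-cong = :-‿cong
          }
        ; comm = :+-comm
        }
      ; *-cong = :*-cong
      ; *-assoc = :*-assoc
      ; *-identity = :*-identityˡ , λ a → ≃-trans (:*-comm a :1) (:*-identityˡ a)
      ; distrib =
          (λ a b c → ≃-trans (:*-comm a (b :+ c))
            (≃-trans (:-distribʳ a b c) (:+-cong (:*-comm b a) (:*-comm c a))))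
        , :-distribʳ
      }
    ; *-comm = :*-comm
    }
  }

module Eval (A : CommutativeRing c ℓ) {V : Set} where
  open CommutativeRing A
  open import Algebra.Properties.Semiring.Exp semiring using (_^_)
  open import Algebra.Properties.Semiring.Mult semiring renaming (_×_ to _·_)
  private
    module P = CommutativeRing ℤ[ V ]
    module Exp = Algebra.Properties.Semiring.Exp P.semiring
    module Mult = Algebra.Properties.Semiring.Mult P.semiring

  eval : (V → Carrier) → Poly V → Carrier
  eval ρ (var v)  = ρ v
  eval ρ :0       = 0#
  eval ρ :1       = 1#
  eval ρ (f :+ g) = eval ρ f + eval ρ g
  eval ρ (f :* g) = eval ρ f * eval ρ g
  eval ρ (:- f)   = - eval ρ f

  eval-cong : ∀ ρ {f g} → f ≃ g → eval ρ f ≈ eval ρ g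
  eval-cong ρ ≃-refl             = refl
  eval-cong ρ (≃-sym e)          = sym (eval-cong ρ e)
  eval-cong ρ (≃-trans e d)      = trans (eval-cong ρ e) (eval-cong ρ d)
  eval-cong ρ (:+-cong e d)      = +-cong (eval-cong ρ e) (eval-cong ρ d)
  eval-cong ρ (:*-cong e d)      = *-cong (eval-cong ρ e) (eval-cong ρ d)
  eval-cong ρ (:-‿cong e)        = -‿cong (eval-cong ρ e)
  eval-cong ρ (:+-assoc _ _ _)   = +-assoc _ _ _
  eval-cong ρ (:+-comm _ _)      = +-comm _ _
  eval-cong ρ (:+-identityˡ _)   = +-identityˡ _
  eval-cong ρ (:-‿inverseˡ _)    = -‿inverseˡ _
  eval-cong ρ (:*-assoc _ _ _)   = *-assoc _ _ _
  eval-cong ρ (:*-comm _ _)      = *-comm _ _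
  eval-cong ρ (:*-identityˡ _)   = *-identityˡ _
  eval-cong ρ (:-distribʳ _ _ _) = distribʳ _ _ _

  eval-ext : ∀ {ρ σ} → (∀ v → ρ v ≈ σ v) → ∀ f → eval ρ f ≈ eval σ f
  eval-ext e (var v)  = e v
  eval-ext e :0       = refl
  eval-ext e :1       = refl
  eval-ext e (f :+ g) = +-cong (eval-ext e f) (eval-ext e g)
  eval-ext e (f :* g) = *-cong (eval-ext e f) (eval-ext e g)
  eval-ext e (:- f)   = -‿cong (eval-ext e f)

  eval-^ : ∀ ρ f n → eval ρ (f Exp.^ n) ≈ eval ρ f ^ n
  eval-^ ρ f zero    = refl
  eval-^ ρ f (suc n) = *-congˡ (eval-^ ρ f n)

  eval-· : ∀ ρ n f → eval ρ (n Mult.× f) ≈ n · eval ρ f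
  eval-· ρ zero    f = refl
  eval-· ρ (suc n) f = +-congˡ (eval-· ρ n f)

open Eval public using (eval)

module _ (A : CommutativeRing c ℓ) {V W : Set} where
  open CommutativeRing A

  eval-∘ : ∀ (ρ : W → Carrier) (σ : V → Poly W) f →
           eval A ρ (eval ℤ[ W ] σ f) ≈ eval A (eval A ρ ∘ σ) f
  eval-∘ ρ σ (var v)  = refl
  eval-∘ ρ σ :0       = refl
  eval-∘ ρ σ :1       = refl
  eval-∘ ρ σ (f :+ g) = +-cong (eval-∘ ρ σ f) (eval-∘ ρ σ g)
  eval-∘ ρ σ (f :* g) = *-cong (eval-∘ ρ σ f) (eval-∘ ρ σ g)
  eval-∘ ρ σ (:- f)   = -‿cong (eval-∘ ρ σ f)

eval-var : ∀ {V} (f : Poly V) → eval ℤ[ V ] var f ≃ f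
eval-var (var v)  = ≃-refl
eval-var :0       = ≃-refl
eval-var :1       = ≃-refl
eval-var (f :+ g) = :+-cong (eval-var f) (eval-var g)
eval-var (f :* g) = :*-cong (eval-var f) (eval-var g)
eval-var (:- f)   = :-‿cong (eval-var f)

TorsionFree : CommutativeRing c ℓ → Set (c ⊔ ℓ)
TorsionFree A = ∀ n x → suc n · x ≈ 0# → x ≈ 0#
  where
  open CommutativeRing A
  open import Algebra.Properties.Semiring.Mult semiring renaming (_×_ to _·_)

-- Power series over A, used only to separate the coefficients of a polynomial.

module Series (A : CommutativeRing c ℓ) where
  open CommutativeRing A
  open import Algebra.Properties.Ring ring using (-‿distribˡ-*)
  open import Algebra.Properties.CommutativeSemigroup +-commutativeSemigroup
    using (interchange; x∙yz≈y∙xz)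
  open import Relation.Binary.Reasoning.Setoid setoid

  Series : Set c
  Series = ℕ → Carrier

  infix 4 _≋_
  _≋_ : Series → Series → Set ℓ
  f ≋ g = ∀ n → f n ≈ g n

  tail : Series → Series
  tail f n = f (suc n)

  infixl 6 _⊕_
  infixl 7 _⊛_
  _⊕_ _⊛_ : Series → Series → Series
  (f ⊕ g) n = f n + g n
  (f ⊛ g) zero    = f 0 * g 0
  (f ⊛ g) (suc n) = f 0 * g (suc n) + (tail f ⊛ g) n

  ⊝_ : Series → Series
  (⊝ f) n = - f n

  𝟘 𝟙 : Series
  𝟘 _ = 0#
  𝟙 zero    = 1#
  𝟙 (suc _) = 0#

  ⊛-cong : ∀ {f g h k} → f ≋ g → h ≋ k → f ⊛ h ≋ g ⊛ k
  ⊛-cong e d zero    = *-cong (e 0) (d 0)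
  ⊛-cong e d (suc n) = +-cong (*-cong (e 0) (d (suc n))) (⊛-cong (e ∘ suc) d n)

  ⊛-distribʳ : ∀ h f g → (f ⊕ g) ⊛ h ≋ f ⊛ h ⊕ g ⊛ h
  ⊛-distribʳ h f g zero    = distribʳ _ _ _
  ⊛-distribʳ h f g (suc n) = begin
    (f 0 + g 0) * h (suc n) + ((tail f ⊕ tail g) ⊛ h) n
      ≈⟨ +-cong (distribʳ _ _ _) (⊛-distribʳ h (tail f) (tail g) n) ⟩
    (f 0 * h (suc n) + g 0 * h (suc n)) + ((tail f ⊛ h) n + (tail g ⊛ h) n)
      ≈⟨ interchange _ _ _ _ ⟩
    (f ⊛ h) (suc n) + (g ⊛ h) (suc n) ∎

  ⊛-sucʳ : ∀ f g n → (f ⊛ g) (suc n) ≈ f (suc n) * g 0 + (f ⊛ tail g) n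
  ⊛-sucʳ f g zero    = +-comm _ _
  ⊛-sucʳ f g (suc n) = begin
    f 0 * g (suc (suc n)) + (tail f ⊛ g) (suc n)
      ≈⟨ +-congˡ (⊛-sucʳ (tail f) g n) ⟩
    f 0 * g (suc (suc n)) + (f (suc (suc n)) * g 0 + (tail f ⊛ tail g) n)
      ≈⟨ x∙yz≈y∙xz _ _ _ ⟩
    f (suc (suc n)) * g 0 + (f ⊛ tail g) (suc n) ∎

  ⊛-comm : ∀ f g → f ⊛ g ≋ g ⊛ f
  ⊛-comm f g zero    = *-comm _ _
  ⊛-comm f g (suc n) = begin
    f 0 * g (suc n) + (tail f ⊛ g) n  ≈⟨ +-cong (*-comm _ _) (⊛-comm (tail f) g n) ⟩
    g (suc n) * f 0 + (g ⊛ tail f) n  ≈⟨ ⊛-sucʳ g f n ⟨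
    (g ⊛ f) (suc n)                   ∎

  scale : Carrier → Series → Series
  scale a f n = a * f n

  ⊛-scaleˡ : ∀ a f g → scale a f ⊛ g ≋ scale a (f ⊛ g)
  ⊛-scaleˡ a f g zero    = *-assoc _ _ _
  ⊛-scaleˡ a f g (suc n) = begin
    a * f 0 * g (suc n) + (scale a (tail f) ⊛ g) n
      ≈⟨ +-cong (*-assoc _ _ _) (⊛-scaleˡ a (tail f) g n) ⟩
    a * (f 0 * g (suc n)) + a * (tail f ⊛ g) n
      ≈⟨ distribˡ _ _ _ ⟨
    a * (f ⊛ g) (suc n) ∎

  ⊛-assoc : ∀ f g h → (f ⊛ g) ⊛ h ≋ f ⊛ (g ⊛ h)
  ⊛-assoc f g h zero    = *-assoc _ _ _
  ⊛-assoc f g h (suc n) = begin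
    f 0 * g 0 * h (suc n) + (tail (f ⊛ g) ⊛ h) n
      ≈⟨ +-congˡ (⊛-distribʳ h (scale (f 0) (tail g)) (tail f ⊛ g) n) ⟩
    f 0 * g 0 * h (suc n) + ((scale (f 0) (tail g) ⊛ h) n + ((tail f ⊛ g) ⊛ h) n)
      ≈⟨ +-cong (*-assoc _ _ _) (+-cong (⊛-scaleˡ (f 0) (tail g) h n) (⊛-assoc (tail f) g h n)) ⟩
    f 0 * (g 0 * h (suc n)) + (f 0 * (tail g ⊛ h) n + (tail f ⊛ (g ⊛ h)) n)
      ≈⟨ +-assoc _ _ _ ⟨
    f 0 * (g 0 * h (suc n)) + f 0 * (tail g ⊛ h) n + (tail f ⊛ (g ⊛ h)) n
      ≈⟨ +-congʳ (distribˡ _ _ _) ⟨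
    (f ⊛ (g ⊛ h)) (suc n) ∎

  ⊛-zeroˡ : ∀ f → 𝟘 ⊛ f ≋ 𝟘
  ⊛-zeroˡ f zero    = zeroˡ _
  ⊛-zeroˡ f (suc n) = trans (+-cong (zeroˡ _) (⊛-zeroˡ f n)) (+-identityˡ _)

  ⊛-identityˡ : ∀ f → 𝟙 ⊛ f ≋ f
  ⊛-identityˡ f zero    = *-identityˡ _
  ⊛-identityˡ f (suc n) = trans (+-cong (*-identityˡ _) (⊛-zeroˡ f n)) (+-identityʳ _)

  seriesRing : CommutativeRing c ℓ
  seriesRing = record
    { Carrier = Series
    ; _≈_ = _≋_
    ; _+_ = _⊕_
    ; _*_ = _⊛_
    ; -_  = ⊝_
    ; 0#  = 𝟘
    ; 1#  = 𝟙
    ; isCommutativeRing = record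
      { isRing = record
        { +-isAbelianGroup = record
          { isGroup = record
            { isMonoid = record
              { isSemigroup = record
                { isMagma = record
                  { isEquivalence = record
                    { refl = λ _ → refl ; sym = λ e n → sym (e n) ; trans = λ e d n → trans (e n) (d n) }
                  ; ∙-cong = λ e d n → +-cong (e n) (d n)
                  }
                ; assoc = λ _ _ _ _ → +-assoc _ _ _
                }
              ; identity = (λ _ _ → +-identityˡ _) , (λ _ _ → +-identityʳ _)
              }
            ; inverse = (λ _ _ → -‿inverseˡ _) , (λ _ _ → -‿inverseʳ _)
            ; ⁻¹-cong = λ e n → -‿cong (e n)
            }
          ; comm = λ _ _ _ → +-comm _ _
          }
        ; *-cong = ⊛-cong
        ; *-assoc = ⊛-assoc
        ; *-identity = ⊛-identityˡ , λ f n → trans (⊛-comm f 𝟙 n) (⊛-identityˡ f n)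
        ; distrib =
            (λ f g h n → trans (⊛-comm f (g ⊕ h) n)
              (trans (⊛-distribʳ f g h n) (+-cong (⊛-comm g f n) (⊛-comm h f n))))
          , ⊛-distribʳ
        }
      ; *-comm = ⊛-comm
      }
    }

  open import Algebra.Properties.Semiring.Mult semiring renaming (_×_ to _·_)
  open import Algebra.Properties.Semiring.Mult (CommutativeRing.semiring seriesRing)
    using () renaming (_×_ to _·ₛ_)

  ·-coeff : ∀ n f k → (n ·ₛ f) k ≈ n · f k
  ·-coeff zero    f k = refl
  ·-coeff (suc n) f k = +-congˡ (·-coeff n f k)

-- ℤ[X₀, …, Xₙ] is (ℤ[X₁, …, Xₙ])[X₀], with f ∈ A[X] given by its list of coefficients.

module Extend (V : Set) (torsionFree : TorsionFree ℤ[ V ]) where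
  open CommutativeRing ℤ[ V ]
  open Series ℤ[ V ]
  private module P = CommutativeRing ℤ[ Maybe V ]

  X : Series
  X 1 = 1#
  X _ = 0#

  toSeries : Poly (Maybe V) → Series
  toSeries = eval seriesRing λ { nothing → X ; (just v) zero → var v ; (just v) (suc _) → 0# }

  add : List (Poly V) → List (Poly V) → List (Poly V)
  add []       g        = g
  add (a ∷ f)  []       = a ∷ f
  add (a ∷ f)  (b ∷ g)  = a + b ∷ add f g

  mulBy : Poly V → List (Poly V) → List (Poly V)
  mulBy a []      = []
  mulBy a (b ∷ g) = a * b ∷ mulBy a g

  mul : List (Poly V) → List (Poly V) → List (Poly V)
  mul []      g = []
  mul (a ∷ f) g = add (mulBy a g) (0# ∷ mul f g)

  coefficients : Poly (Maybe V) → List (Poly V)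
  coefficients (var nothing)  = 0# ∷ 1# ∷ []
  coefficients (var (just v)) = var v ∷ []
  coefficients :0             = []
  coefficients :1             = 1# ∷ []
  coefficients (f :+ g)       = add (coefficients f) (coefficients g)
  coefficients (f :* g)       = mul (coefficients f) (coefficients g)
  coefficients (:- f)         = mulBy (- 1#) (coefficients f)

  coeff : List (Poly V) → Series
  coeff []      _       = 0#
  coeff (a ∷ f) zero    = a
  coeff (a ∷ f) (suc n) = coeff f n

  coeff-add : ∀ f g → coeff (add f g) ≋ coeff f ⊕ coeff g
  coeff-add []      g       n       = sym (+-identityˡ _)
  coeff-add (a ∷ f) []      n       = sym (+-identityʳ _)
  coeff-add (a ∷ f) (b ∷ g) zero    = refl
  coeff-add (a ∷ f) (b ∷ g) (suc n) = coeff-add f g n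

  coeff-mulBy : ∀ a g → coeff (mulBy a g) ≋ scale a (coeff g)
  coeff-mulBy a []      n       = sym (zeroʳ _)
  coeff-mulBy a (b ∷ g) zero    = refl
  coeff-mulBy a (b ∷ g) (suc n) = coeff-mulBy a g n

  coeff-mul : ∀ f g → coeff (mul f g) ≋ coeff f ⊛ coeff g
  coeff-mul []      g n       = sym (⊛-zeroˡ (coeff g) n)
  coeff-mul (a ∷ f) g zero    =
    trans (coeff-add (mulBy a g) _ 0) (trans (+-identityʳ _) (coeff-mulBy a g 0))
  coeff-mul (a ∷ f) g (suc n) =
    trans (coeff-add (mulBy a g) _ (suc n)) (+-cong (coeff-mulBy a g (suc n)) (coeff-mul f g n))

  open import Algebra.Properties.Ring ring using (-1*x≈-x)

  toSeries≋coeff : ∀ f → toSeries f ≋ coeff (coefficients f)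
  toSeries≋coeff (var nothing)  zero          = refl
  toSeries≋coeff (var nothing)  (suc zero)    = refl
  toSeries≋coeff (var nothing)  (suc (suc _)) = refl
  toSeries≋coeff (var (just v)) zero          = refl
  toSeries≋coeff (var (just v)) (suc _)       = refl
  toSeries≋coeff :0             n             = refl
  toSeries≋coeff :1             zero          = refl
  toSeries≋coeff :1             (suc _)       = refl
  toSeries≋coeff (f :+ g)       n             =
    trans (+-cong (toSeries≋coeff f n) (toSeries≋coeff g n))
          (sym (coeff-add (coefficients f) (coefficients g) n))
  toSeries≋coeff (f :* g)       n             =
    trans (⊛-cong (toSeries≋coeff f) (toSeries≋coeff g) n)
          (sym (coeff-mul (coefficients f) (coefficients g) n))
  toSeries≋coeff (:- f)         n             =
    trans (-‿cong (toSeries≋coeff f n))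
          (trans (sym (-1*x≈-x _)) (sym (coeff-mulBy (- 1#) (coefficients f) n)))

  C : Poly V → Poly (Maybe V)
  C = eval ℤ[ Maybe V ] (var ∘ just)

  open Eval ℤ[ Maybe V ] {V} using (eval-cong)

  horner : List (Poly V) → Poly (Maybe V)
  horner []      = :0
  horner (a ∷ f) = C a :+ var nothing :* horner f

  module _ where
    open import Algebra.Solver.Ring.NaturalCoefficients.Default P.commutativeSemiring
      using (solve; _:=_) renaming (_:+_ to _⟨+⟩_; _:*_ to _⟨*⟩_)
    open import Relation.Binary.Reasoning.Setoid P.setoid

    horner-add : ∀ f g → horner (add f g) ≃ horner f :+ horner g
    horner-add []      g       = P.sym (P.+-identityˡ _)
    horner-add (a ∷ f) []      = P.sym (P.+-identityʳ _)
    horner-add (a ∷ f) (b ∷ g) = begin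
      C a :+ C b :+ var nothing :* horner (add f g)
        ≈⟨ P.+-congˡ (P.*-congˡ (horner-add f g)) ⟩
      C a :+ C b :+ var nothing :* (horner f :+ horner g)
        ≈⟨ solve 5 (λ a b x f g → a ⟨+⟩ b ⟨+⟩ x ⟨*⟩ (f ⟨+⟩ g) :=
             (a ⟨+⟩ x ⟨*⟩ f) ⟨+⟩ (b ⟨+⟩ x ⟨*⟩ g)) P.refl (C a) (C b) (var nothing) (horner f) (horner g) ⟩
      horner (a ∷ f) :+ horner (b ∷ g) ∎

    horner-mulBy : ∀ a g → horner (mulBy a g) ≃ C a :* horner g
    horner-mulBy a []      = P.sym (P.zeroʳ _)
    horner-mulBy a (b ∷ g) = begin
      C a :* C b :+ var nothing :* horner (mulBy a g)
        ≈⟨ P.+-congˡ (P.*-congˡ (horner-mulBy a g)) ⟩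
      C a :* C b :+ var nothing :* (C a :* horner g)
        ≈⟨ solve 4 (λ a b x g → a ⟨*⟩ b ⟨+⟩ x ⟨*⟩ (a ⟨*⟩ g) := a ⟨*⟩ (b ⟨+⟩ x ⟨*⟩ g))
             P.refl (C a) (C b) (var nothing) (horner g) ⟩
      C a :* horner (b ∷ g) ∎

    horner-mul : ∀ f g → horner (mul f g) ≃ horner f :* horner g
    horner-mul []      g = P.sym (P.zeroˡ _)
    horner-mul (a ∷ f) g = begin
      horner (add (mulBy a g) (0# ∷ mul f g))
        ≈⟨ horner-add (mulBy a g) (0# ∷ mul f g) ⟩
      horner (mulBy a g) :+ (:0 :+ var nothing :* horner (mul f g))
        ≈⟨ P.+-cong (horner-mulBy a g) (P.trans (P.+-identityˡ _) (P.*-congˡ (horner-mul f g))) ⟩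
      C a :* horner g :+ var nothing :* (horner f :* horner g)
        ≈⟨ solve 4 (λ a x f g → a ⟨*⟩ g ⟨+⟩ x ⟨*⟩ (f ⟨*⟩ g) := (a ⟨+⟩ x ⟨*⟩ f) ⟨*⟩ g)
             P.refl (C a) (var nothing) (horner f) (horner g) ⟩
      horner (a ∷ f) :* horner g ∎

  open import Algebra.Properties.Ring P.ring using () renaming (-1*x≈-x to :-1*x≃:-x)

  horner-coefficients : ∀ f → horner (coefficients f) ≃ f
  horner-coefficients (var nothing)  = P.trans (P.+-identityˡ _)
    (P.trans (P.*-congˡ (P.trans (P.+-congˡ (P.zeroʳ _)) (P.+-identityʳ _))) (P.*-identityʳ _))
  horner-coefficients (var (just v)) = P.trans (P.+-congˡ (P.zeroʳ _)) (P.+-identityʳ _)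
  horner-coefficients :0             = P.refl
  horner-coefficients :1             = P.trans (P.+-congˡ (P.zeroʳ _)) (P.+-identityʳ _)
  horner-coefficients (f :+ g)       = P.trans (horner-add (coefficients f) (coefficients g))
    (P.+-cong (horner-coefficients f) (horner-coefficients g))
  horner-coefficients (f :* g)       = P.trans (horner-mul (coefficients f) (coefficients g))
    (P.*-cong (horner-coefficients f) (horner-coefficients g))
  horner-coefficients (:- f)         = P.trans (horner-mulBy (- 1#) (coefficients f))
    (P.trans (P.*-congˡ (horner-coefficients f)) (:-1*x≃:-x f))

  horner-zero : ∀ f → coeff f ≋ 𝟘 → horner f ≃ :0
  horner-zero []      e = P.refl
  horner-zero (a ∷ f) e = P.trans
    (P.+-cong (eval-cong (var ∘ just) (e 0))
              (P.trans (P.*-congˡ (horner-zero f (e ∘ suc))) (P.zeroʳ _)))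
    (P.+-identityˡ _)

  torsionFree-extend : TorsionFree ℤ[ Maybe V ]
  torsionFree-extend n f e = P.trans (P.sym (horner-coefficients f)) (horner-zero (coefficients f)
    λ k → trans (sym (toSeries≋coeff f k)) (torsionFree n (toSeries f k)
      (trans (sym (·-coeff (suc n) (toSeries f) k))
        (trans (sym (Eval.eval-· seriesRing _ (suc n) f k)) (Eval.eval-cong seriesRing _ e k)))))

module Constants (V : Set) (empty : V → ⊥) where
  open CommutativeRing ℤ[ V ]
  open import Algebra.Properties.Semiring.Mult semiring using (×1-homo-*; ×-homo-+; ×-comm-*; ×-congʳ) renaming (_×_ to _·_)
  open import Algebra.Properties.CommutativeMonoid.Mult +-commutativeMonoid using () renaming (×-distrib-+ to ·-distrib-+)
  open import Algebra.Properties.Semiring.Mult (CommutativeRing.semiring ℤ.+-*-commutativeRing) using () renaming (_×_ to _·ℤ_)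
  open import Algebra.Properties.Group +-group using (identityˡ-unique)
  open import Relation.Binary.Reasoning.Setoid setoid
  open import Algebra.Solver.Ring.NaturalCoefficients.Default commutativeSemiring
    using (solve; _:=_) renaming (_:+_ to _⟨+⟩_; _:*_ to _⟨*⟩_)

  -- (a , b) represents a - b.
  difference : ∀ f → Σ (ℕ × ℕ) λ (a , b) → f + b · 1# ≈ a · 1#
  difference (var v)  = ⊥-elim (empty v)
  difference :0       = (0 , 0) , +-identityˡ _
  difference :1       = (1 , 0) , refl
  difference (f :+ g) with difference f | difference g
  ... | (a , b) , e | (c , d) , e′ = (a ℕ.+ c , b ℕ.+ d) , (begin
    f + g + (b ℕ.+ d) · 1#           ≈⟨ +-congˡ (×-homo-+ 1# b d) ⟩
    f + g + (b · 1# + d · 1#)        ≈⟨ solve 4 (λ f g b d → f ⟨+⟩ g ⟨+⟩ (b ⟨+⟩ d) := (f ⟨+⟩ b) ⟨+⟩ (g ⟨+⟩ d)) refl f g _ _ ⟩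
    (f + b · 1#) + (g + d · 1#)      ≈⟨ +-cong e e′ ⟩
    a · 1# + c · 1#                  ≈⟨ ×-homo-+ 1# a c ⟨
    (a ℕ.+ c) · 1#                   ∎)
  difference (f :* g) with difference f | difference g
  ... | (a , b) , e | (c , d) , e′ = (a ℕ.* c ℕ.+ b ℕ.* d , a ℕ.* d ℕ.+ b ℕ.* c) , (begin
    f * g + (a ℕ.* d ℕ.+ b ℕ.* c) · 1#
      ≈⟨ +-congˡ (split a d b c) ⟩
    f * g + (a · 1# * (d · 1#) + b · 1# * (c · 1#))
      ≈⟨ +-congˡ (+-cong (*-congʳ e) (*-congˡ e′)) ⟨
    f * g + ((f + b · 1#) * (d · 1#) + b · 1# * (g + d · 1#))
      ≈⟨ solve 4 (λ f g b d → f ⟨*⟩ g ⟨+⟩ ((f ⟨+⟩ b) ⟨*⟩ d ⟨+⟩ b ⟨*⟩ (g ⟨+⟩ d)) :=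
           (f ⟨+⟩ b) ⟨*⟩ (g ⟨+⟩ d) ⟨+⟩ b ⟨*⟩ d) refl f g _ _ ⟩
    (f + b · 1#) * (g + d · 1#) + b · 1# * (d · 1#)
      ≈⟨ +-congʳ (*-cong e e′) ⟩
    a · 1# * (c · 1#) + b · 1# * (d · 1#)
      ≈⟨ split a c b d ⟨
    (a ℕ.* c ℕ.+ b ℕ.* d) · 1# ∎)
    where
    split : ∀ a c b d → (a ℕ.* c ℕ.+ b ℕ.* d) · 1# ≈ a · 1# * (c · 1#) + b · 1# * (d · 1#)
    split a c b d = trans (×-homo-+ 1# (a ℕ.* c) (b ℕ.* d)) (+-cong (×1-homo-* a c) (×1-homo-* b d))
  difference (:- f) with difference f
  ... | (a , b) , e = (b , a) , (begin
    - f + a · 1#          ≈⟨ +-congˡ e ⟨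
    - f + (f + b · 1#)    ≈⟨ +-assoc _ _ _ ⟨
    - f + f + b · 1#      ≈⟨ +-congʳ (-‿inverseˡ f) ⟩
    0# + b · 1#           ≈⟨ +-identityˡ _ ⟩
    b · 1#                ∎)

  ·1ℤ : ∀ n → n ·ℤ ℤ.1ℤ ≡ ℤ.+ n
  ·1ℤ zero    = ≡.refl
  ·1ℤ (suc n) = ≡.cong (ℤ._+_ ℤ.1ℤ) (·1ℤ n)

  ·1-injective : ∀ {m n} → m · 1# ≈ n · 1# → m ≡ n
  ·1-injective {m} {n} e = ℤ.+-injective (≡.trans (≡.sym (toℤ m)) (≡.trans (eval-cong ρ e) (toℤ n)))
    where
    open Eval ℤ.+-*-commutativeRing {V} using (eval-cong; eval-·)
    ρ : V → ℤ
    ρ v = ⊥-elim (empty v)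
    toℤ : ∀ k → eval ℤ.+-*-commutativeRing ρ (k · 1#) ≡ ℤ.+ k
    toℤ k = ≡.trans (eval-· ρ k 1#) (·1ℤ k)

  torsionFree-constants : TorsionFree ℤ[ V ]
  torsionFree-constants n f e with difference f
  ... | (a , b) , d = identityˡ-unique f (b · 1#) (trans d (reflexive (≡.cong (_· 1#) (≡.sym b≡a))))
    where
    open import Algebra.Properties.Semiring.Mult semiring using (×-assocˡ)
    b≡a : b ≡ a
    b≡a = ℕ.*-cancelˡ-≡ b a (suc n) (·1-injective (begin
      (suc n ℕ.* b) · 1#             ≈⟨ ×-assocˡ 1# (suc n) b ⟨
      suc n · (b · 1#)               ≈⟨ +-identityˡ _ ⟨
      0# + suc n · (b · 1#)          ≈⟨ +-congʳ e ⟨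
      suc n · f + suc n · (b · 1#)   ≈⟨ ·-distrib-+ f (b · 1#) (suc n) ⟨
      suc n · (f + b · 1#)           ≈⟨ ×-congʳ (suc n) d ⟩
      suc n · (a · 1#)               ≈⟨ ×-assocˡ 1# (suc n) a ⟩
      (suc n ℕ.* a) · 1#             ∎))

module Relabel {V : Set} (_≟_ : DecidableEquality V) where

  Index : List V → Set
  Index []       = ⊥
  Index (_ ∷ vs) = Maybe (Index vs)

  torsionFree-index : ∀ vs → TorsionFree ℤ[ Index vs ]
  torsionFree-index []       = Constants.torsionFree-constants ⊥ λ ()
  torsionFree-index (_ ∷ vs) = Extend.torsionFree-extend (Index vs) (torsionFree-index vs)

  label : ∀ vs → Index vs → Poly V
  label (v ∷ vs) nothing  = var v
  label (v ∷ vs) (just i) = label vs i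

  index : ∀ vs → V → Poly (Index vs)
  index []       v = :0
  index (w ∷ vs) v with v ≟ w
  ... | yes _ = var nothing
  ... | no  _ = eval ℤ[ Index (w ∷ vs) ] (var ∘ just) (index vs v)

  label-index : ∀ vs {v} → v ∈ vs → eval ℤ[ V ] (label vs) (index vs v) ≃ var v
  label-index (w ∷ vs) {v} v∈ with v ≟ w
  ... | yes ≡.refl = ≃-refl
  ... | no  v≢w    = ≃-trans (eval-∘ ℤ[ V ] (label (w ∷ vs)) (var ∘ just) (index vs v)) (label-index vs (later v∈))
    where
    later : v ∈ w ∷ vs → v ∈ vs
    later (here v≡w) = ⊥-elim (v≢w v≡w)
    later (there v∈) = v∈

  variables : Poly V → List V
  variables (var v)  = v ∷ []
  variables :0       = []
  variables :1       = []
  variables (f :+ g) = variables f ++ variables g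
  variables (f :* g) = variables f ++ variables g
  variables (:- f)   = variables f

  relabel : ∀ vs f → (∀ {v} → v ∈ variables f → v ∈ vs) →
            eval ℤ[ V ] (λ v → eval ℤ[ V ] (label vs) (index vs v)) f ≃ f
  relabel vs (var v)  s = label-index vs (s (here ≡.refl))
  relabel vs :0       s = ≃-refl
  relabel vs :1       s = ≃-refl
  relabel vs (f :+ g) s = :+-cong (relabel vs f (s ∘ ∈-++⁺ˡ)) (relabel vs g (s ∘ ∈-++⁺ʳ _))
  relabel vs (f :* g) s = :*-cong (relabel vs f (s ∘ ∈-++⁺ˡ)) (relabel vs g (s ∘ ∈-++⁺ʳ _))
  relabel vs (:- f)   s = :-‿cong (relabel vs f s)

  torsionFree : TorsionFree ℤ[ V ]
  torsionFree n f e = ≃-trans (≃-sym (relabel vs f λ v∈ → v∈))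
    (≃-trans (≃-sym (eval-∘ ℤ[ V ] (label vs) (index vs) f))
      (Eval.eval-cong ℤ[ V ] (label vs) (torsionFree-index vs n (eval ℤ[ Index vs ] (index vs) f)
        (≃-trans (≃-sym (Eval.eval-· ℤ[ Index vs ] (index vs) (suc n) f))
                 (Eval.eval-cong ℤ[ Index vs ] (index vs) e)))))
    where
    vs = variables f

∤! : ∀ {p} → Prime p → ∀ {k} → k ℕ.< p → p ∣ k ! → ⊥
∤! pp {zero}  k<p p∣1 with ∣1⇒≡1 p∣1
... | ≡.refl with () ← ℕ.NonTrivial.nonTrivial (prime⇒nonTrivial pp)
∤! pp {suc k} k<p p∣  = [ (λ p∣sk → ℕ.<⇒≱ k<p (∣⇒≤ p∣sk)) , ∤! pp (ℕ.<-trans (ℕ.n<1+n k) k<p) ]′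
  (euclidsLemma (suc k) (k !) pp p∣)

p∣pCk : ∀ {p} → Prime p → ∀ {k} → 0 ℕ.< k → k ℕ.< p → p ∣ p C k
p∣pCk {p} pp {k} 0<k k<p = [ (λ d → d) , (λ d → ⊥-elim ([ ∤! pp k<p , ∤! pp p∸k<p ]′ (euclidsLemma (k !) ((p ℕ.∸ k) !) pp d))) ]′
  (euclidsLemma (p C k) (k ! ℕ.* (p ℕ.∸ k) !) pp (≡.subst (p ∣_) (≡.sym product) (n∣n! p)))
  where
  instance
    _ = prime⇒nonZero pp
    _ = k ℕ.!* (p ℕ.∸ k) !≢0
  p∸k<p : p ℕ.∸ k ℕ.< p
  p∸k<p = ℕ.∸-monoʳ-< 0<k (ℕ.<⇒≤ k<p)
  product : (p C k) ℕ.* (k ! ℕ.* (p ℕ.∸ k) !) ≡ p !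
  product = ≡.trans (≡.cong (λ n → n ℕ.* (k ! ℕ.* (p ℕ.∸ k) !)) (nCk≡n!/k![n-k]! (ℕ.<⇒≤ k<p))) (ℕ.m/n*n≡m (k![n∸k]!∣n! (ℕ.<⇒≤ k<p)))
  n∣n! : ∀ n .⦃ _ : NonZero n ⦄ → n ∣ n !
  n∣n! (suc n) = m∣m*n (n !)

module Congruence (A : CommutativeRing c ℓ) where
  open CommutativeRing A
  open import Algebra.Properties.CommutativeSemiring.Exp commutativeSemiring
  open import Algebra.Properties.Semiring.Mult semiring using (×-assoc-*; ×-congʳ; ×-assocˡ) renaming (_×_ to _·_)
  open import Algebra.Properties.Ring ring using (-‿distribʳ-*; -0#≈0#)
  open import Algebra.Properties.AbelianGroup +-abelianGroup using (⁻¹-∙-comm)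
  open import Algebra.Properties.CommutativeSemiring.Binomial commutativeSemiring using (binomialTerm) renaming (theorem to binomialTheorem)
  open import Algebra.Properties.Semiring.Sum semiring using (sum; sum-init-last)
  open import Algebra.Solver.Ring.NaturalCoefficients.Default commutativeSemiring
    using (solve; _:=_; con) renaming (_:+_ to _⟨+⟩_; _:*_ to _⟨*⟩_)
  open import Relation.Binary.Reasoning.Setoid setoid

  ⟨_⟩ : ℕ → Carrier
  ⟨ n ⟩ = n · 1#

  ⟨⟩*≈· : ∀ n x → ⟨ n ⟩ * x ≈ n · x
  ⟨⟩*≈· n x = trans (×-assoc-* n 1# x) (×-congʳ n (*-identityˡ x))

  infix 4 _≡_mod_
  record _≡_mod_ (a b m : Carrier) : Set (c ⊔ ℓ) where
    constructor _,_
    field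
      quotient : Carrier
      equation : a ≈ b + m * quotient

  module _ {m : Carrier} where

    mod-reflexive : ∀ {a b} → a ≈ b → a ≡ b mod m
    mod-reflexive e = 0# , trans e (sym (trans (+-congˡ (zeroʳ m)) (+-identityʳ _)))

    mod-sym : ∀ {a b} → a ≡ b mod m → b ≡ a mod m
    mod-sym {a} {b} (c , e) = - c , (begin
      b                          ≈⟨ +-identityʳ b ⟨
      b + 0#                     ≈⟨ +-congˡ (-‿inverseʳ (m * c)) ⟨
      b + (m * c + - (m * c))    ≈⟨ +-assoc _ _ _ ⟨
      b + m * c + - (m * c)      ≈⟨ +-cong (sym e) (-‿distribʳ-* m c) ⟩
      a + m * - c                ∎)

    mod-trans : ∀ {a b c} → a ≡ b mod m → b ≡ c mod m → a ≡ c mod m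
    mod-trans {a} {b} {c} (u , e) (v , d) = v + u , (begin
      a                   ≈⟨ e ⟩
      b + m * u           ≈⟨ +-congʳ d ⟩
      c + m * v + m * u   ≈⟨ +-assoc _ _ _ ⟩
      c + (m * v + m * u) ≈⟨ +-congˡ (distribˡ m v u) ⟨
      c + m * (v + u)     ∎)

    mod-+ : ∀ {a b c d} → a ≡ b mod m → c ≡ d mod m → a + c ≡ b + d mod m
    mod-+ {b = b} {d = d} (u , e) (v , f) = u + v , trans (+-cong e f)
      (solve 5 (λ b d m u v → (b ⟨+⟩ m ⟨*⟩ u) ⟨+⟩ (d ⟨+⟩ m ⟨*⟩ v) := b ⟨+⟩ d ⟨+⟩ m ⟨*⟩ (u ⟨+⟩ v)) refl b d m u v)

    mod-* : ∀ {a b c d} → a ≡ b mod m → c ≡ d mod m → a * c ≡ b * d mod m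
    mod-* {b = b} {d = d} (u , e) (v , f) = u * d + b * v + m * (u * v) , trans (*-cong e f)
      (solve 5 (λ b d m u v → (b ⟨+⟩ m ⟨*⟩ u) ⟨*⟩ (d ⟨+⟩ m ⟨*⟩ v) :=
        b ⟨*⟩ d ⟨+⟩ m ⟨*⟩ (u ⟨*⟩ d ⟨+⟩ b ⟨*⟩ v ⟨+⟩ m ⟨*⟩ (u ⟨*⟩ v))) refl b d m u v)

    mod-neg : ∀ {a b} → a ≡ b mod m → - a ≡ - b mod m
    mod-neg {a} {b} (u , e) = - u , trans (-‿cong e) (trans (sym (⁻¹-∙-comm b (m * u))) (+-congˡ (-‿distribʳ-* m u)))

    mod-^ : ∀ {a b} → a ≡ b mod m → ∀ n → a ^ n ≡ b ^ n mod m
    mod-^ e zero    = mod-reflexive refl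
    mod-^ e (suc n) = mod-* e (mod-^ e n)

    mod-cancelʳ : ∀ {a b c d} → a + b ≡ c + d mod m → b ≡ d mod m → a ≡ c mod m
    mod-cancelʳ {a} {b} {c} {d} e f = mod-trans (mod-reflexive (sym (drop a b)))
      (mod-trans (mod-+ e (mod-neg f)) (mod-reflexive (drop c d)))
      where
      drop : ∀ a b → a + b + - b ≈ a
      drop a b = trans (+-assoc _ _ _) (trans (+-congˡ (-‿inverseʳ b)) (+-identityʳ a))

  mod-weaken : ∀ {a b} m n → a ≡ b mod m * n → a ≡ b mod m
  mod-weaken m n (u , e) = n * u , trans e (+-congˡ (*-assoc m n u))

  mod-scale : ∀ {a b m} k → a ≡ b mod m → k * a ≡ k * b mod k * m
  mod-scale {a} {b} {m} k (u , e) = u , trans (*-congˡ e) (trans (distribˡ _ _ _) (+-congˡ (sym (*-assoc _ _ _))))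

  expand : ∀ b x n → ∃ λ e → (b + x) ^ suc n ≈ b ^ suc n + (⟨ suc n ⟩ * (x * b ^ n) + x * x * e)
  expand b x zero    = 0# , solve 2 (λ b x → (b ⟨+⟩ x) ⟨*⟩ con 1 :=
    b ⟨*⟩ con 1 ⟨+⟩ ((con 1 ⟨+⟩ con 0) ⟨*⟩ (x ⟨*⟩ con 1) ⟨+⟩ x ⟨*⟩ x ⟨*⟩ con 0)) refl b x
  expand b x (suc n) with expand b x n
  ... | e , eq = b * e + ⟨ suc n ⟩ * b ^ n + x * e , trans (*-congˡ eq)
    (solve 5 (λ b x B N e →
      (b ⟨+⟩ x) ⟨*⟩ (b ⟨*⟩ B ⟨+⟩ (N ⟨*⟩ (x ⟨*⟩ B) ⟨+⟩ x ⟨*⟩ x ⟨*⟩ e)) :=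
      b ⟨*⟩ (b ⟨*⟩ B) ⟨+⟩ ((con 1 ⟨+⟩ N) ⟨*⟩ (x ⟨*⟩ (b ⟨*⟩ B)) ⟨+⟩ x ⟨*⟩ x ⟨*⟩ (b ⟨*⟩ e ⟨+⟩ N ⟨*⟩ B ⟨+⟩ x ⟨*⟩ e)))
      refl b x (b ^ n) ⟨ suc n ⟩ e)

  frobenius-+ : ∀ {p} → Prime p → ∀ a b → (a + b) ^ p ≡ a ^ p + b ^ p mod ⟨ p ⟩
  frobenius-+ {zero}  pp = ⊥-elim (ℕ.≢-nonZero⁻¹ 0 ⦃ prime⇒nonZero pp ⦄ ≡.refl)
  frobenius-+ {p@(suc q)} pp a b =
    mod-trans (mod-reflexive (binomialTheorem p a b))
    (mod-trans
      (mod-+ (mod-reflexive first)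
        (mod-trans (mod-reflexive (sum-init-last (binomialTerm a b p ∘ Fin.suc)))
          (mod-trans (mod-+ (sum-zero _ middle) (mod-reflexive final)) (mod-reflexive (+-identityˡ _)))))
      (mod-reflexive (+-comm _ _)))
    where
    sum-zero : ∀ {n} (t : Vector.Vector Carrier n) → (∀ i → t i ≡ 0# mod ⟨ p ⟩) → sum t ≡ 0# mod ⟨ p ⟩
    sum-zero {zero}  t e = mod-reflexive refl
    sum-zero {suc n} t e = mod-trans (mod-+ (e Fin.zero) (sum-zero (t ∘ Fin.suc) (e ∘ Fin.suc)))
                                     (mod-reflexive (+-identityʳ 0#))
    term-zero : ∀ k → p ∣ p C Fin.toℕ k → binomialTerm a b p k ≡ 0# mod ⟨ p ⟩
    term-zero k (divides r e) = r · t , (begin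
      (p C Fin.toℕ k) · t  ≡⟨ ≡.cong (_· t) (≡.trans e (ℕ.*-comm r p)) ⟩
      (p ℕ.* r) · t        ≈⟨ ×-assocˡ t p r ⟨
      p · (r · t)          ≈⟨ ⟨⟩*≈· p (r · t) ⟨
      ⟨ p ⟩ * (r · t)      ≈⟨ +-identityˡ _ ⟨
      0# + ⟨ p ⟩ * (r · t) ∎)
      where t = a ^ Fin.toℕ k * b ^ (p ℕ.∸ Fin.toℕ k)
    first : binomialTerm a b p Fin.zero ≈ b ^ p
    first = trans (+-identityʳ _) (*-identityˡ _)
    middle : ∀ (i : Fin q) → binomialTerm a b p (Fin.suc (Fin.inject₁ i)) ≡ 0# mod ⟨ p ⟩
    middle i = term-zero (Fin.suc (Fin.inject₁ i)) (p∣pCk pp (ℕ.s≤s ℕ.z≤n)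
      (ℕ.s≤s (≡.subst (ℕ._< q) (≡.sym (Fin.toℕ-inject₁ i)) (Fin.toℕ<n i))))
    final : binomialTerm a b p (Fin.suc (Fin.fromℕ q)) ≈ a ^ p
    final = begin
      binomialTerm a b p (Fin.suc (Fin.fromℕ q))
        ≡⟨ ≡.cong (λ k → (p C suc k) · (a ^ suc k * b ^ (q ℕ.∸ k))) (Fin.toℕ-fromℕ q) ⟩
      (p C p) · (a ^ p * b ^ (q ℕ.∸ q))
        ≡⟨ ≡.cong₂ (λ m n → m · (a ^ p * b ^ n)) (nCn≡1 p) (ℕ.n∸n≡0 q) ⟩
      a ^ p * 1# + 0#
        ≈⟨ trans (+-identityʳ _) (*-identityʳ _) ⟩
      a ^ p ∎

  -- a ≡ b mod pᵏ⁺¹ implies aᵖ ≡ bᵖ mod pᵏ⁺², and hence the iterated version.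
  mod-^p : ∀ p .⦃ _ : NonZero p ⦄ {a b} k → a ≡ b mod ⟨ p ⟩ ^ suc k → a ^ p ≡ b ^ p mod ⟨ p ⟩ ^ suc (suc k)
  mod-^p p@(suc q) {a} {b} k (c , eq) with expand b (⟨ p ⟩ ^ suc k * c) q
  ... | e , eq′ = c * b ^ q + ⟨ p ⟩ ^ k * c * c * e , trans (^-congˡ p eq) (trans eq′ (+-congˡ
    (solve 5 (λ π r c B e →
      π ⟨*⟩ (π ⟨*⟩ r ⟨*⟩ c ⟨*⟩ B) ⟨+⟩ π ⟨*⟩ r ⟨*⟩ c ⟨*⟩ (π ⟨*⟩ r ⟨*⟩ c) ⟨*⟩ e :=
      π ⟨*⟩ (π ⟨*⟩ r) ⟨*⟩ (c ⟨*⟩ B ⟨+⟩ r ⟨*⟩ c ⟨*⟩ c ⟨*⟩ e))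
      refl ⟨ p ⟩ (⟨ p ⟩ ^ k) c (b ^ q) e)))

  ^-suc : ∀ p x n → x ^ (p ℕ.^ suc n) ≈ (x ^ (p ℕ.^ n)) ^ p
  ^-suc p x n = sym (trans (^-assocʳ x (p ℕ.^ n) p) (^-congʳ x (ℕ.*-comm (p ℕ.^ n) p)))

  mod-^p^ : ∀ p .⦃ _ : NonZero p ⦄ {a b} n → a ≡ b mod ⟨ p ⟩ → a ^ (p ℕ.^ n) ≡ b ^ (p ℕ.^ n) mod ⟨ p ⟩ ^ suc n
  mod-^p^ p {a} {b} zero    (u , e) = u , (begin
    a * 1#                       ≈⟨ *-identityʳ a ⟩
    a                            ≈⟨ e ⟩
    b + ⟨ p ⟩ * u                ≈⟨ +-cong (*-identityʳ b) (*-congʳ (*-identityʳ ⟨ p ⟩)) ⟨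
    b * 1# + ⟨ p ⟩ * 1# * u      ∎)
  mod-^p^ p {a} {b} (suc n) e = mod-trans (mod-reflexive (^-suc p a n))
    (mod-trans (mod-^p p n (mod-^p^ p n e)) (mod-reflexive (sym (^-suc p b n))))

  module _ (torsionFree : TorsionFree A) (p : ℕ) .⦃ _ : NonZero p ⦄ where
    open import Algebra.Properties.Group +-group using (x∙y⁻¹≈ε⇒x≈y)

    ⟨p⟩-cancel : ∀ {a b} → ⟨ p ⟩ * a ≈ ⟨ p ⟩ * b → a ≈ b
    ⟨p⟩-cancel {a} {b} e = x∙y⁻¹≈ε⇒x≈y a b (cancel p (begin
      p · (a + - b)                    ≈⟨ ⟨⟩*≈· p (a + - b) ⟨
      ⟨ p ⟩ * (a + - b)                ≈⟨ distribˡ _ _ _ ⟩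
      ⟨ p ⟩ * a + ⟨ p ⟩ * - b          ≈⟨ +-cong e (sym (-‿distribʳ-* _ _)) ⟩
      ⟨ p ⟩ * b + - (⟨ p ⟩ * b)        ≈⟨ -‿inverseʳ _ ⟩
      0#                               ∎))
      where
      cancel : ∀ p .⦃ _ : NonZero p ⦄ {x} → p · x ≈ 0# → x ≈ 0#
      cancel (suc q) = torsionFree q _

    mod-unscale : ∀ {a b m} → ⟨ p ⟩ * a ≡ ⟨ p ⟩ * b mod ⟨ p ⟩ * m → a ≡ b mod m
    mod-unscale (u , e) = u , ⟨p⟩-cancel (trans e (trans (+-congˡ (*-assoc _ _ _)) (sym (distribˡ _ _ _))))

module Ghost (p : ℕ) (A : CommutativeRing c ℓ) where
  open CommutativeRing A
  open Congruence A
  open import Algebra.Properties.CommutativeSemiring.Exp commutativeSemiring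
  open import Relation.Binary.Reasoning.Setoid setoid

  -- ghost n x = Σ_{j ≤ n} pʲ xⱼ^(pⁿ⁻ʲ)
  ghost : ℕ → (ℕ → Carrier) → Carrier
  ghost zero    x = x 0
  ghost (suc n) x = x 0 ^ (p ℕ.^ suc n) + ⟨ p ⟩ * ghost n (x ∘ suc)

  ghost-cong : ∀ n {x y} → (∀ j → x j ≈ y j) → ghost n x ≈ ghost n y
  ghost-cong zero    e = e 0
  ghost-cong (suc n) e = +-cong (^-congˡ (p ℕ.^ suc n) (e 0)) (*-congˡ (ghost-cong n (e ∘ suc)))

  ghost-suc : ∀ n x → ghost (suc n) x ≈ ghost n (λ j → x j ^ p) + ⟨ p ⟩ ^ suc n * x (suc n)
  ghost-suc zero    x = +-cong (^-congʳ (x 0) (ℕ.*-identityʳ p)) (*-congʳ (sym (*-identityʳ ⟨ p ⟩)))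
  ghost-suc (suc n) x = begin
    x 0 ^ (p ℕ.^ suc (suc n)) + ⟨ p ⟩ * ghost (suc n) (x ∘ suc)
      ≈⟨ +-cong (sym (^-assocʳ (x 0) p (p ℕ.^ suc n)))
           (trans (*-congˡ (ghost-suc n (x ∘ suc))) (trans (distribˡ _ _ _) (+-congˡ (sym (*-assoc _ _ _))))) ⟩
    (x 0 ^ p) ^ (p ℕ.^ suc n) + (⟨ p ⟩ * ghost n (λ j → x (suc j) ^ p) + ⟨ p ⟩ ^ suc (suc n) * x (suc (suc n)))
      ≈⟨ +-assoc _ _ _ ⟨
    ghost (suc n) (λ j → x j ^ p) + ⟨ p ⟩ ^ suc (suc n) * x (suc (suc n)) ∎

  ghost-injective : TorsionFree A → .⦃ _ : NonZero p ⦄ → ∀ {x y} → (∀ n → ghost n x ≈ ghost n y) → ∀ n → x n ≈ y n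
  ghost-injective tf e zero    = e 0
  ghost-injective tf {x} {y} e (suc n) = ghost-injective tf (λ j →
    ⟨p⟩-cancel tf p (∙-cancelˡ (x 0 ^ (p ℕ.^ suc j)) _ _
      (trans (e (suc j)) (+-congʳ (^-congˡ (p ℕ.^ suc j) (sym (e 0))))))) n
    where open import Algebra.Properties.Group +-group using (∙-cancelˡ)

  0^ : ∀ m .⦃ _ : NonZero m ⦄ → 0# ^ m ≈ 0#
  0^ (suc m) = zeroˡ _

  1^ : ∀ m → 1# ^ m ≈ 1#
  1^ zero    = refl
  1^ (suc m) = trans (*-identityˡ _) (1^ m)

  ghost-0 : .⦃ _ : NonZero p ⦄ → ∀ n → ghost n (λ _ → 0#) ≈ 0#
  ghost-0 zero    = refl
  ghost-0 (suc n) = trans (+-cong (0^ (p ℕ.^ suc n) ⦃ ℕ.m^n≢0 p (suc n) ⦄) (trans (*-congˡ (ghost-0 n)) (zeroʳ _))) (+-identityˡ 0#)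

module _ (p : ℕ) (A : CommutativeRing c ℓ) {V : Set} where
  open CommutativeRing A

  eval-ghost : ∀ (ρ : V → Carrier) n x → eval A ρ (Ghost.ghost p ℤ[ V ] n x) ≈ Ghost.ghost p A n (eval A ρ ∘ x)
  eval-ghost ρ zero    x = refl
  eval-ghost ρ (suc n) x = +-cong (Eval.eval-^ A ρ (x 0) (p ℕ.^ suc n))
    (*-cong (Eval.eval-· A ρ p :1) (eval-ghost ρ n (x ∘ suc)))

-- Dwork's lemma: φ lifts the Frobenius of 𝔽ₚ[V], so (gₙ) is the sequence of ghost components
-- of a (unique) sequence in ℤ[V] as soon as gₙ₊₁ ≡ φ(gₙ) mod pⁿ⁺¹.

module Dwork {p : ℕ} (pp : Prime p) {V : Set} (torsionFree : TorsionFree ℤ[ V ]) where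
  open CommutativeRing ℤ[ V ]
  open Congruence ℤ[ V ]
  open Ghost p ℤ[ V ]
  open import Algebra.Properties.CommutativeSemiring.Exp commutativeSemiring
  private
    instance
      p≢0 : NonZero p
      p≢0 = prime⇒nonZero pp

  φ : Poly V → Poly V
  φ = eval ℤ[ V ] (λ v → var v ^ p)

  φ≡^p : ∀ f → φ f ≡ f ^ p mod ⟨ p ⟩
  φ≡^p (var v)  = mod-reflexive refl
  φ≡^p :0       = mod-reflexive (sym (0^ p))
  φ≡^p :1       = mod-reflexive (sym (1^ p))
  φ≡^p (f :+ g) = mod-trans (mod-+ (φ≡^p f) (φ≡^p g)) (mod-sym (frobenius-+ pp f g))
  φ≡^p (f :* g) = mod-trans (mod-* (φ≡^p f) (φ≡^p g)) (mod-reflexive (sym (^-distrib-* f g p)))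
  φ≡^p (:- f)   = mod-trans (mod-neg (φ≡^p f)) (mod-cancelʳ
    (mod-trans (mod-reflexive (trans (-‿inverseˡ (f ^ p)) (trans (sym (0^ p)) (^-congˡ p (sym (-‿inverseˡ f))))))
               (frobenius-+ pp (- f) f))
    (mod-reflexive refl))

  record Target : Set where
    field
      seq  : ℕ → Poly V
      lift : ∀ n → seq (suc n) ≡ φ (seq n) mod ⟨ p ⟩ ^ suc n
  open Target

  module _ (g : Target) where
    head-mod : ∀ n → seq g n ≡ seq g 0 ^ (p ℕ.^ n) mod ⟨ p ⟩
    head-mod zero    = mod-reflexive (sym (*-identityʳ _))
    head-mod (suc n) = mod-trans (mod-weaken ⟨ p ⟩ (⟨ p ⟩ ^ n) (lift g n)) (mod-trans (φ≡^p (seq g n))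
      (mod-trans (mod-^ (head-mod n) p) (mod-reflexive (sym (^-suc p (seq g 0) n)))))

    next-seq : ℕ → Poly V
    next-seq n = _≡_mod_.quotient (head-mod (suc n))

    seq-suc : ∀ n → seq g (suc n) ≈ seq g 0 ^ (p ℕ.^ suc n) + ⟨ p ⟩ * next-seq n
    seq-suc n = _≡_mod_.equation (head-mod (suc n))

    φ-seq-suc : ∀ n → φ (seq g (suc n)) ≈ φ (seq g 0) ^ (p ℕ.^ suc n) + ⟨ p ⟩ * φ (next-seq n)
    φ-seq-suc n = trans (Eval.eval-cong ℤ[ V ] _ (seq-suc n))
      (+-cong (Eval.eval-^ ℤ[ V ] _ (seq g 0) (p ℕ.^ suc n)) (*-congʳ (Eval.eval-· ℤ[ V ] _ p :1)))

    next : Target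
    next .seq    = next-seq
    next .lift n = mod-unscale torsionFree p (mod-cancelʳ
      (mod-trans (mod-reflexive (trans (+-comm _ _) (sym (seq-suc (suc n)))))
        (mod-trans (lift g (suc n)) (mod-reflexive (trans (φ-seq-suc n) (+-comm _ _)))))
      (mod-trans (mod-reflexive (sym (^-assocʳ (seq g 0) p (p ℕ.^ suc n))))
        (mod-sym (mod-^p^ p (suc n) (φ≡^p (seq g 0))))))

  components : Target → ℕ → Poly V
  components g zero    = seq g 0
  components g (suc n) = components (next g) n

  ghost-components : ∀ g n → ghost n (components g) ≈ seq g n
  ghost-components g zero    = refl
  ghost-components g (suc n) = trans (+-congˡ (*-congˡ (ghost-components (next g) n))) (sym (seq-suc g n))

  ghostTarget : (ℕ → V) → Target
  ghostTarget x .seq n  = ghost n (var ∘ x)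
  ghostTarget x .lift n = var (x (suc n)) , trans (ghost-suc n (var ∘ x)) (+-congʳ (sym (eval-ghost p ℤ[ V ] _ n (var ∘ x))))

  _⊞_ _⊠_ : Target → Target → Target
  (g ⊞ h) .seq n  = seq g n + seq h n
  (g ⊞ h) .lift n = mod-+ (lift g n) (lift h n)
  (g ⊠ h) .seq n  = seq g n * seq h n
  (g ⊠ h) .lift n = mod-* (lift g n) (lift h n)

  ⊟_ : Target → Target
  (⊟ g) .seq n  = - seq g n
  (⊟ g) .lift n = mod-neg (lift g n)

module Witt {p : ℕ} (pp : Prime p) where
  private
    instance
      p≢0 : NonZero p
      p≢0 = prime⇒nonZero pp

  Var : ℕ → Set
  Var k = Fin k × ℕ

  torsionFree : ∀ k → TorsionFree ℤ[ Var k ]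
  torsionFree k = Relabel.torsionFree (≡-dec Fin._≟_ ℕ._≟_)

  open module D {k} = Dwork pp (torsionFree k) using (Target; ghostTarget; components; ghost-components; _⊞_; _⊠_; ⊟_)
  open Dwork.Target

  X : ∀ {k} → Fin k → Target {k}
  X i = ghostTarget (i ,_)

  -- The Witt polynomials Sₙ, Pₙ ∈ ℤ[X₀,…,Y₀,…] and Nₙ ∈ ℤ[X₀,…], determined by
  -- ghost n S = ghost n X + ghost n Y, ghost n P = ghost n X · ghost n Y, ghost n N = - ghost n X.
  addition multiplication : ℕ → Poly (Var 2)
  addition       = components (X Fin.zero ⊞ X (Fin.suc Fin.zero))
  multiplication = components (X Fin.zero ⊠ X (Fin.suc Fin.zero))

  negation : ℕ → Poly (Var 1)
  negation = components (⊟ X Fin.zero)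

  module _ (A : CommutativeRing c ℓ) where
    open CommutativeRing A
    open Ghost p A

    infix 4 _≈ᵂ_
    _≈ᵂ_ : (ℕ → Carrier) → (ℕ → Carrier) → Set ℓ
    a ≈ᵂ b = ∀ n → a n ≈ b n

    one : ℕ → Carrier
    one zero    = 1#
    one (suc _) = 0#

    apply : ∀ {k} → (ℕ → Poly (Var k)) → (Fin k → ℕ → Carrier) → ℕ → Carrier
    apply f a n = eval A (λ (i , m) → a i m) (f n)

    infixl 6 _+ᵂ_
    infixl 7 _*ᵂ_
    infix  8 -ᵂ_
    _+ᵂ_ _*ᵂ_ : (ℕ → Carrier) → (ℕ → Carrier) → (ℕ → Carrier)
    a +ᵂ b = apply addition (a Vector.∷ b Vector.∷ Vector.[])
    a *ᵂ b = apply multiplication (a Vector.∷ b Vector.∷ Vector.[])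

    -ᵂ_ : (ℕ → Carrier) → (ℕ → Carrier)
    -ᵂ a = apply negation (a Vector.∷ Vector.[])

    apply-cong : ∀ {k} f {a b : Fin k → ℕ → Carrier} → (∀ i → a i ≈ᵂ b i) → apply f a ≈ᵂ apply f b
    apply-cong f e n = Eval.eval-ext A (λ (i , m) → e i m) (f n)

    ghost-apply : ∀ {k} (g : Target {k}) a n → ghost n (apply (components g) a) ≈ eval A (λ (i , m) → a i m) (seq g n)
    ghost-apply g a n = trans (sym (eval-ghost p A _ n (components g))) (Eval.eval-cong A _ (ghost-components g n))

    ghost-one : ∀ n → ghost n one ≈ 1#
    ghost-one zero    = refl
    ghost-one (suc n) = trans (+-cong (1^ (p ℕ.^ suc n)) (trans (*-congˡ (ghost-0 n)) (zeroʳ _))) (+-identityʳ 1#)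

    ghost-X : ∀ {k} (a : Fin k → ℕ → Carrier) i n → eval A (λ (i , m) → a i m) (seq (X i) n) ≈ ghost n (a i)
    ghost-X a i n = eval-ghost p A _ n (var ∘ (i ,_))

    ghost-+ : ∀ a b n → ghost n (a +ᵂ b) ≈ ghost n a + ghost n b
    ghost-+ a b n = trans (ghost-apply _ v n) (+-cong (ghost-X v Fin.zero n) (ghost-X v (Fin.suc Fin.zero) n))
      where v = a Vector.∷ b Vector.∷ Vector.[]

    ghost-* : ∀ a b n → ghost n (a *ᵂ b) ≈ ghost n a * ghost n b
    ghost-* a b n = trans (ghost-apply _ v n) (*-cong (ghost-X v Fin.zero n) (ghost-X v (Fin.suc Fin.zero) n))
      where v = a Vector.∷ b Vector.∷ Vector.[]

    ghost-neg : ∀ a n → ghost n (-ᵂ a) ≈ - ghost n a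
    ghost-neg a n = trans (ghost-apply _ v n) (-‿cong (ghost-X v Fin.zero n))
      where v = a Vector.∷ Vector.[]

    +ᵂ-cong : ∀ {a b c d} → a ≈ᵂ b → c ≈ᵂ d → a +ᵂ c ≈ᵂ b +ᵂ d
    +ᵂ-cong e f = apply-cong addition λ { Fin.zero → e ; (Fin.suc Fin.zero) → f }

    *ᵂ-cong : ∀ {a b c d} → a ≈ᵂ b → c ≈ᵂ d → a *ᵂ c ≈ᵂ b *ᵂ d
    *ᵂ-cong e f = apply-cong multiplication λ { Fin.zero → e ; (Fin.suc Fin.zero) → f }

    -ᵂ-cong : ∀ {a b} → a ≈ᵂ b → -ᵂ a ≈ᵂ -ᵂ b
    -ᵂ-cong e = apply-cong negation λ { Fin.zero → e }

    evalᵂ : ∀ {k} → (Fin k → ℕ → Carrier) → Poly (Fin k) → ℕ → Carrier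
    evalᵂ a (var i)  = a i
    evalᵂ a :0       = λ _ → 0#
    evalᵂ a :1       = one
    evalᵂ a (s :+ t) = evalᵂ a s +ᵂ evalᵂ a t
    evalᵂ a (s :* t) = evalᵂ a s *ᵂ evalᵂ a t
    evalᵂ a (:- t)   = -ᵂ evalᵂ a t

    ghost-evalᵂ : ∀ {k} (a : Fin k → ℕ → Carrier) t n → ghost n (evalᵂ a t) ≈ eval A (ghost n ∘ a) t
    ghost-evalᵂ a (var i)  n = refl
    ghost-evalᵂ a :0       n = ghost-0 n
    ghost-evalᵂ a :1       n = ghost-one n
    ghost-evalᵂ a (s :+ t) n = trans (ghost-+ (evalᵂ a s) (evalᵂ a t) n) (+-cong (ghost-evalᵂ a s n) (ghost-evalᵂ a t n))
    ghost-evalᵂ a (s :* t) n = trans (ghost-* (evalᵂ a s) (evalᵂ a t) n) (*-cong (ghost-evalᵂ a s n) (ghost-evalᵂ a t n))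
    ghost-evalᵂ a (:- t)   n = trans (ghost-neg (evalᵂ a t) n) (-‿cong (ghost-evalᵂ a t n))

  module _ (A : CommutativeRing c ℓ) {V : Set} (ρ : V → CommutativeRing.Carrier A) where
    open CommutativeRing A
    private U = ℤ[ V ]

    eval-apply : ∀ {k} f (a : Fin k → ℕ → Poly V) n →
                 eval A ρ (apply U f a n) ≈ apply A f (λ i m → eval A ρ (a i m)) n
    eval-apply f a n = eval-∘ A ρ _ (f n)

    eval-evalᵂ : ∀ {k} (a : Fin k → ℕ → Poly V) t n →
                 eval A ρ (evalᵂ U a t n) ≈ evalᵂ A (λ i m → eval A ρ (a i m)) t n
    eval-evalᵂ a (var i)  n = refl
    eval-evalᵂ a :0       n = refl
    eval-evalᵂ a :1       zero    = refl
    eval-evalᵂ a :1       (suc n) = refl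
    eval-evalᵂ a (s :+ t) n = trans (eval-apply addition _ n) (apply-cong A addition
      (λ { Fin.zero → eval-evalᵂ a s ; (Fin.suc Fin.zero) → eval-evalᵂ a t }) n)
    eval-evalᵂ a (s :* t) n = trans (eval-apply multiplication _ n) (apply-cong A multiplication
      (λ { Fin.zero → eval-evalᵂ a s ; (Fin.suc Fin.zero) → eval-evalᵂ a t }) n)
    eval-evalᵂ a (:- t)   n = trans (eval-apply negation _ n) (apply-cong A negation
      (λ { Fin.zero → eval-evalᵂ a t }) n)

  module _ (A : CommutativeRing c ℓ) where
    open CommutativeRing A

    evalᵂ-cong : ∀ {k} (a : Fin k → ℕ → Carrier) {s t} → s ≃ t → _≈ᵂ_ A (evalᵂ A a s) (evalᵂ A a t)
    evalᵂ-cong {k} a {s} {t} e n = trans (sym (eval-evalᵂ A ρ x s n)) (trans (Eval.eval-cong A ρ universal) (eval-evalᵂ A ρ x t n))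
      where
      U = ℤ[ Var k ]
      x : Fin k → ℕ → Poly (Var k)
      x i m = var (i , m)
      ρ : Var k → Carrier
      ρ (i , m) = a i m
      universal : evalᵂ U x s n ≃ evalᵂ U x t n
      universal = Ghost.ghost-injective p U (torsionFree k) (λ j → ≃-trans (ghost-evalᵂ U x s j)
        (≃-trans (Eval.eval-cong U _ e) (≃-sym (ghost-evalᵂ U x t j)))) n

    private
      x₀ x₁ x₂ : Poly (Fin 3)
      x₀ = var Fin.zero
      x₁ = var (Fin.suc Fin.zero)
      x₂ = var (Fin.suc (Fin.suc Fin.zero))

      law : ∀ {s t : Poly (Fin 3)} → s ≃ t → ∀ a b c → _≈ᵂ_ A (evalᵂ A (a Vector.∷ b Vector.∷ c Vector.∷ Vector.[]) s)
                                                          (evalᵂ A (a Vector.∷ b Vector.∷ c Vector.∷ Vector.[]) t)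
      law e a b c = evalᵂ-cong (a Vector.∷ b Vector.∷ c Vector.∷ Vector.[]) e

      module F = CommutativeRing ℤ[ Fin 3 ]
      𝟘 : ℕ → Carrier
      𝟘 _ = 0#

    -- The ring of p-typical Witt vectors of A.
    W : CommutativeRing c ℓ
    W = record
      { Carrier = ℕ → Carrier
      ; _≈_ = _≈ᵂ_ A
      ; _+_ = _+ᵂ_ A
      ; _*_ = _*ᵂ_ A
      ; -_  = -ᵂ_ A
      ; 0#  = 𝟘
      ; 1#  = one A
      ; isCommutativeRing = record
        { isRing = record
          { +-isAbelianGroup = record
            { isGroup = record
              { isMonoid = record
                { isSemigroup = record
                  { isMagma = record
                    { isEquivalence = record
                      { refl = λ _ → refl ; sym = λ e n → sym (e n) ; trans = λ e d n → trans (e n) (d n) }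
                    ; ∙-cong = +ᵂ-cong A
                    }
                  ; assoc = law (F.+-assoc x₀ x₁ x₂)
                  }
                ; identity = (λ a → law (F.+-identityˡ x₀) a 𝟘 𝟘) , (λ a → law (F.+-identityʳ x₀) a 𝟘 𝟘)
                }
              ; inverse = (λ a → law (F.-‿inverseˡ x₀) a 𝟘 𝟘) , (λ a → law (F.-‿inverseʳ x₀) a 𝟘 𝟘)
              ; ⁻¹-cong = -ᵂ-cong A
              }
            ; comm = λ a b → law (F.+-comm x₀ x₁) a b 𝟘
            }
          ; *-cong = *ᵂ-cong A
          ; *-assoc = law (F.*-assoc x₀ x₁ x₂)
          ; *-identity = (λ a → law (F.*-identityˡ x₀) a 𝟘 𝟘) , (λ a → law (F.*-identityʳ x₀) a 𝟘 𝟘)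
          ; distrib = law (F.distribˡ x₀ x₁ x₂) , law (F.distribʳ x₀ x₁ x₂)
          }
        ; *-comm = λ a b → law (F.*-comm x₀ x₁) a b 𝟘
        }
      }

-- Classically, a Heyting field is a field: the apartness is tight and x # y holds exactly when
-- x - y is invertible; in particular 0# and 1# are distinct.
fieldRing : HeytingField c ℓ₁ ℓ₂ → CommutativeRing c ℓ₁
fieldRing k = HeytingCommutativeRing.commutativeRing (HeytingField.heytingCommutativeRing k)

HasCharacteristic : CommutativeRing c ℓ → ℕ → Set ℓ
HasCharacteristic A p = ∀ n → (n · 1# ≈ 0#) ⇔ (p ∣ n)
  where
  open CommutativeRing A
  open import Algebra.Properties.Semiring.Mult semiring renaming (_×_ to _·_)

IsPerfect : CommutativeRing c ℓ → ℕ → Set (c ⊔ ℓ)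
IsPerfect A p = ∀ x → ∃ λ y → y ^ p ≈ x
  where
  open CommutativeRing A
  open import Algebra.Properties.Semiring.Exp semiring using (_^_)

module _ {R : CommutativeRing c ℓ} where
  open CommutativeRing R using (Carrier; _≈_; 0#; 1#)

  module _ (M : Module R m ℓm) where
    open Module M
    open import Algebra.Properties.Monoid.Sum +ᴹ-monoid using (sum)
    open import Algebra.Properties.Monoid.Mult +ᴹ-monoid renaming (_×_ to _·_)

    IsZero : Set (m ⊔ ℓm)
    IsZero = ∀ x → x ≈ᴹ 0ᴹ

    -- The usual notion over an integral domain, such as W(k).
    IsTorsion : Carrierᴹ → Set (c ⊔ ℓ ⊔ ℓm)
    IsTorsion x = ∃ λ a → ¬ a ≈ 0# × a *ₗ x ≈ᴹ 0ᴹ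

    TorsionIsZero : Set (c ⊔ ℓ ⊔ m ⊔ ℓm)
    TorsionIsZero = ∀ x → IsTorsion x → x ≈ᴹ 0ᴹ

    record IsBasis {n : ℕ} (e : Fin n → Carrierᴹ) : Set (c ⊔ ℓ ⊔ m ⊔ ℓm) where
      field
        spanning    : ∀ x → ∃ λ (a : Fin n → Carrier) → x ≈ᴹ sum (λ j → a j *ₗ e j)
        independent : ∀ (a : Fin n → Carrier) → sum (λ j → a j *ₗ e j) ≈ᴹ 0ᴹ → ∀ j → a j ≈ 0#

    IsFiniteFree : Set (c ⊔ ℓ ⊔ m ⊔ ℓm)
    IsFiniteFree = ∃ λ n → ∃ λ (e : Fin n → Carrierᴹ) → IsBasis e

    infixr 7 _·ℤ_
    _·ℤ_ : ℤ → Carrierᴹ → Carrierᴹ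
    (+ n)    ·ℤ x = n · x
    -[1+ n ] ·ℤ x = -ᴹ (suc n · x)

  module Cokernel (M N : Module R m ℓm) (f : Module.Carrierᴹ M → Module.Carrierᴹ N)
                  (hom : IsModuleHomomorphism (Module.rawModule M) (Module.rawModule N) f) where
    private
      module M = Module M
    open Module N
    open IsModuleHomomorphism hom
    open import Algebra.Properties.AbelianGroup +ᴹ-abelianGroup using (⁻¹-anti-homo‿-; ⁻¹-∙-comm; ε⁻¹≈ε)
    open import Algebra.Properties.CommutativeSemigroup (CommutativeMonoid.commutativeSemigroup +ᴹ-commutativeMonoid) using (interchange)
    open import Relation.Binary.Reasoning.Setoid ≈ᴹ-setoid

    infix 4 _∼_
    _∼_ : Carrierᴹ → Carrierᴹ → Set (m ⊔ ℓm)
    x ∼ y = ∃ λ z → x +ᴹ -ᴹ y ≈ᴹ f z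

    ∼-reflexive : ∀ {x y} → x ≈ᴹ y → x ∼ y
    ∼-reflexive {x} {y} e = M.0ᴹ , ≈ᴹ-trans (+ᴹ-congʳ e) (≈ᴹ-trans (-ᴹ‿inverseʳ y) (≈ᴹ-sym 0ᴹ-homo))

    ∼-sym : ∀ {x y} → x ∼ y → y ∼ x
    ∼-sym {x} {y} (z , e) = M.-ᴹ z , (begin
      y +ᴹ -ᴹ x       ≈⟨ ⁻¹-anti-homo‿- x y ⟨
      -ᴹ (x +ᴹ -ᴹ y)  ≈⟨ -ᴹ‿cong e ⟩
      -ᴹ f z          ≈⟨ -ᴹ-homo z ⟨
      f (M.-ᴹ z)      ∎)

    ∼-trans : ∀ {x y z} → x ∼ y → y ∼ z → x ∼ z
    ∼-trans {x} {y} {z} (u , e) (v , d) = u M.+ᴹ v , (begin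
      x +ᴹ -ᴹ z                       ≈⟨ +ᴹ-congʳ (+ᴹ-identityʳ x) ⟨
      x +ᴹ 0ᴹ +ᴹ -ᴹ z                 ≈⟨ +ᴹ-congʳ (+ᴹ-congˡ (-ᴹ‿inverseˡ y)) ⟨
      x +ᴹ (-ᴹ y +ᴹ y) +ᴹ -ᴹ z        ≈⟨ +ᴹ-congʳ (+ᴹ-assoc x (-ᴹ y) y) ⟨
      x +ᴹ -ᴹ y +ᴹ y +ᴹ -ᴹ z          ≈⟨ +ᴹ-assoc _ y (-ᴹ z) ⟩
      (x +ᴹ -ᴹ y) +ᴹ (y +ᴹ -ᴹ z)      ≈⟨ +ᴹ-cong e d ⟩
      f u +ᴹ f v                      ≈⟨ +ᴹ-homo u v ⟨
      f (u M.+ᴹ v)                    ∎)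

    ∼-+-cong : ∀ {x y u v} → x ∼ y → u ∼ v → (x +ᴹ u) ∼ (y +ᴹ v)
    ∼-+-cong {x} {y} {u} {v} (a , e) (b , d) = a M.+ᴹ b , (begin
      x +ᴹ u +ᴹ -ᴹ (y +ᴹ v)           ≈⟨ +ᴹ-congˡ (⁻¹-∙-comm y v) ⟨
      x +ᴹ u +ᴹ (-ᴹ y +ᴹ -ᴹ v)        ≈⟨ interchange x u (-ᴹ y) (-ᴹ v) ⟩
      (x +ᴹ -ᴹ y) +ᴹ (u +ᴹ -ᴹ v)      ≈⟨ +ᴹ-cong e d ⟩
      f a +ᴹ f b                      ≈⟨ +ᴹ-homo a b ⟨
      f (a M.+ᴹ b)                    ∎)

    ∼-neg-cong : ∀ {x y} → x ∼ y → (-ᴹ x) ∼ (-ᴹ y)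
    ∼-neg-cong {x} {y} (a , e) = M.-ᴹ a , ≈ᴹ-trans (⁻¹-∙-comm x (-ᴹ y)) (≈ᴹ-trans (-ᴹ‿cong e) (≈ᴹ-sym (-ᴹ-homo a)))

    ∼-*-cong : ∀ {r s x y} → r ≈ s → x ∼ y → (r *ₗ x) ∼ (s *ₗ y)
    ∼-*-cong {r} {s} {x} {y} r≈s (a , e) = ∼-trans (∼-reflexive (*ₗ-congʳ r≈s)) (s M.*ₗ a , (begin
      s *ₗ x +ᴹ -ᴹ (s *ₗ y)     ≈⟨ +ᴹ-congˡ (neg y) ⟨
      s *ₗ x +ᴹ s *ₗ (-ᴹ y)     ≈⟨ *ₗ-distribˡ s x (-ᴹ y) ⟨
      s *ₗ (x +ᴹ -ᴹ y)          ≈⟨ *ₗ-congˡ e ⟩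
      s *ₗ f a                  ≈⟨ *ₗ-homo s a ⟨
      f (s M.*ₗ a)              ∎))
      where
      open import Algebra.Properties.Group +ᴹ-group using (inverseʳ-unique)
      neg : ∀ y → s *ₗ (-ᴹ y) ≈ᴹ -ᴹ (s *ₗ y)
      neg y = inverseʳ-unique (s *ₗ y) (s *ₗ (-ᴹ y))
        (≈ᴹ-trans (≈ᴹ-sym (*ₗ-distribˡ s y (-ᴹ y))) (≈ᴹ-trans (*ₗ-congˡ (-ᴹ‿inverseʳ y)) (*ₗ-zeroʳ s)))

    cokernel : Module R m (m ⊔ ℓm)
    cokernel = record
      { Carrierᴹ = Carrierᴹ
      ; _≈ᴹ_ = _∼_
      ; _+ᴹ_ = _+ᴹ_
      ; _*ₗ_ = _*ₗ_
      ; _*ᵣ_ = λ x r → r *ₗ x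
      ; 0ᴹ   = 0ᴹ
      ; -ᴹ_  = -ᴹ_
      ; isModule = IsModuleFromLeft.isModule {commutativeRing = R} (record { isLeftModule = record
        { isLeftSemimodule = record
          { +ᴹ-isCommutativeMonoid = record
            { isMonoid = record
              { isSemigroup = record
                { isMagma = record
                  { isEquivalence = record { refl = ∼-reflexive ≈ᴹ-refl ; sym = ∼-sym ; trans = ∼-trans }
                  ; ∙-cong = ∼-+-cong
                  }
                ; assoc = λ x y z → ∼-reflexive (+ᴹ-assoc x y z)
                }
              ; identity = (λ x → ∼-reflexive (+ᴹ-identityˡ x)) , (λ x → ∼-reflexive (+ᴹ-identityʳ x))
              }
            ; comm = λ x y → ∼-reflexive (+ᴹ-comm x y)
            }
          ; isPreleftSemimodule = record
            { *ₗ-cong = ∼-*-cong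
            ; *ₗ-zeroˡ = λ x → ∼-reflexive (*ₗ-zeroˡ x)
            ; *ₗ-distribʳ = λ x r s → ∼-reflexive (*ₗ-distribʳ x r s)
            ; *ₗ-identityˡ = λ x → ∼-reflexive (*ₗ-identityˡ x)
            ; *ₗ-assoc = λ r s x → ∼-reflexive (*ₗ-assoc r s x)
            ; *ₗ-zeroʳ = λ r → ∼-reflexive (*ₗ-zeroʳ r)
            ; *ₗ-distribˡ = λ r x y → ∼-reflexive (*ₗ-distribˡ r x y)
            }
          }
        ; -ᴹ‿cong = ∼-neg-cong
        ; -ᴹ‿inverse = (λ x → ∼-reflexive (-ᴹ‿inverseˡ x)) , (λ x → ∼-reflexive (-ᴹ‿inverseʳ x))
        } })
      }

  -- M[1/s]; the pair (x , a) stands for x / sᵃ.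
  module Localisation (M : Module R m ℓm) (s : Carrier) where
    open Module M
    open CommutativeRing R using (semiring; *-comm; _*_)
    open import Algebra.Properties.Semiring.Exp semiring using (_^_; ^-homo-*; ^-congʳ)
    open import Algebra.Properties.CommutativeSemigroup (CommutativeMonoid.commutativeSemigroup +ᴹ-commutativeMonoid) using (interchange)
    open import Relation.Binary.Reasoning.Setoid ≈ᴹ-setoid

    pow : ℕ → Carrierᴹ → Carrierᴹ
    pow a x = s ^ a *ₗ x

    infix 4 _∼_
    _∼_ : Carrierᴹ × ℕ → Carrierᴹ × ℕ → Set ℓm
    (x , a) ∼ (y , b) = ∃ λ k → pow (k ℕ.+ b) x ≈ᴹ pow (k ℕ.+ a) y

    _+ˡ_ : Carrierᴹ × ℕ → Carrierᴹ × ℕ → Carrierᴹ × ℕ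
    (x , a) +ˡ (y , b) = pow b x +ᴹ pow a y , a ℕ.+ b

    -ˡ_ : Carrierᴹ × ℕ → Carrierᴹ × ℕ
    -ˡ (x , a) = -ᴹ x , a

    _*ˡ_ : Carrier → Carrierᴹ × ℕ → Carrierᴹ × ℕ
    r *ˡ (x , a) = r *ₗ x , a

    pow-cong : ∀ a {x y} → x ≈ᴹ y → pow a x ≈ᴹ pow a y
    pow-cong a = *ₗ-congˡ

    pow-pow : ∀ a b x → pow a (pow b x) ≈ᴹ pow (a ℕ.+ b) x
    pow-pow a b x = ≈ᴹ-trans (≈ᴹ-sym (*ₗ-assoc (s ^ a) (s ^ b) x)) (*ₗ-congʳ (CommutativeRing.sym R (^-homo-* s a b)))

    pow-≡ : ∀ {a b} x → a ≡ b → pow a x ≈ᴹ pow b x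
    pow-≡ x ≡.refl = ≈ᴹ-refl

    regroup : ∀ a b c d x → a ℕ.+ b ≡ c ℕ.+ d → pow a (pow b x) ≈ᴹ pow c (pow d x)
    regroup a b c d x e = ≈ᴹ-trans (pow-pow a b x) (≈ᴹ-trans (pow-≡ x e) (≈ᴹ-sym (pow-pow c d x)))

    pow-+ : ∀ a x y → pow a (x +ᴹ y) ≈ᴹ pow a x +ᴹ pow a y
    pow-+ a = *ₗ-distribˡ (s ^ a)

    pow-* : ∀ a r x → pow a (r *ₗ x) ≈ᴹ r *ₗ pow a x
    pow-* a r x = *ₗ-comm (s ^ a) r x

    pow-neg : ∀ a x → pow a (-ᴹ x) ≈ᴹ -ᴹ pow a x
    pow-neg a x = inverseʳ-unique (pow a x) (pow a (-ᴹ x))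
      (≈ᴹ-trans (≈ᴹ-sym (pow-+ a x (-ᴹ x))) (≈ᴹ-trans (pow-cong a (-ᴹ‿inverseʳ x)) (*ₗ-zeroʳ _)))
      where open import Algebra.Properties.Group +ᴹ-group using (inverseʳ-unique)

    same : ∀ {x y a b} → a ≡ b → x ≈ᴹ y → (x , a) ∼ (y , b)
    same {a = a} ≡.refl e = 0 , pow-cong a e

    zero∼ : ∀ {x} a → x ≈ᴹ 0ᴹ → (x , a) ∼ (0ᴹ , 0)
    zero∼ a e = 0 , ≈ᴹ-trans (*ₗ-congˡ e) (≈ᴹ-trans (*ₗ-zeroʳ _) (≈ᴹ-sym (*ₗ-zeroʳ _)))

    ∼-sym : ∀ {u v} → u ∼ v → v ∼ u
    ∼-sym (k , e) = k , ≈ᴹ-sym e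

    ∼-trans : ∀ {u v w} → u ∼ v → v ∼ w → u ∼ w
    ∼-trans {x , a} {y , b} {z , c} (k , e) (l , d) = k ℕ.+ l ℕ.+ b , (begin
      pow (k ℕ.+ l ℕ.+ b ℕ.+ c) x          ≈⟨ pow-≡ x (i₁ k l b c) ⟩
      pow ((l ℕ.+ c) ℕ.+ (k ℕ.+ b)) x      ≈⟨ pow-pow (l ℕ.+ c) (k ℕ.+ b) x ⟨
      pow (l ℕ.+ c) (pow (k ℕ.+ b) x)      ≈⟨ pow-cong (l ℕ.+ c) e ⟩
      pow (l ℕ.+ c) (pow (k ℕ.+ a) y)      ≈⟨ regroup (l ℕ.+ c) (k ℕ.+ a) (k ℕ.+ a) (l ℕ.+ c) y (ℕ.+-comm (l ℕ.+ c) (k ℕ.+ a)) ⟩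
      pow (k ℕ.+ a) (pow (l ℕ.+ c) y)      ≈⟨ pow-cong (k ℕ.+ a) d ⟩
      pow (k ℕ.+ a) (pow (l ℕ.+ b) z)      ≈⟨ pow-pow (k ℕ.+ a) (l ℕ.+ b) z ⟩
      pow ((k ℕ.+ a) ℕ.+ (l ℕ.+ b)) z      ≈⟨ pow-≡ z (i₂ k l a b) ⟩
      pow (k ℕ.+ l ℕ.+ b ℕ.+ a) z          ∎)
      where
      i₁ : ∀ k l b c → k ℕ.+ l ℕ.+ b ℕ.+ c ≡ (l ℕ.+ c) ℕ.+ (k ℕ.+ b)
      i₁ = solve-∀
      i₂ : ∀ k l a b → (k ℕ.+ a) ℕ.+ (l ℕ.+ b) ≡ k ℕ.+ l ℕ.+ b ℕ.+ a
      i₂ = solve-∀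

    ∼-+-cong : ∀ {u u′ v v′} → u ∼ u′ → v ∼ v′ → (u +ˡ v) ∼ (u′ +ˡ v′)
    ∼-+-cong {x , a} {x′ , a′} {y , b} {y′ , b′} (k , e) (l , d) = k ℕ.+ l , (begin
      pow (k ℕ.+ l ℕ.+ (a′ ℕ.+ b′)) (pow b x +ᴹ pow a y)
        ≈⟨ pow-+ (k ℕ.+ l ℕ.+ (a′ ℕ.+ b′)) _ _ ⟩
      pow (k ℕ.+ l ℕ.+ (a′ ℕ.+ b′)) (pow b x) +ᴹ pow (k ℕ.+ l ℕ.+ (a′ ℕ.+ b′)) (pow a y)
        ≈⟨ +ᴹ-cong (regroup (k ℕ.+ l ℕ.+ (a′ ℕ.+ b′)) b (l ℕ.+ b′ ℕ.+ b) (k ℕ.+ a′) x (i₁ k l a′ b b′))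
                   (regroup (k ℕ.+ l ℕ.+ (a′ ℕ.+ b′)) a (k ℕ.+ a′ ℕ.+ a) (l ℕ.+ b′) y (i₂ k l a a′ b′)) ⟩
      pow (l ℕ.+ b′ ℕ.+ b) (pow (k ℕ.+ a′) x) +ᴹ pow (k ℕ.+ a′ ℕ.+ a) (pow (l ℕ.+ b′) y)
        ≈⟨ +ᴹ-cong (pow-cong (l ℕ.+ b′ ℕ.+ b) e) (pow-cong (k ℕ.+ a′ ℕ.+ a) d) ⟩
      pow (l ℕ.+ b′ ℕ.+ b) (pow (k ℕ.+ a) x′) +ᴹ pow (k ℕ.+ a′ ℕ.+ a) (pow (l ℕ.+ b) y′)
        ≈⟨ +ᴹ-cong (regroup (l ℕ.+ b′ ℕ.+ b) (k ℕ.+ a) (k ℕ.+ l ℕ.+ (a ℕ.+ b)) b′ x′ (i₃ k l a b b′))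
                   (regroup (k ℕ.+ a′ ℕ.+ a) (l ℕ.+ b) (k ℕ.+ l ℕ.+ (a ℕ.+ b)) a′ y′ (i₄ k l a a′ b)) ⟩
      pow (k ℕ.+ l ℕ.+ (a ℕ.+ b)) (pow b′ x′) +ᴹ pow (k ℕ.+ l ℕ.+ (a ℕ.+ b)) (pow a′ y′)
        ≈⟨ pow-+ (k ℕ.+ l ℕ.+ (a ℕ.+ b)) _ _ ⟨
      pow (k ℕ.+ l ℕ.+ (a ℕ.+ b)) (pow b′ x′ +ᴹ pow a′ y′) ∎)
      where
      i₁ : ∀ k l a′ b b′ → k ℕ.+ l ℕ.+ (a′ ℕ.+ b′) ℕ.+ b ≡ l ℕ.+ b′ ℕ.+ b ℕ.+ (k ℕ.+ a′)
      i₁ = solve-∀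
      i₂ : ∀ k l a a′ b′ → k ℕ.+ l ℕ.+ (a′ ℕ.+ b′) ℕ.+ a ≡ k ℕ.+ a′ ℕ.+ a ℕ.+ (l ℕ.+ b′)
      i₂ = solve-∀
      i₃ : ∀ k l a b b′ → l ℕ.+ b′ ℕ.+ b ℕ.+ (k ℕ.+ a) ≡ k ℕ.+ l ℕ.+ (a ℕ.+ b) ℕ.+ b′
      i₃ = solve-∀
      i₄ : ∀ k l a a′ b → k ℕ.+ a′ ℕ.+ a ℕ.+ (l ℕ.+ b) ≡ k ℕ.+ l ℕ.+ (a ℕ.+ b) ℕ.+ a′
      i₄ = solve-∀

    +ˡ-assoc : ∀ u v w → ((u +ˡ v) +ˡ w) ∼ (u +ˡ (v +ˡ w))
    +ˡ-assoc (x , a) (y , b) (z , c) = same (ℕ.+-assoc a b c) (begin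
      pow c (pow b x +ᴹ pow a y) +ᴹ pow (a ℕ.+ b) z
        ≈⟨ +ᴹ-cong (≈ᴹ-trans (pow-+ c _ _) (+ᴹ-cong
             (≈ᴹ-trans (pow-pow c b x) (pow-≡ x (ℕ.+-comm c b)))
             (regroup c a a c y (ℕ.+-comm c a)))) (≈ᴹ-sym (pow-pow a b z)) ⟩
      pow (b ℕ.+ c) x +ᴹ pow a (pow c y) +ᴹ pow a (pow b z)
        ≈⟨ +ᴹ-assoc _ _ _ ⟩
      pow (b ℕ.+ c) x +ᴹ (pow a (pow c y) +ᴹ pow a (pow b z))
        ≈⟨ +ᴹ-congˡ (pow-+ a _ _) ⟨
      pow (b ℕ.+ c) x +ᴹ pow a (pow c y +ᴹ pow b z) ∎)

    +ˡ-comm : ∀ u v → (u +ˡ v) ∼ (v +ˡ u)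
    +ˡ-comm (x , a) (y , b) = same (ℕ.+-comm a b) (+ᴹ-comm _ _)

    +ˡ-identityˡ : ∀ u → ((0ᴹ , 0) +ˡ u) ∼ u
    +ˡ-identityˡ (x , a) = same ≡.refl
      (≈ᴹ-trans (+ᴹ-cong (*ₗ-zeroʳ _) (*ₗ-identityˡ x)) (+ᴹ-identityˡ x))

    +ˡ-inverseˡ : ∀ u → ((-ˡ u) +ˡ u) ∼ (0ᴹ , 0)
    +ˡ-inverseˡ (x , a) = zero∼ (a ℕ.+ a) (≈ᴹ-trans (+ᴹ-congʳ (pow-neg a x)) (-ᴹ‿inverseˡ _))

    -ˡ-cong : ∀ {u v} → u ∼ v → (-ˡ u) ∼ (-ˡ v)
    -ˡ-cong {x , a} {y , b} (k , e) = k , ≈ᴹ-trans (pow-neg (k ℕ.+ b) x) (≈ᴹ-trans (-ᴹ‿cong e) (≈ᴹ-sym (pow-neg (k ℕ.+ a) y)))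

    *ˡ-cong : ∀ {r t u v} → r ≈ t → u ∼ v → (r *ˡ u) ∼ (t *ˡ v)
    *ˡ-cong {r} {t} {x , a} {y , b} r≈t (k , e) =
      k , ≈ᴹ-trans (pow-* (k ℕ.+ b) r x) (≈ᴹ-trans (*ₗ-cong r≈t e) (≈ᴹ-sym (pow-* (k ℕ.+ a) t y)))

    *ˡ-distribʳ : ∀ u r t → ((CommutativeRing._+_ R r t) *ˡ u) ∼ ((r *ˡ u) +ˡ (t *ˡ u))
    *ˡ-distribʳ (x , a) r t = 0 , (begin
      pow (a ℕ.+ a) (CommutativeRing._+_ R r t *ₗ x)        ≈⟨ *ₗ-congˡ (*ₗ-distribʳ x r t) ⟩
      pow (a ℕ.+ a) (r *ₗ x +ᴹ t *ₗ x)                      ≈⟨ pow-pow a a _ ⟨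
      pow a (pow a (r *ₗ x +ᴹ t *ₗ x))                      ≈⟨ pow-cong a (pow-+ a _ _) ⟩
      pow a (pow a (r *ₗ x) +ᴹ pow a (t *ₗ x))              ∎)

    *ˡ-distribˡ : ∀ r u v → (r *ˡ (u +ˡ v)) ∼ ((r *ˡ u) +ˡ (r *ˡ v))
    *ˡ-distribˡ r (x , a) (y , b) = same ≡.refl
      (≈ᴹ-trans (*ₗ-distribˡ r _ _) (+ᴹ-cong (≈ᴹ-sym (pow-* b r x)) (≈ᴹ-sym (pow-* a r y))))

    localisation : Module R m ℓm
    localisation = record
      { Carrierᴹ = Carrierᴹ × ℕ
      ; _≈ᴹ_ = _∼_
      ; _+ᴹ_ = _+ˡ_
      ; _*ₗ_ = _*ˡ_
      ; _*ᵣ_ = λ u r → r *ˡ u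
      ; 0ᴹ   = 0ᴹ , 0
      ; -ᴹ_  = -ˡ_
      ; isModule = IsModuleFromLeft.isModule {commutativeRing = R} (record { isLeftModule = record
        { isLeftSemimodule = record
          { +ᴹ-isCommutativeMonoid = record
            { isMonoid = record
              { isSemigroup = record
                { isMagma = record
                  { isEquivalence = record { refl = same ≡.refl ≈ᴹ-refl ; sym = ∼-sym ; trans = ∼-trans }
                  ; ∙-cong = ∼-+-cong
                  }
                ; assoc = +ˡ-assoc
                }
              ; identity = +ˡ-identityˡ , (λ u → ∼-trans (+ˡ-comm u (0ᴹ , 0)) (+ˡ-identityˡ u))
              }
            ; comm = +ˡ-comm
            }
          ; isPreleftSemimodule = record
            { *ₗ-cong = *ˡ-cong
            ; *ₗ-zeroˡ = λ (x , a) → zero∼ a (*ₗ-zeroˡ x)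
            ; *ₗ-distribʳ = *ˡ-distribʳ
            ; *ₗ-identityˡ = λ (x , a) → same ≡.refl (*ₗ-identityˡ x)
            ; *ₗ-assoc = λ r t (x , a) → same ≡.refl (*ₗ-assoc r t x)
            ; *ₗ-zeroʳ = λ r → zero∼ 0 (*ₗ-zeroʳ r)
            ; *ₗ-distribˡ = *ˡ-distribˡ
            }
          }
        ; -ᴹ‿cong = -ˡ-cong
        ; -ᴹ‿inverse = +ˡ-inverseˡ , (λ u → ∼-trans (+ˡ-comm u (-ˡ u)) (+ˡ-inverseˡ u))
        } })
      }

  open Cokernel public using (cokernel)
  open Localisation public using (localisation)

-- The inclusion Fil (i - 1) ⊆ Fil i is represented by the injective linear map ι i.
record Filtration (R : CommutativeRing c ℓ) (m ℓm : Level) : Set (c ⊔ ℓ ⊔ lsuc (m ⊔ ℓm)) where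
  field
    Fil   : ℤ → Module R m ℓm
    ι     : ∀ i → Module.Carrierᴹ (Fil (ℤ.pred i)) → Module.Carrierᴹ (Fil i)
    ι-mono : ∀ i → IsModuleMonomorphism (Module.rawModule (Fil (ℤ.pred i))) (Module.rawModule (Fil i)) (ι i)
    finiteFree : ∀ i → IsFiniteFree (Fil i)
    stabilises : ∃ λ b → ∀ i → b ℤ.≤ i →
      Surjective (Module._≈ᴹ_ (Fil (ℤ.pred i))) (Module._≈ᴹ_ (Fil i)) (ι i)
    vanishes   : ∃ λ a → ∀ i → i ℤ.≤ a → IsZero (Fil i)

  gr : ℤ → Module R m (m ⊔ ℓm)
  gr i = cokernel (Fil (ℤ.pred i)) (Fil i) (ι i) (IsModuleMonomorphism.isModuleHomomorphism (ι-mono i))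

record FilteredEndomorphism {R : CommutativeRing c ℓ} (F : Filtration R m ℓm) : Set (c ⊔ ℓ ⊔ m ⊔ ℓm) where
  open Filtration F
  field
    Θ      : ∀ i → Module.Carrierᴹ (Fil i) → Module.Carrierᴹ (Fil i)
    Θ-hom  : ∀ i → IsModuleHomomorphism (Module.rawModule (Fil i)) (Module.rawModule (Fil i)) (Θ i)
    Θ-ι    : ∀ i x → Module._≈ᴹ_ (Fil i) (Θ i (ι i x)) (ι i (Θ (ℤ.pred i) x))

  module _ (i : ℤ) where
    private
      module N = Module (Fil i)
      module G = Module (gr i)
      module T = IsModuleHomomorphism (Θ-hom i)
      open Cokernel (Fil (ℤ.pred i)) (Fil i) (ι i) (IsModuleMonomorphism.isModuleHomomorphism (ι-mono i))
        using (∼-reflexive)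

    gr-Θ : G.Carrierᴹ → G.Carrierᴹ
    gr-Θ = Θ i

    gr-Θ-hom : IsModuleHomomorphism G.rawModule G.rawModule gr-Θ
    gr-Θ-hom = record { isBimoduleHomomorphism = record
      { +ᴹ-isGroupHomomorphism = record
        { isMonoidHomomorphism = record
          { isMagmaHomomorphism = record
            { isRelHomomorphism = record { cong = λ {x} {y} → gr-cong x y }
            ; homo = λ x y → ∼-reflexive (T.+ᴹ-homo x y)
            }
          ; ε-homo = ∼-reflexive T.0ᴹ-homo
          }
        ; ⁻¹-homo = λ x → ∼-reflexive (T.-ᴹ-homo x)
        }
      ; *ₗ-homo = λ r x → ∼-reflexive (T.*ₗ-homo r x)
      ; *ᵣ-homo = λ r x → ∼-reflexive (T.*ₗ-homo r x)
      } }
      where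
      gr-cong : ∀ x y → x G.≈ᴹ y → Θ i x G.≈ᴹ Θ i y
      gr-cong x y (z , e) = Θ (ℤ.pred i) z , N.≈ᴹ-trans (N.+ᴹ-congˡ (N.≈ᴹ-sym (T.-ᴹ-homo y)))
        (N.≈ᴹ-trans (N.≈ᴹ-sym (T.+ᴹ-homo x (N.-ᴹ y))) (N.≈ᴹ-trans (T.⟦⟧-cong e) (Θ-ι i z)))

  ActsOnGrByMinusIndex : Set (m ⊔ ℓm)
  ActsOnGrByMinusIndex = ∀ i x → Module._≈ᴹ_ (gr i) (gr-Θ i x) (_·ℤ_ (gr i) (ℤ.- i) x)

module _ {R : CommutativeRing c ℓ} (F : Filtration R m ℓm) (p : ℕ) where
  open CommutativeRing R using (1#; semiring)
  open import Algebra.Properties.Semiring.Mult semiring renaming (_×_ to _·_)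
  open Filtration F

  -- {i ∈ ℤ : gr i [1/p] ≠ 0}
  HT : ℤ → Set (m ⊔ ℓm)
  HT i = ¬ IsZero (localisation (gr i) (p · 1#))

{-# OPTIONS --safe #-}

-- Suppose no r ∈ HT has the form i - mp with m > 0. By induction on j < i, a product of operators
-- Θ + r with p ∤ i - r annihilates Filⱼ: if p ∤ i - j, adjoin the factor Θ + j, which maps Filⱼ to
-- Filⱼ₋₁; otherwise j ∉ HT, so Filⱼ is torsion over Filⱼ₋₁ and the product for Filⱼ₋₁ still works.
-- If gr i had torsion, some y ∈ Filᵢ₋₁ not divisible by p would be p times an element of Filᵢ;
-- then (Θ + i) y ∈ p Filᵢ₋₁, so 0 = ∏ (Θ + r) y ≡ ± ∏ (i - r) y mod p, and y ∈ p Filᵢ₋₁.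
--
-- Constructively, the ranks are given, hence rank jumps are decidable; Gaussian elimination is only
-- available under a double negation, which suffices because equality in W(k) is stable.

module Submission where

open import Algebra.Apartness.Bundles using (HeytingField)
open import Algebra.Bundles using (CommutativeMonoid; CommutativeRing)
open import Algebra.Module.Bundles using (Module)
import Algebra.Module.Construct.TensorUnit as TensorUnit
open import Algebra.Module.Morphism.Structures using (IsModuleHomomorphism; IsModuleMonomorphism)
import Algebra.Properties.Semiring.Mult
open import Data.Empty using (⊥-elim)
open import Data.Fin.Base as Fin using (Fin; punchIn; punchOut)
open import Data.Fin.Properties as Fin using (punchIn-punchOut)
open import Data.Integer.Base as ℤ using (ℤ; +_; -[1+_]; 0ℤ; 1ℤ; -1ℤ)
import Data.Integer.Properties as ℤ
import Data.Integer.Tactic.RingSolver as ℤ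
open import Data.List.Base using (List; []; _∷_)
open import Data.List.Relation.Unary.All using (All; []; _∷_)
open import Data.Nat.Base as ℕ using (ℕ; zero; suc; NonZero; z≤n; s≤s)
open import Data.Nat.Coprimality using (Coprime; coprime-Bézout)
open import Data.Nat.Divisibility using (_∣_; _∣?_; divides; ∣-refl)
open import Data.Nat.GCD using (module Bézout)
open import Data.Nat.Primality using (Prime; prime⇒irreducible; prime⇒nonZero)
import Data.Nat.Properties as ℕ
open import Data.Product.Base using (∃; ∃₂; _,_; _×_; proj₁; proj₂)
open import Data.Sum.Base using (_⊎_; inj₁; inj₂)
import Data.Vec.Functional as Vector
open import Function.Base using (_∘_)
open import Function.Bundles using (Equivalence)
open import Level using (Level; _⊔_)
open import Relation.Binary.PropositionalEquality as ≡ using (_≡_)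
open import Relation.Nullary.Decidable.Core using (yes; no; toSum; ¬¬-excluded-middle)
open import Relation.Nullary.Negation.Core using (¬_; ¬¬-map)
open import Defs

-- `W` is built from Witt polynomials over a Heyting field, so divisibility in it has to be derived.
-- The key is that multiplication by p is Verschiebung after Frobenius. This fails over the
-- integers; it is proved as a congruence modulo p between universal polynomials and then
-- specialised to characteristic p. With p-th roots it makes W(k) a ring of digit expansions, in
-- which an element with invertible head is inverted by a geometric series.
--
-- Torsion in gr i is reached by elimination on the images in Fil i of a basis of Fil (i - 1):
-- either they span a direct summand, and gr i is torsion-free, or they are dependent modulo p,
-- which yields the element y of the overview. A rank jump at j puts j in `HT`, since gr j [1/p] = 0
-- would place nonzero multiples of a basis of Fil j in Fil (j - 1) and force equal ranks.

private
  variable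
    a b c ℓ ℓk ℓ₁ ℓ₂ m m₁ m₂ m₃ ℓm ℓm₁ ℓm₂ ℓm₃ : Level

-- Witt vectors

module GhostCongruence (p : ℕ) .⦃ _ : NonZero p ⦄ (A : CommutativeRing c ℓ) (torsionFree : TorsionFree A) where
  open CommutativeRing A
  open Congruence A
  open Ghost p A
  open import Algebra.Properties.Semiring.Exp semiring using (_^_)

  -- The heads agree modulo p, so their p^(j+1)-th powers agree modulo p^(j+2), the precision of the
  -- hypothesis in degree j + 1. Subtracting them and dividing by p, which torsion-freeness allows,
  -- leaves the same hypothesis for the shifted sequences.
  ghost-injective-mod : ∀ {x y} → (∀ n → ghost n x ≡ ghost n y mod ⟨ p ⟩ ^ suc n) → ∀ n → x n ≡ y n mod ⟨ p ⟩
  ghost-injective-mod e zero    = mod-weaken ⟨ p ⟩ 1# (e 0)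
  ghost-injective-mod e (suc n) = ghost-injective-mod (λ j → mod-unscale torsionFree p (mod-cancelʳ
    (mod-trans (mod-reflexive (+-comm _ _)) (mod-trans (e (suc j)) (mod-reflexive (+-comm _ _))))
    (mod-^p^ p (suc j) (mod-weaken ⟨ p ⟩ 1# (e 0))))) n

module WittCoordinates {p : ℕ} (pp : Prime p) where
  open Witt pp
  private
    instance
      p≢0 : NonZero p
      p≢0 = prime⇒nonZero pp

  module _ (A : CommutativeRing c ℓ) where
    open CommutativeRing A
    open Ghost p A
    open import Algebra.Properties.Semiring.Exp semiring using (_^_)

    teichmüller : Carrier → ℕ → Carrier
    teichmüller x zero    = x
    teichmüller x (suc _) = 0#

    verschiebung : (ℕ → Carrier) → ℕ → Carrier
    verschiebung x zero    = 0#
    verschiebung x (suc n) = x n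

    -- This coordinatewise formula is the Witt vector Frobenius in characteristic p; over other
    -- rings it is so only modulo p.
    frobenius : (ℕ → Carrier) → ℕ → Carrier
    frobenius x n = x n ^ p

    ghost-decomposition : ∀ x n → ghost n (teichmüller (x 0)) + ghost n (verschiebung (x ∘ suc)) ≈ ghost n x
    ghost-decomposition x zero    = +-identityʳ _
    ghost-decomposition x (suc n) = +-cong
      (trans (+-congˡ (trans (*-congˡ (ghost-0 n)) (zeroʳ _))) (+-identityʳ _))
      (trans (+-congʳ (0^ (p ℕ.^ suc n) ⦃ ℕ.m^n≢0 p (suc n) ⦄)) (+-identityˡ _))

  module Universal where
    U = ℤ[ Var 1 ]
    open CommutativeRing U
    open Ghost p U
    open Congruence U
    open import Algebra.Properties.Semiring.Exp semiring using (_^_)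
    module M = Algebra.Properties.Semiring.Mult (CommutativeRing.semiring ℤ[ Fin 1 ])

    x : Fin 1 → ℕ → Poly (Var 1)
    x i n = var (i , n)

    x₀ : ℕ → Poly (Var 1)
    x₀ = x Fin.zero

    p·x : Poly (Fin 1)
    p·x = p M.× var Fin.zero

    -- Identities are proved for indeterminate coordinates, where torsion-freeness lets ghost
    -- components determine a Witt vector, and are specialised afterwards.
    decomposition : ∀ n → _+ᵂ_ U (teichmüller U (x₀ 0)) (verschiebung U (x₀ ∘ suc)) n ≃ x₀ n
    decomposition = ghost-injective (torsionFree 1)
      (λ n → trans (ghost-+ U _ _ n) (ghost-decomposition U x₀ n))

    ghost-p·x : ∀ n → ghost n (evalᵂ U x p·x) ≈ ⟨ p ⟩ * ghost n x₀
    ghost-p·x n = trans (ghost-evalᵂ U x p·x n)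
      (trans (Eval.eval-· U _ p (var Fin.zero)) (sym (⟨⟩*≈· p _)))

    -- Integrally the two sides differ: in degree n the ghost of VF x lacks the term p^(n+1) x_n of
    -- p times the ghost of x. This term vanishes at exactly the precision that
    -- `ghost-injective-mod` asks for.
    p·x≡VF : ∀ n → evalᵂ U x p·x n ≡ verschiebung U (frobenius U x₀) n mod ⟨ p ⟩
    p·x≡VF = GhostCongruence.ghost-injective-mod p U (torsionFree 1) λ n →
      mod-trans (mod-reflexive (ghost-p·x n)) (ghosts n)
      where
      ghosts : ∀ n → ⟨ p ⟩ * ghost n x₀ ≡ ghost n (verschiebung U (frobenius U x₀)) mod ⟨ p ⟩ ^ suc n
      ghosts zero    = x₀ 0 , sym (trans (+-identityˡ _) (*-congʳ (*-identityʳ _)))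
      ghosts (suc n) = x₀ (suc n) , trans (*-congˡ (ghost-suc n x₀)) (trans (distribˡ _ _ _)
        (+-cong (sym (trans (+-congʳ (0^ (p ℕ.^ suc n) ⦃ ℕ.m^n≢0 p (suc n) ⦄)) (+-identityˡ _))) (sym (*-assoc _ _ _))))

  module _ (A : CommutativeRing c ℓ) where
    open CommutativeRing A
    open Universal using (x; x₀; p·x)
    private
      module W = CommutativeRing (W A)
      module MW = Algebra.Properties.Semiring.Mult W.semiring
      module MA = Algebra.Properties.Semiring.Mult semiring
      module M = Universal.M

      ρ : (ℕ → Carrier) → Var 1 → Carrier
      ρ a (_ , n) = a n

    decomposition : ∀ a → teichmüller A (a 0) W.+ verschiebung A (a ∘ suc) W.≈ a
    decomposition a n = trans (sym (trans
      (eval-apply A (ρ a) addition _ n)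
      (apply-cong A addition (λ { Fin.zero → τ ; (Fin.suc Fin.zero) → ν }) n)))
      (Eval.eval-cong A (ρ a) (Universal.decomposition n))
      where
      τ : ∀ m → eval A (ρ a) (teichmüller ℤ[ Var 1 ] (x₀ 0) m) ≈ teichmüller A (a 0) m
      τ zero    = refl
      τ (suc _) = refl
      ν : ∀ m → eval A (ρ a) (verschiebung ℤ[ Var 1 ] (x₀ ∘ suc) m) ≈ verschiebung A (a ∘ suc) m
      ν zero    = refl
      ν (suc _) = refl

    module _ (p≈0 : p MA.× 1# ≈ 0#) where

      evalᵂ-× : ∀ n a → evalᵂ A (λ (i : Fin 1) m → a m) (n M.× var Fin.zero) W.≈ n MW.× a
      evalᵂ-× zero    a = W.refl {λ _ → 0#}
      evalᵂ-× (suc n) a = W.+-congˡ {x = a} (evalᵂ-× n a)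

      p×≈VF : ∀ a → p MW.× a W.≈ verschiebung A (frobenius A a)
      p×≈VF a n = trans (sym (evalᵂ-× p a n)) (trans (sym (eval-evalᵂ A (ρ a) x p·x n))
        (trans (modp (Universal.p·x≡VF n)) (ν n)))
        where
        open Congruence ℤ[ Var 1 ] using (_≡_mod_; ⟨_⟩)
        modp : ∀ {f g} → f ≡ g mod ⟨ p ⟩ → eval A (ρ a) f ≈ eval A (ρ a) g
        modp (q Congruence., e) = trans (Eval.eval-cong A (ρ a) e) (trans (+-congˡ
          (trans (*-congʳ (trans (Eval.eval-· A (ρ a) p :1) p≈0)) (zeroˡ _))) (+-identityʳ _))
        ν : ∀ m → eval A (ρ a) (verschiebung ℤ[ Var 1 ] (frobenius ℤ[ Var 1 ] x₀) m) ≈ verschiebung A (frobenius A a) m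
        ν zero    = refl
        ν (suc m) = Eval.eval-^ A (ρ a) (x₀ m) p

-- The properties of W(k) that drive elimination. Equality in a Heyting field is stable but not
-- decidable, hence the double negation on the dichotomy.
record IsStableDVR (R : CommutativeRing c ℓ) (π : CommutativeRing.Carrier R) : Set (c ⊔ ℓ) where
  open CommutativeRing R
  field
    ≈-stable         : ∀ {x y} → ¬ ¬ x ≈ y → x ≈ y
    *-cancel         : ∀ {a x} → ¬ a ≈ 0# → a * x ≈ 0# → x ≈ 0#
    π≉0              : ¬ π ≈ 0#
    π∤1              : ¬ ∃ λ y → 1# ≈ π * y
    unit-or-multiple : ∀ x → ¬ ¬ ((∃ λ u → u * x ≈ 1#) ⊎ (∃ λ y → x ≈ π * y))

-- Heyting fields and their Frobenius

module FieldProperties (k : HeytingField c ℓ₁ ℓ₂) where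
  open HeytingField k using (tight; #⇒invertible; invertible⇒#)
  open CommutativeRing (fieldRing k)
  open import Algebra.Properties.Ring ring using (-0#≈0#)

  x-0≈x : ∀ x → x - 0# ≈ x
  x-0≈x x = trans (+-congˡ -0#≈0#) (+-identityʳ x)

  stable : ∀ {x y} → ¬ ¬ x ≈ y → x ≈ y
  stable {x} {y} ¬¬e = proj₁ (tight x y) λ x#y → ¬¬e λ e → proj₂ (tight x y) e x#y

  1≉0 : ¬ 1# ≈ 0#
  1≉0 e = proj₂ (tight 1# 0#) e (invertible⇒# (1# , 1*1 , 1*1′))
    where
    1*1 = trans (*-identityˡ _) (x-0≈x 1#)
    1*1′ = trans (*-identityʳ _) (x-0≈x 1#)

  -- A refutation of the first alternative shows that `x` is not apart from 0, and tightness turns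
  -- this into equality.
  zero-or-invertible : ∀ x → ¬ ¬ ((∃ λ y → y * x ≈ 1#) ⊎ x ≈ 0#)
  zero-or-invertible x k = k (inj₂ (proj₁ (tight x 0#) λ x#0 →
    let (y , e , _) = #⇒invertible x#0 in k (inj₁ (y , trans (*-congˡ (sym (x-0≈x x))) e))))

module CharacteristicP (k : HeytingField c ℓ₁ ℓ₂) {p : ℕ} (pp : Prime p)
                       (char : HasCharacteristic (fieldRing k) p) where
  open CommutativeRing (fieldRing k)
  open FieldProperties k
  open Congruence (fieldRing k)
  open import Algebra.Properties.CommutativeSemiring.Exp commutativeSemiring
  open import Algebra.Properties.Group +-group using (x∙y⁻¹≈ε⇒x≈y; identityˡ-unique)
  open import Relation.Binary.Reasoning.Setoid setoid

  p≈0 : ⟨ p ⟩ ≈ 0#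
  p≈0 = Equivalence.from (char p) ∣-refl

  ^p-reduced : ∀ {x} → x ^ p ≈ 0# → x ≈ 0#
  ^p-reduced {x} e = stable λ x≉0 → zero-or-invertible x λ
    { (inj₁ (y , yx≈1)) → 1≉0 (begin
        1#              ≈⟨ Ghost.1^ p (fieldRing k) p ⟨
        1# ^ p          ≈⟨ ^-congˡ p yx≈1 ⟨
        (y * x) ^ p     ≈⟨ ^-distrib-* y x p ⟩
        y ^ p * x ^ p   ≈⟨ *-congˡ e ⟩
        y ^ p * 0#      ≈⟨ zeroʳ _ ⟩
        0#              ∎)
    ; (inj₂ x≈0) → x≉0 x≈0 }

  -- Frobenius is additive and its kernel is trivial. Adding y back to x - y avoids computing the
  -- sign in (-y)^p.
  ^p-injective : ∀ {x y} → x ^ p ≈ y ^ p → x ≈ y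
  ^p-injective {x} {y} e with frobenius-+ pp (x - y) y
  ... | q , d = x∙y⁻¹≈ε⇒x≈y x y (^p-reduced (identityˡ-unique _ (y ^ p) (begin
    (x - y) ^ p + y ^ p                ≈⟨ trans (+-congˡ (trans (*-congʳ p≈0) (zeroˡ q))) (+-identityʳ _) ⟨
    (x - y) ^ p + y ^ p + ⟨ p ⟩ * q    ≈⟨ d ⟨
    (x - y + y) ^ p                    ≈⟨ ^-congˡ p (trans (+-assoc _ _ _) (trans (+-congˡ (-‿inverseˡ y)) (+-identityʳ x))) ⟩
    x ^ p                              ≈⟨ e ⟩
    y ^ p                              ∎)))

-- A strict p-ring with residue field k: digit a n is the n-th Witt coordinate of a.
module _ (R : CommutativeRing c ℓ) (k : CommutativeRing ℓ₁ ℓ₂) (p : ℕ) (π : CommutativeRing.Carrier R) where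
  open CommutativeRing R
  private module k = CommutativeRing k
  open import Algebra.Properties.Semiring.Exp k.semiring using () renaming (_^_ to _^ᵏ_)

  record Digits : Set (c ⊔ ℓ ⊔ ℓ₁ ⊔ ℓ₂) where
    field
      digit           : Carrier → ℕ → k.Carrier
      digit-cong      : ∀ {a b} → a ≈ b → ∀ n → digit a n k.≈ digit b n
      digit-injective : ∀ {a b} → (∀ n → digit a n k.≈ digit b n) → a ≈ b
      fromDigits      : (ℕ → k.Carrier) → Carrier
      digit-from      : ∀ f n → digit (fromDigits f) n k.≈ f n
      lift            : k.Carrier → Carrier
      lift-cong       : ∀ {x y} → x k.≈ y → lift x ≈ lift y
      head-lift       : ∀ x → digit (lift x) 0 k.≈ x
      head-+          : ∀ a b → digit (a + b) 0 k.≈ digit a 0 k.+ digit b 0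
      head-*          : ∀ a b → digit (a * b) 0 k.≈ digit a 0 k.* digit b 0
      head-1          : digit 1# 0 k.≈ k.1#
      head-π          : ∀ a → digit (π * a) 0 k.≈ k.0#
      digit-π         : ∀ a n → digit (π * a) (suc n) k.≈ digit a n ^ᵏ p
      tail            : Carrier → Carrier
      digit-tail      : ∀ a n → digit (tail a) n ^ᵏ p k.≈ digit a (suc n)
      decomposition   : ∀ a → a ≈ lift (digit a 0) + π * tail a

-- Divisibility and units through digit expansions

module DigitsProperties {R : CommutativeRing c ℓ} (k : HeytingField ℓk ℓ₁ ℓ₂) {p : ℕ} (pp : Prime p)
                        (char : HasCharacteristic (fieldRing k) p) {π : CommutativeRing.Carrier R} (D : Digits R (fieldRing k) p π) where
  open CommutativeRing R
  open Digits D
  open import Algebra.Properties.Semiring.Exp semiring using (_^_)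
  open import Algebra.Properties.Group +-group using (∙-cancelˡ; x∙y⁻¹≈ε⇒x≈y)
  open import Algebra.Properties.Ring ring using (-‿distribʳ-*)
  open import Algebra.Solver.Ring.NaturalCoefficients.Default commutativeSemiring
    using (solve; _:=_; con) renaming (_:+_ to _⟨+⟩_; _:*_ to _⟨*⟩_)
  open import Relation.Binary.Reasoning.Setoid setoid
  open CharacteristicP k pp char using (^p-reduced; ^p-injective)
  open FieldProperties k using (stable; 1≉0; zero-or-invertible)
  private
    module k = CommutativeRing (fieldRing k)
    open import Algebra.Properties.Semiring.Exp k.semiring using () renaming (^-congˡ to ^ᵏ-congˡ)
    instance
      p≢0 : NonZero p
      p≢0 = prime⇒nonZero pp

  -- Since 0 = π · 0, each digit of 0 after the head is the p-th power of the one before.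
  digit-0 : ∀ n → digit 0# n k.≈ k.0#
  digit-0 zero    = k.trans (digit-cong (sym (zeroʳ π)) 0) (head-π 0#)
  digit-0 (suc n) = k.trans (digit-cong (sym (zeroʳ π)) (suc n)) (k.trans (digit-π 0# n)
    (k.trans (^ᵏ-congˡ p (digit-0 n)) (Ghost.0^ p (fieldRing k) p)))

  π-regular : ∀ {a} → π * a ≈ 0# → a ≈ 0#
  π-regular {a} e = digit-injective λ n → k.trans
    (^p-reduced (k.trans (k.sym (digit-π a n)) (k.trans (digit-cong e (suc n)) (digit-0 (suc n)))))
    (k.sym (digit-0 n))

  π-cancel : ∀ {a b} → π * a ≈ π * b → a ≈ b
  π-cancel {a} {b} e = x∙y⁻¹≈ε⇒x≈y a b (π-regular (begin
    π * (a - b)        ≈⟨ distribˡ _ _ _ ⟩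
    π * a + π * - b    ≈⟨ +-cong e (sym (-‿distribʳ-* π b)) ⟩
    π * b - π * b      ≈⟨ -‿inverseʳ _ ⟩
    0#                 ∎))

  π^-regular : ∀ n {a} → π ^ n * a ≈ 0# → a ≈ 0#
  π^-regular zero    e = trans (sym (*-identityˡ _)) e
  π^-regular (suc n) e = π^-regular n (π-regular (trans (sym (*-assoc _ _ _)) e))

  π∣-intro : ∀ {a} → digit a 0 k.≈ k.0# → a ≈ π * tail a
  π∣-intro {a} e = digit-injective λ
    { zero    → k.trans e (k.sym (head-π (tail a)))
    ; (suc n) → k.trans (k.sym (digit-tail a n)) (k.sym (digit-π (tail a) n)) }

  infix 4 _≈[_]_
  _≈[_]_ : Carrier → ℕ → Carrier → Set ℓ₁
  a ≈[ N ] b = ∀ {j} → j ℕ.< N → digit a j k.≈ digit b j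

  -- Together with `≈[]-intro` this identifies agreement of N digits with congruence modulo π^N, the
  -- bridge between digits and addition. The digits of a tail are p-th roots of the shifted digits,
  -- so injectivity of Frobenius passes agreement to the tails.
  ≈[]-elim : ∀ N {a b} → a ≈[ N ] b → ∃ λ s → a ≈ b + π ^ N * s
  ≈[]-elim zero    {a} {b} e = a - b , sym (begin
    b + 1# * (a - b)   ≈⟨ +-congˡ (*-identityˡ _) ⟩
    b + (a - b)        ≈⟨ +-comm _ _ ⟩
    a - b + b          ≈⟨ +-assoc _ _ _ ⟩
    a + (- b + b)      ≈⟨ +-congˡ (-‿inverseˡ b) ⟩
    a + 0#             ≈⟨ +-identityʳ a ⟩
    a                  ∎)
  ≈[]-elim (suc N) {a} {b} e with ≈[]-elim N {tail a} {tail b} (λ {j} j<N → ^p-injective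
    (k.trans (digit-tail a j) (k.trans (e (s≤s j<N)) (k.sym (digit-tail b j)))))
  ... | s , d = s , (begin
    a                                                     ≈⟨ decomposition a ⟩
    lift (digit a 0) + π * tail a                         ≈⟨ +-cong (lift-cong (e (s≤s z≤n))) (*-congˡ d) ⟩
    lift (digit b 0) + π * (tail b + π ^ N * s)           ≈⟨ solve 5 (λ l q t r s → l ⟨+⟩ q ⟨*⟩ (t ⟨+⟩ r ⟨*⟩ s) :=
                                                              l ⟨+⟩ q ⟨*⟩ t ⟨+⟩ q ⟨*⟩ r ⟨*⟩ s) refl _ π (tail b) (π ^ N) s ⟩
    lift (digit b 0) + π * tail b + π ^ suc N * s         ≈⟨ +-congʳ (decomposition b) ⟨
    b + π ^ suc N * s                                     ∎)

  ≈[]-intro : ∀ N {a b s} → a ≈ b + π ^ N * s → a ≈[ N ] b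
  ≈[]-intro (suc N) {a} {b} {s} e = digits _
    where
    e′ : a ≈ b + π * (π ^ N * s)
    e′ = trans e (+-congˡ (*-assoc _ _ _))
    head : digit a 0 k.≈ digit b 0
    head = k.trans (digit-cong e′ 0) (k.trans (head-+ b _) (k.trans (k.+-congˡ (head-π _)) (k.+-identityʳ _)))
    tails : tail a ≈ tail b + π ^ N * s
    tails = π-cancel (∙-cancelˡ (lift (digit a 0)) _ _ (begin
      lift (digit a 0) + π * tail a                      ≈⟨ decomposition a ⟨
      a                                                  ≈⟨ e′ ⟩
      b + π * (π ^ N * s)                                ≈⟨ +-congʳ (trans (decomposition b) (+-congʳ (lift-cong (k.sym head)))) ⟩
      lift (digit a 0) + π * tail b + π * (π ^ N * s)    ≈⟨ +-assoc _ _ _ ⟩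
      lift (digit a 0) + (π * tail b + π * (π ^ N * s))  ≈⟨ +-congˡ (distribˡ _ _ _) ⟨
      lift (digit a 0) + π * (tail b + π ^ N * s)        ∎))
    digits : ∀ j → j ℕ.< suc N → digit a j k.≈ digit b j
    digits zero    _         = head
    digits (suc j) (s≤s j<N) =
      k.trans (k.sym (digit-tail a j)) (k.trans (^ᵏ-congˡ p (≈[]-intro N tails j<N)) (digit-tail b j))

  -- The inverse of 1 - πe is the limit of the partial sums of Σ πⁿeⁿ, built digit by digit.
  module Geometric (e : Carrier) where

    partialSum : ℕ → Carrier
    partialSum zero    = 0#
    partialSum (suc n) = 1# + π * e * partialSum n

    partialSum-suc : ∀ n → partialSum (suc n) ≈ partialSum n + π ^ n * e ^ n
    partialSum-suc zero    = trans (+-congˡ (zeroʳ _)) (trans (+-comm _ _) (+-congˡ (sym (*-identityˡ 1#))))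
    partialSum-suc (suc n) = trans (+-congˡ (*-congˡ (partialSum-suc n)))
      (solve 5 (λ q e z r s → con 1 ⟨+⟩ q ⟨*⟩ e ⟨*⟩ (z ⟨+⟩ r ⟨*⟩ s) := con 1 ⟨+⟩ q ⟨*⟩ e ⟨*⟩ z ⟨+⟩ q ⟨*⟩ r ⟨*⟩ (e ⟨*⟩ s))
        refl π e (partialSum n) (π ^ n) (e ^ n))

    limit : Carrier
    -- Partial sums from index n + 1 on agree modulo π^(n+1), so their digit n no longer changes.
    limit = fromDigits λ n → digit (partialSum (suc n)) n

    partialSum-stable : ∀ d j → digit (partialSum (suc j)) j k.≈ digit (partialSum (d ℕ.+ suc j)) j
    partialSum-stable zero    j = k.refl
    partialSum-stable (suc d) j = k.trans (partialSum-stable d j)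
      (k.sym (≈[]-intro (d ℕ.+ suc j) (partialSum-suc (d ℕ.+ suc j)) (ℕ.m≤n+m (suc j) d)))

    limit≈partialSum : ∀ N → limit ≈[ N ] partialSum N
    limit≈partialSum N {j} j<N = k.trans (digit-from _ j) (k.trans (partialSum-stable (N ℕ.∸ suc j) j)
      (digit-cong (reflexive (≡.cong partialSum (ℕ.m∸n+n≡m j<N))) j))

    -- Digit n is compared through partial sum n + 2. The limit agrees with partial sum n + 1 modulo
    -- π^(n+1), and x ↦ 1 + π e x sends that sum to the next one without losing precision.
    fixedPoint : limit ≈ 1# + π * e * limit
    fixedPoint = digit-injective λ n → k.trans (limit≈partialSum (2 ℕ.+ n) (ℕ.m≤n⇒m≤1+n ℕ.≤-refl))
      (k.sym (≈[]-intro (suc n) (step (suc n)) ℕ.≤-refl))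
      where
      step : ∀ N → 1# + π * e * limit ≈ partialSum (suc N) + π ^ N * (π * e * proj₁ (≈[]-elim N (limit≈partialSum N)))
      step N with ≈[]-elim N (limit≈partialSum N)
      ... | s , d = trans (+-congˡ (*-congˡ d))
        (solve 5 (λ q e z r s → con 1 ⟨+⟩ q ⟨*⟩ e ⟨*⟩ (z ⟨+⟩ r ⟨*⟩ s) := con 1 ⟨+⟩ q ⟨*⟩ e ⟨*⟩ z ⟨+⟩ r ⟨*⟩ (q ⟨*⟩ e ⟨*⟩ s))
          refl π e (partialSum N) (π ^ N) s)

  invertible-1+π : ∀ f → ∃ λ z → z * (1# + π * f) ≈ 1#
  invertible-1+π f = z , (begin
    z * (1# + π * f)                      ≈⟨ solve 3 (λ z q f → z ⟨*⟩ (con 1 ⟨+⟩ q ⟨*⟩ f) := z ⟨+⟩ q ⟨*⟩ f ⟨*⟩ z) refl z π f ⟩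
    z + π * f * z                         ≈⟨ +-congʳ (Geometric.fixedPoint (- f)) ⟩
    1# + π * - f * z + π * f * z          ≈⟨ +-assoc _ _ _ ⟩
    1# + (π * - f * z + π * f * z)        ≈⟨ +-congˡ (distribʳ z (π * - f) (π * f)) ⟨
    1# + (π * - f + π * f) * z            ≈⟨ +-congˡ (*-congʳ (distribˡ π (- f) f)) ⟨
    1# + π * (- f + f) * z                ≈⟨ +-congˡ (*-congʳ (trans (*-congˡ (-‿inverseˡ f)) (zeroʳ π))) ⟩
    1# + 0# * z                           ≈⟨ trans (+-congˡ (zeroˡ z)) (+-identityʳ 1#) ⟩
    1#                                    ∎)
    where z = Geometric.limit (- f)

  -- Lifting the inverse of the residue makes the product 1 modulo π, and such elements are inverted
  -- by the geometric series.
  invertible-head : ∀ {x} → (∃ λ y → y k.* digit x 0 k.≈ k.1#) → ∃ λ u → u * x ≈ 1#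
  invertible-head {x} (y , yx≈1) = z * lift y , (begin
    z * lift y * x                                 ≈⟨ *-assoc _ _ _ ⟩
    z * (lift y * x)                               ≈⟨ *-congˡ (trans (sym (+-identityˡ _)) (+-congʳ (sym (-‿inverseʳ 1#)))) ⟩
    z * (1# - 1# + lift y * x)                     ≈⟨ *-congˡ (trans (+-assoc _ _ _) (+-congˡ (+-comm _ _))) ⟩
    z * (1# + (lift y * x - 1#))                   ≈⟨ *-congˡ (+-congˡ (π∣-intro head)) ⟩
    z * (1# + π * tail (lift y * x - 1#))          ≈⟨ proj₂ inverse ⟩
    1#                                             ∎)
    where
    inverse = invertible-1+π (tail (lift y * x - 1#))
    z = proj₁ inverse
    head : digit (lift y * x - 1#) 0 k.≈ k.0#
    head = k.trans (head-+ _ _) (k.trans (k.+-congʳ (k.trans (head-* _ _) (k.trans (k.*-congʳ (head-lift y))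
      (k.trans yx≈1 (k.sym head-1))))) (k.trans (k.sym (head-+ _ _)) (k.trans (digit-cong (-‿inverseʳ 1#) 0) (digit-0 0))))

  unit-or-multiple : ∀ x → ¬ ¬ ((∃ λ u → u * x ≈ 1#) ⊎ (∃ λ y → x ≈ π * y))
  unit-or-multiple x κ = zero-or-invertible (digit x 0) λ
    { (inj₁ y) → κ (inj₁ (invertible-head y))
    ; (inj₂ e) → κ (inj₂ (tail x , π∣-intro e)) }

  UnitTimesPower : Carrier → Set _
  UnitTimesPower a = ∃₂ λ n u → a ≈ π ^ n * u × ∃ λ v → v * u ≈ 1#

  -- The index of a nonzero digit bounds the recursion: while the head vanishes, `a` is divided by π
  -- and the index drops by one.
  nonzeroDigit⇒unitTimesPower : ∀ n a → ¬ digit a n k.≈ k.0# → ¬ ¬ UnitTimesPower a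
  nonzeroDigit⇒unitTimesPower n a a≉0 κ = zero-or-invertible (digit a 0) λ
    { (inj₁ y) → κ (0 , a , sym (*-identityˡ a) , invertible-head y)
    ; (inj₂ e) → shift n a≉0 e }
    where
    shift : ∀ n → ¬ digit a n k.≈ k.0# → digit a 0 k.≈ k.0# → _
    shift zero    a≉0 e = a≉0 e
    shift (suc n) a≉0 e = nonzeroDigit⇒unitTimesPower n (tail a)
      (λ t≈0 → a≉0 (k.trans (k.sym (digit-tail a n)) (k.trans (^ᵏ-congˡ p t≈0) (Ghost.0^ p (fieldRing k) p))))
      λ { (m , u , d , inv) → κ (suc m , u , trans (π∣-intro e) (trans (*-congˡ d) (sym (*-assoc _ _ _))) , inv) }

  nonzero⇒unitTimesPower : ∀ a → ¬ a ≈ 0# → ¬ ¬ UnitTimesPower a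
  nonzero⇒unitTimesPower a a≉0 κ = a≉0 (digit-injective λ n → stable λ d≉ →
    nonzeroDigit⇒unitTimesPower n a (λ d → d≉ (k.trans d (k.sym (digit-0 n)))) κ)

  ≈-stable : ∀ {x y} → ¬ ¬ x ≈ y → x ≈ y
  ≈-stable ¬¬e = digit-injective λ n → stable λ d → ¬¬e λ e → d (digit-cong e n)

  *-cancel : ∀ {a x} → ¬ a ≈ 0# → a * x ≈ 0# → x ≈ 0#
  *-cancel {a} {x} a≉0 ax≈0 = ≈-stable λ x≉0 → nonzero⇒unitTimesPower a a≉0
    λ { (n , u , d , v , vu≈1) → x≉0 (begin
      x               ≈⟨ *-identityˡ x ⟨
      1# * x          ≈⟨ *-congʳ vu≈1 ⟨
      v * u * x       ≈⟨ *-assoc _ _ _ ⟩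
      v * (u * x)     ≈⟨ *-congˡ (π^-regular n (trans (sym (*-assoc _ _ _)) (trans (*-congʳ (sym d)) ax≈0))) ⟩
      v * 0#          ≈⟨ zeroʳ v ⟩
      0#              ∎) }

  π∤1 : ¬ ∃ λ y → 1# ≈ π * y
  π∤1 (y , e) = 1≉0 (k.trans (k.sym head-1) (k.trans (digit-cong e 0) (head-π y)))

  isStableDVR : IsStableDVR R π
  isStableDVR = record
    { ≈-stable = ≈-stable
    ; *-cancel = *-cancel
    ; π≉0 = λ π≈0 → π∤1 (0# , trans (π-regular (trans (*-identityʳ π) π≈0)) (sym (zeroʳ π)))
    ; π∤1 = π∤1
    ; unit-or-multiple = unit-or-multiple
    }

-- W(k) for a perfect field k

module _ (k : HeytingField c ℓ₁ ℓ₂) {p : ℕ} (pp : Prime p)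
         (char : HasCharacteristic (fieldRing k) p) (perfect : IsPerfect (fieldRing k) p) where
  open Witt pp using (W)
  open WittCoordinates pp
  private
    K = fieldRing k
    module k = CommutativeRing K
    module W = CommutativeRing (W K)
    open import Algebra.Properties.Semiring.Mult W.semiring using (×-assoc-*; ×-congʳ) renaming (_×_ to _·_)
    open import Algebra.Properties.Semiring.Exp k.semiring using (_^_)

    root : (ℕ → k.Carrier) → ℕ → k.Carrier
    root a n = proj₁ (perfect (a n))

    root^p : ∀ a n → root a n ^ p k.≈ a n
    root^p a n = proj₂ (perfect (a n))

    π*≈VF : ∀ a → (p · W.1#) W.* a W.≈ verschiebung K (frobenius K a)
    π*≈VF a = W.trans {(p · W.1#) W.* a} {p · a} {verschiebung K (frobenius K a)}
      (W.trans {(p · W.1#) W.* a} {p · (W.1# W.* a)} {p · a}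
        (×-assoc-* p W.1# a) (×-congʳ p {W.1# W.* a} {a} (W.*-identityˡ a)))
      (p×≈VF K (CharacteristicP.p≈0 k pp char) a)

  wittDigits : Digits (W K) K p (p · W.1#)
  wittDigits = record
    { digit = λ a → a
    ; digit-cong = λ e → e
    ; digit-injective = λ e → e
    ; fromDigits = λ f → f
    ; digit-from = λ _ _ → k.refl
    ; lift = teichmüller K
    ; lift-cong = λ { e zero → e ; e (suc _) → k.refl }
    ; head-lift = λ _ → k.refl
    ; head-+ = λ _ _ → k.refl
    ; head-* = λ _ _ → k.refl
    ; head-1 = k.refl
    ; head-π = λ a → π*≈VF a 0
    ; digit-π = λ a n → π*≈VF a (suc n)
    -- Multiplication by p shifts the coordinates and raises them to p-th powers, so division by p
    -- takes roots. Perfectness enters here.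
    ; tail = λ a → root (a ∘ suc)
    ; digit-tail = λ a → root^p (a ∘ suc)
    ; decomposition = λ a → W.sym {teichmüller K (a 0) W.+ ((p · W.1#) W.* root (a ∘ suc))} {a}
        (W.trans {teichmüller K (a 0) W.+ ((p · W.1#) W.* root (a ∘ suc))}
          {teichmüller K (a 0) W.+ verschiebung K (a ∘ suc)} {a}
          (W.+-congˡ {teichmüller K (a 0)} {(p · W.1#) W.* root (a ∘ suc)} {verschiebung K (a ∘ suc)}
            (W.trans {(p · W.1#) W.* root (a ∘ suc)} {verschiebung K (frobenius K (root (a ∘ suc)))} {verschiebung K (a ∘ suc)}
              (π*≈VF (root (a ∘ suc)))
              λ { zero → k.refl ; (suc n) → root^p (a ∘ suc) n }))
          (decomposition K a))
    }

  wittStableDVR : IsStableDVR (W K) (p · W.1#)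
  wittStableDVR = DigitsProperties.isStableDVR k pp char wittDigits

-- Linear algebra over a stable discrete valuation ring

-- Double negation commutes with finite conjunctions, so finitely many doubly negated choices can be
-- made at once.
¬¬-∀⊎∃ : ∀ {n} {P : Fin n → Set a} {Q : Fin n → Set b} →
         (∀ i → ¬ ¬ (P i ⊎ Q i)) → ¬ ¬ ((∀ i → P i) ⊎ ∃ Q)
¬¬-∀⊎∃ {n = zero}  h κ = κ (inj₁ λ ())
¬¬-∀⊎∃ {n = suc n} h κ = h Fin.zero λ
  { (inj₂ q) → κ (inj₂ (Fin.zero , q))
  ; (inj₁ p) → ¬¬-∀⊎∃ (h ∘ Fin.suc) λ
    { (inj₂ (i , q)) → κ (inj₂ (Fin.suc i , q))
    ; (inj₁ ps)      → κ (inj₁ λ { Fin.zero → p ; (Fin.suc i) → ps i }) } }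

module _ {R : CommutativeRing c ℓ} where
  open CommutativeRing R using (Carrier; _≈_; 0#; 1#; _+_; _*_; -_)
  private module R = CommutativeRing R

  module Combination (M : Module R m ℓm) where
    open Module M
    open import Algebra.Properties.Monoid.Sum +ᴹ-monoid using (sum; sum-cong-≋)
    open import Algebra.Properties.CommutativeMonoid.Sum +ᴹ-commutativeMonoid using (∑-distrib-+)

    infixr 7 _⊙_
    _⊙_ : ∀ {n} → (Fin n → Carrier) → (Fin n → Carrierᴹ) → Carrierᴹ
    v ⊙ x = sum (λ j → v j *ₗ x j)

    ⊙-cong : ∀ {n} {v w : Fin n → Carrier} {x y : Fin n → Carrierᴹ} →
             (∀ j → v j ≈ w j) → (∀ j → x j ≈ᴹ y j) → v ⊙ x ≈ᴹ w ⊙ y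
    ⊙-cong e d = sum-cong-≋ λ j → *ₗ-cong (e j) (d j)

    ⊙-congʳ : ∀ {n} {v w : Fin n → Carrier} (x : Fin n → Carrierᴹ) → (∀ j → v j ≈ w j) → v ⊙ x ≈ᴹ w ⊙ x
    ⊙-congʳ x e = ⊙-cong {x = x} e λ _ → ≈ᴹ-refl

    ⊙-zero : ∀ {n} {v : Fin n → Carrier} (x : Fin n → Carrierᴹ) → (∀ j → v j ≈ 0#) → v ⊙ x ≈ᴹ 0ᴹ
    ⊙-zero {zero}  x e = ≈ᴹ-refl
    ⊙-zero {suc n} x e = ≈ᴹ-trans
      (+ᴹ-cong (≈ᴹ-trans (*ₗ-congʳ (e Fin.zero)) (*ₗ-zeroˡ _)) (⊙-zero (x ∘ Fin.suc) (e ∘ Fin.suc)))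
      (+ᴹ-identityˡ 0ᴹ)

    ⊙-+ : ∀ {n} (v w : Fin n → Carrier) x → (λ j → v j + w j) ⊙ x ≈ᴹ v ⊙ x +ᴹ w ⊙ x
    ⊙-+ v w x = ≈ᴹ-trans (sum-cong-≋ λ j → *ₗ-distribʳ (x j) (v j) (w j)) (∑-distrib-+ (λ j → v j *ₗ x j) (λ j → w j *ₗ x j))

    ⊙-* : ∀ {n} r (v : Fin n → Carrier) x → (λ j → r * v j) ⊙ x ≈ᴹ r *ₗ (v ⊙ x)
    ⊙-* {zero}  r v x = ≈ᴹ-sym (*ₗ-zeroʳ r)
    ⊙-* {suc n} r v x = ≈ᴹ-trans (+ᴹ-cong (*ₗ-assoc _ _ _) (⊙-* r (v ∘ Fin.suc) (x ∘ Fin.suc)))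
      (≈ᴹ-sym (*ₗ-distribˡ _ _ _))

    -- Differences are written with the scalar -1, so that the two laws of a `LinearMap` apply to
    -- them directly.
    x-x≈0 : ∀ x → x +ᴹ - 1# *ₗ x ≈ᴹ 0ᴹ
    x-x≈0 x = ≈ᴹ-trans (+ᴹ-congʳ (≈ᴹ-sym (*ₗ-identityˡ x))) (≈ᴹ-trans (≈ᴹ-sym (*ₗ-distribʳ x 1# (- 1#)))
      (≈ᴹ-trans (*ₗ-congʳ (R.-‿inverseʳ 1#)) (*ₗ-zeroˡ x)))

    -1*≈- : ∀ x → - 1# *ₗ x ≈ᴹ -ᴹ x
    -1*≈- x = inverseʳ-unique x (- 1# *ₗ x) (x-x≈0 x)
      where open import Algebra.Properties.Group +ᴹ-group using (inverseʳ-unique)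

    x-y≈0⇒x≈y : ∀ {x y} → x +ᴹ - 1# *ₗ y ≈ᴹ 0ᴹ → x ≈ᴹ y
    x-y≈0⇒x≈y {x} {y} e = x∙y⁻¹≈ε⇒x≈y x y (≈ᴹ-trans (+ᴹ-congˡ (≈ᴹ-sym (-1*≈- y))) e)
      where open import Algebra.Properties.Group +ᴹ-group using (x∙y⁻¹≈ε⇒x≈y)

  module _ (M : Module R m₁ ℓm₁) (N : Module R m₂ ℓm₂) where
    private
      module M = Module M
      module N = Module N

    record LinearMap : Set (c ⊔ m₁ ⊔ ℓm₁ ⊔ m₂ ⊔ ℓm₂) where
      field
        _⟨$⟩_  : M.Carrierᴹ → N.Carrierᴹ
        cong   : ∀ {x y} → x M.≈ᴹ y → _⟨$⟩_ x N.≈ᴹ _⟨$⟩_ y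
        +-homo : ∀ x y → _⟨$⟩_ (x M.+ᴹ y) N.≈ᴹ _⟨$⟩_ x N.+ᴹ _⟨$⟩_ y
        *-homo : ∀ r x → _⟨$⟩_ (r M.*ₗ x) N.≈ᴹ r N.*ₗ _⟨$⟩_ x
      infixr 5 _⟨$⟩_

      0-homo : _⟨$⟩_ M.0ᴹ N.≈ᴹ N.0ᴹ
      0-homo = N.≈ᴹ-trans (cong (M.≈ᴹ-sym (M.*ₗ-zeroˡ M.0ᴹ))) (N.≈ᴹ-trans (*-homo 0# M.0ᴹ) (N.*ₗ-zeroˡ _))

      zero-homo : ∀ {x} → x M.≈ᴹ M.0ᴹ → _⟨$⟩_ x N.≈ᴹ N.0ᴹ
      zero-homo e = N.≈ᴹ-trans (cong e) 0-homo

      ⊙-homo : ∀ {n} (v : Fin n → Carrier) x →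
               _⟨$⟩_ (Combination._⊙_ M v x) N.≈ᴹ Combination._⊙_ N v (_⟨$⟩_ ∘ x)
      ⊙-homo {zero}  v x = 0-homo
      ⊙-homo {suc n} v x = N.≈ᴹ-trans (+-homo _ _)
        (N.+ᴹ-cong (*-homo _ _) (⊙-homo (v ∘ Fin.suc) (x ∘ Fin.suc)))

  open LinearMap using (_⟨$⟩_; cong; +-homo; *-homo; 0-homo; zero-homo; ⊙-homo)

  linearMap : {M : Module R m₁ ℓm₁} {N : Module R m₂ ℓm₂} {f : Module.Carrierᴹ M → Module.Carrierᴹ N} →
              IsModuleHomomorphism (Module.rawModule M) (Module.rawModule N) f → LinearMap M N
  linearMap {f = f} hom = record
    { _⟨$⟩_ = f ; cong = H.⟦⟧-cong ; +-homo = H.+ᴹ-homo ; *-homo = H.*ₗ-homo }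
    where module H = IsModuleHomomorphism hom

  scalars : Module R c ℓ
  scalars = TensorUnit.⟨module⟩

  Functional : Module R m ℓm → Set _
  Functional M = LinearMap M scalars

  idᴸ : {M : Module R m ℓm} → LinearMap M M
  idᴸ {M = M} = record { _⟨$⟩_ = λ x → x ; cong = λ e → e ; +-homo = λ _ _ → ≈ᴹ-refl ; *-homo = λ _ _ → ≈ᴹ-refl }
    where open Module M

  infixr 9 _∘ᴸ_
  _∘ᴸ_ : {M : Module R m₁ ℓm₁} {N : Module R m₂ ℓm₂} {P : Module R m₃ ℓm₃} →
         LinearMap N P → LinearMap M N → LinearMap M P
  _∘ᴸ_ {P = P} g f = record
    { _⟨$⟩_  = λ x → g ⟨$⟩ f ⟨$⟩ x
    ; cong   = cong g ∘ cong f
    ; +-homo = λ x y → ≈ᴹ-trans (cong g (+-homo f x y)) (+-homo g _ _)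
    ; *-homo = λ r x → ≈ᴹ-trans (cong g (*-homo f r x)) (*-homo g _ _)
    }
    where open Module P

  module _ {M : Module R m₁ ℓm₁} {N : Module R m₂ ℓm₂} where
    private module M = Module M
    open Module N
    open import Algebra.Properties.CommutativeSemigroup (CommutativeMonoid.commutativeSemigroup +ᴹ-commutativeMonoid) using (interchange)

    zeroᴸ : LinearMap M N
    zeroᴸ = record
      { _⟨$⟩_  = λ _ → 0ᴹ
      ; cong   = λ _ → ≈ᴹ-refl
      ; +-homo = λ _ _ → ≈ᴹ-sym (+ᴹ-identityˡ 0ᴹ)
      ; *-homo = λ r _ → ≈ᴹ-sym (*ₗ-zeroʳ r)
      }

    infixl 6 _+ᴸ_
    _+ᴸ_ : LinearMap M N → LinearMap M N → LinearMap M N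
    f +ᴸ g = record
      { _⟨$⟩_  = λ x → (f ⟨$⟩ x) +ᴹ (g ⟨$⟩ x)
      ; cong   = λ e → +ᴹ-cong (cong f e) (cong g e)
      ; +-homo = λ x y → ≈ᴹ-trans (+ᴹ-cong (+-homo f x y) (+-homo g x y)) (interchange _ _ _ _)
      ; *-homo = λ r x → ≈ᴹ-trans (+ᴹ-cong (*-homo f r x) (*-homo g r x)) (≈ᴹ-sym (*ₗ-distribˡ _ _ _))
      }

    infixr 7 _*ᴸ_
    _*ᴸ_ : Carrier → LinearMap M N → LinearMap M N
    s *ᴸ f = record
      { _⟨$⟩_  = λ x → s *ₗ (f ⟨$⟩ x)
      ; cong   = *ₗ-congˡ ∘ cong f
      ; +-homo = λ x y → ≈ᴹ-trans (*ₗ-congˡ (+-homo f x y)) (*ₗ-distribˡ _ _ _)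
      ; *-homo = λ r x → ≈ᴹ-trans (*ₗ-congˡ (*-homo f r x))
          (≈ᴹ-trans (≈ᴹ-sym (*ₗ-assoc _ _ _)) (≈ᴹ-trans (*ₗ-congʳ (R.*-comm s r)) (*ₗ-assoc _ _ _)))
      }

    infixr 7 _⊗_
    _⊗_ : Functional M → Carrierᴹ → LinearMap M N
    f ⊗ y = record
      { _⟨$⟩_  = λ x → (f ⟨$⟩ x) *ₗ y
      ; cong   = *ₗ-congʳ ∘ cong f
      ; +-homo = λ x x′ → ≈ᴹ-trans (*ₗ-congʳ (+-homo f x x′)) (*ₗ-distribʳ _ _ _)
      ; *-homo = λ r x → ≈ᴹ-trans (*ₗ-congʳ (*-homo f r x)) (*ₗ-assoc _ _ _)
      }

    combine : ∀ {n} → (Fin n → Functional M) → (Fin n → Carrierᴹ) → LinearMap M N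
    combine {zero}  f y = zeroᴸ
    combine {suc n} f y = f Fin.zero ⊗ y Fin.zero +ᴸ combine (f ∘ Fin.suc) (y ∘ Fin.suc)

    combine-⊙ : ∀ {n} (f : Fin n → Functional M) y x →
                combine f y ⟨$⟩ x ≈ᴹ Combination._⊙_ N (λ j → f j ⟨$⟩ x) y
    combine-⊙ {zero}  f y x = ≈ᴹ-refl
    combine-⊙ {suc n} f y x = +ᴹ-congˡ (combine-⊙ (f ∘ Fin.suc) (y ∘ Fin.suc) x)

  -- Gaussian elimination

  module Elimination (M : Module R m ℓm) where
    open Module M
    open Combination M
    open Combination scalars using () renaming (x-x≈0 to r-r≈0)
    open import Relation.Binary.Reasoning.Setoid ≈ᴹ-setoid

    -- The fraction-free pivot step x ↦ f(y) x - f(x) y: it kills y and lands in the kernel of f,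
    -- whatever the pivot f(y) is.
    eliminate : Functional M → Carrierᴹ → LinearMap M M
    eliminate f y = (f ⟨$⟩ y) *ᴸ idᴸ +ᴸ - 1# *ᴸ f ⊗ y

    eliminate-self : ∀ f y → eliminate f y ⟨$⟩ y ≈ᴹ 0ᴹ
    eliminate-self f y = x-x≈0 _

    functional-eliminate : ∀ f y x → f ⟨$⟩ eliminate f y ⟨$⟩ x ≈ 0#
    functional-eliminate f y x = R.trans (+-homo f _ _) (R.trans
      (R.+-cong (*-homo f _ _) (R.trans (*-homo f _ _) (R.*-congˡ (R.trans (*-homo f _ _) (R.*-comm _ _)))))
      (r-r≈0 _))

    -- A combination `v` of the eliminated vectors, re-expanded over the original ones; the head
    -- collects the multiples of the pivot vector.
    backSubstitute : ∀ {n} → Functional M → (Fin (suc n) → Carrierᴹ) → (Fin n → Carrier) → Fin (suc n) → Carrier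
    backSubstitute f x v = - 1# * (f ⟨$⟩ v ⊙ (x ∘ Fin.suc)) Vector.∷ λ j → (f ⟨$⟩ x Fin.zero) * v j

    eliminate-⊙ : ∀ {n} f (x : Fin (suc n) → Carrierᴹ) (v : Fin n → Carrier) →
      backSubstitute f x v ⊙ x ≈ᴹ
      v ⊙ (λ j → eliminate f (x Fin.zero) ⟨$⟩ x (Fin.suc j))
    eliminate-⊙ f x v = begin
      (- 1# * t) *ₗ x₀ +ᴹ (λ j → (f ⟨$⟩ x₀) * v j) ⊙ (x ∘ Fin.suc)
        ≈⟨ +ᴹ-cong (*ₗ-assoc _ _ _) (⊙-* _ v (x ∘ Fin.suc)) ⟩
      - 1# *ₗ t *ₗ x₀ +ᴹ (f ⟨$⟩ x₀) *ₗ v ⊙ (x ∘ Fin.suc)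
        ≈⟨ +ᴹ-comm _ _ ⟩
      eliminate f x₀ ⟨$⟩ v ⊙ (x ∘ Fin.suc)
        ≈⟨ ⊙-homo (eliminate f x₀) v (x ∘ Fin.suc) ⟩
      v ⊙ (λ j → eliminate f x₀ ⟨$⟩ x (Fin.suc j)) ∎
      where
      x₀ = x Fin.zero
      t = f ⟨$⟩ v ⊙ (x ∘ Fin.suc)

    unit-⊙ : ∀ {n} (x : Fin (suc n) → Carrierᴹ) → (1# Vector.∷ λ _ → 0#) ⊙ x ≈ᴹ x Fin.zero
    unit-⊙ x = ≈ᴹ-trans (+ᴹ-cong (*ₗ-identityˡ _) (⊙-zero (x ∘ Fin.suc) λ _ → R.refl)) (+ᴹ-identityʳ _)

  module StableDVR {π : Carrier} (dvr : IsStableDVR R π) where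
    open IsStableDVR dvr

    1≉0 : ¬ 1# ≈ 0#
    1≉0 e = π∤1 (0# , R.trans e (R.sym (R.zeroʳ π)))

    module _ (M : Module R m ℓm) where
      open Module M
      open Combination M
      open Elimination M

      -- Induction on the number of vectors: if all functionals vanish on the first vector, that
      -- vector alone will do; otherwise a pivot removes one functional and one vector. The solution
      -- stays nonzero because its tail is only scaled by the nonzero pivot.
      dependent : ∀ {n l} (f : Fin n → Functional M) (x : Fin l → Carrierᴹ) → n ℕ.< l →
                  ¬ ¬ ∃ λ v → ¬ (∀ j → v j ≈ 0#) × (∀ i → f i ⟨$⟩ v ⊙ x ≈ 0#)
      dependent {n} {suc l} f x n<l κ = ¬¬-∀⊎∃ (λ i → ¬¬-map toSum (¬¬-excluded-middle {A = f i ⟨$⟩ x Fin.zero ≈ 0#})) λ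
        { (inj₁ vanish)   → κ ((1# Vector.∷ λ _ → 0#) , (λ v≈0 → 1≉0 (v≈0 Fin.zero)) ,
                              λ i → R.trans (cong (f i) (unit-⊙ x)) (vanish i))
        ; (inj₂ (i , d≉0)) → pivot f n<l i d≉0 κ }
        where
        pivot : ∀ {n} (f : Fin n → Functional M) → n ℕ.< suc l → ∀ i → ¬ f i ⟨$⟩ x Fin.zero ≈ 0# →
                ¬ ¬ ∃ λ v → ¬ (∀ j → v j ≈ 0#) × (∀ i → f i ⟨$⟩ v ⊙ x ≈ 0#)
        pivot {suc n} f (s≤s n<l) i d≉0 κ = dependent (f ∘ punchIn i) (λ j → E ⟨$⟩ x (Fin.suc j)) n<l
          λ { (v , v≉0 , h) → κ (backSubstitute (f i) x v , (λ w≈0 → v≉0 λ j → *-cancel d≉0 (w≈0 (Fin.suc j))) ,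
            λ i′ → R.trans (cong (f i′) (eliminate-⊙ (f i) x v)) (vanish v h i′)) }
          where
          E = eliminate (f i) (x Fin.zero)
          y = λ j → E ⟨$⟩ x (Fin.suc j)
          vanish : ∀ v → (∀ i′ → f (punchIn i i′) ⟨$⟩ v ⊙ y ≈ 0#) → ∀ i′ → f i′ ⟨$⟩ v ⊙ y ≈ 0#
          vanish v h i′ with i Fin.≟ i′
          ... | yes ≡.refl = R.trans (cong (f i) (≈ᴹ-sym (⊙-homo E v (x ∘ Fin.suc)))) (functional-eliminate (f i) (x Fin.zero) _)
          ... | no  i≢i′   = ≡.subst (λ s → f s ⟨$⟩ v ⊙ y ≈ 0#) (punchIn-punchOut i≢i′) (h (punchOut i≢i′))

      module _ (multiple-or-functional : ∀ x → ¬ ¬ ((∃ λ y → x ≈ᴹ π *ₗ y) ⊎ ∃ λ (f : Functional M) → f ⟨$⟩ x ≈ 1#)) where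

        -- Such dual functionals exhibit the span of `x` as a free direct summand.
        Retraction : ∀ {n} → (Fin n → Carrierᴹ) → Set _
        Retraction {n} x = ∃ λ (f : Fin n → Functional M) → ∀ v j → f j ⟨$⟩ v ⊙ x ≈ v j

        DependentModπ : ∀ {n} → (Fin n → Carrierᴹ) → Set _
        DependentModπ x = ∃₂ λ v y → ¬ (∀ j → ∃ λ z → v j ≈ π * z) × v ⊙ x ≈ᴹ π *ₗ y

        -- Elimination with pivots normalised to 1. A first vector divisible by π is itself a
        -- dependency; otherwise some functional takes the value 1 on it, and back substitution with
        -- this pivot keeps the coefficients from all being divisible by π.
        retraction-or-dependent : ∀ {n} (x : Fin n → Carrierᴹ) → ¬ ¬ (Retraction x ⊎ DependentModπ x)
        retraction-or-dependent {zero}  x κ = κ (inj₁ ((λ ()) , λ _ ()))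
        retraction-or-dependent {suc n} x κ = multiple-or-functional x₀ λ
          { (inj₁ (y , e)) → κ (inj₂ ((1# Vector.∷ λ _ → 0#) , y , (λ h → π∤1 (h Fin.zero)) , ≈ᴹ-trans (unit-⊙ x) e))
          ; (inj₂ (f , fx₀≈1)) → retraction-or-dependent (λ j → eliminate f x₀ ⟨$⟩ x (Fin.suc j)) λ
            { (inj₁ (g , inv)) → κ (inj₁ (retract f fx₀≈1 g inv))
            ; (inj₂ (v , y , v≢0 , e)) → κ (inj₂ (backSubstitute f x v , y ,
                (λ h → v≢0 λ j → let (z , d) = h (Fin.suc j) in
                  z , R.trans (R.sym (R.trans (R.*-congʳ fx₀≈1) (R.*-identityˡ _))) d) ,
                ≈ᴹ-trans (eliminate-⊙ f x v) e)) } }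
          where
          x₀ = x Fin.zero
          retract : (f : Functional M) → f ⟨$⟩ x₀ ≈ 1# → (g : Fin n → Functional M) →
                    (∀ v j → g j ⟨$⟩ v ⊙ (λ j → eliminate f x₀ ⟨$⟩ x (Fin.suc j)) ≈ v j) → Retraction x
          retract f fx₀≈1 g inv = (f ∘ᴸ rest Vector.∷ g′) , λ { v Fin.zero → head v ; v (Fin.suc j) → tails v j }
            where
            open import Relation.Binary.Reasoning.Setoid ≈ᴹ-setoid
            E = eliminate f x₀
            g′ : Fin n → Functional M
            g′ j = g j ∘ᴸ E
            -- `f` may be nonzero on the later vectors, so their components, recovered by `g′`, are
            -- subtracted before `f` is applied.
            rest : LinearMap M M
            rest = idᴸ +ᴸ - 1# *ᴸ combine g′ (x ∘ Fin.suc)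
            tails : ∀ v j → g′ j ⟨$⟩ v ⊙ x ≈ v (Fin.suc j)
            tails v j = R.trans (cong (g j) (begin
              E ⟨$⟩ v ⊙ x
                ≈⟨ ⊙-homo E v x ⟩
              v Fin.zero *ₗ (E ⟨$⟩ x₀) +ᴹ (v ∘ Fin.suc) ⊙ (λ j → E ⟨$⟩ x (Fin.suc j))
                ≈⟨ +ᴹ-congʳ (≈ᴹ-trans (*ₗ-congˡ (eliminate-self f x₀)) (*ₗ-zeroʳ _)) ⟩
              0ᴹ +ᴹ (v ∘ Fin.suc) ⊙ (λ j → E ⟨$⟩ x (Fin.suc j))
                ≈⟨ +ᴹ-identityˡ _ ⟩
              (v ∘ Fin.suc) ⊙ (λ j → E ⟨$⟩ x (Fin.suc j)) ∎)) (inv (v ∘ Fin.suc) j)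
            restᵥ : ∀ v → rest ⟨$⟩ v ⊙ x ≈ᴹ v Fin.zero *ₗ x₀
            restᵥ v = begin
              v ⊙ x +ᴹ - 1# *ₗ (combine g′ (x ∘ Fin.suc) ⟨$⟩ v ⊙ x)
                ≈⟨ +ᴹ-congˡ (*ₗ-congˡ (≈ᴹ-trans (combine-⊙ {N = M} g′ (x ∘ Fin.suc) (v ⊙ x)) (⊙-congʳ (x ∘ Fin.suc) (tails v)))) ⟩
              v Fin.zero *ₗ x₀ +ᴹ (v ∘ Fin.suc) ⊙ (x ∘ Fin.suc) +ᴹ - 1# *ₗ (v ∘ Fin.suc) ⊙ (x ∘ Fin.suc)
                ≈⟨ +ᴹ-assoc _ _ _ ⟩
              v Fin.zero *ₗ x₀ +ᴹ ((v ∘ Fin.suc) ⊙ (x ∘ Fin.suc) +ᴹ - 1# *ₗ (v ∘ Fin.suc) ⊙ (x ∘ Fin.suc))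
                ≈⟨ +ᴹ-congˡ (x-x≈0 _) ⟩
              v Fin.zero *ₗ x₀ +ᴹ 0ᴹ
                ≈⟨ +ᴹ-identityʳ _ ⟩
              v Fin.zero *ₗ x₀ ∎
            head : ∀ v → f ⟨$⟩ rest ⟨$⟩ v ⊙ x ≈ v Fin.zero
            head v = R.trans (cong f (restᵥ v)) (R.trans (*-homo f _ _) (R.trans (R.*-congˡ fx₀≈1) (R.*-identityʳ _)))

    module Free (M : Module R m ℓm) (free : IsFiniteFree M) where
      open Module M
      open Combination M
      private
        rank = proj₁ free
      basis : Fin rank → Carrierᴹ
      basis = proj₁ (proj₂ free)
      open IsBasis (proj₂ (proj₂ free))

      basis-injective : ∀ {v w} → v ⊙ basis ≈ᴹ w ⊙ basis → ∀ j → v j ≈ w j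
      basis-injective {v} {w} e j = Combination.x-y≈0⇒x≈y scalars (independent (λ j → v j + - 1# * w j)
        (≈ᴹ-trans (⊙-+ v (λ j → - 1# * w j) basis)
          (≈ᴹ-trans (+ᴹ-cong e (⊙-* (- 1#) w basis)) (x-x≈0 _))) j)

      coordinates : Carrierᴹ → Fin rank → Carrier
      coordinates x = proj₁ (spanning x)

      expansion : ∀ x → x ≈ᴹ coordinates x ⊙ basis
      expansion x = proj₂ (spanning x)

      coordinate : Fin rank → Functional M
      coordinate j = record
        { _⟨$⟩_  = λ x → coordinates x j
        ; cong   = λ {x} {y} e → basis-injective (≈ᴹ-trans (≈ᴹ-sym (expansion x)) (≈ᴹ-trans e (expansion y))) j
        ; +-homo = λ x y → basis-injective (≈ᴹ-trans (≈ᴹ-sym (expansion _))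
            (≈ᴹ-trans (+ᴹ-cong (expansion x) (expansion y)) (≈ᴹ-sym (⊙-+ (coordinates x) (coordinates y) basis)))) j
        ; *-homo = λ r x → basis-injective (≈ᴹ-trans (≈ᴹ-sym (expansion _))
            (≈ᴹ-trans (*ₗ-congˡ (expansion x)) (≈ᴹ-sym (⊙-* r (coordinates x) basis)))) j
        }

      coordinate-⊙ : ∀ v j → coordinate j ⟨$⟩ v ⊙ basis ≈ v j
      coordinate-⊙ v j = basis-injective (≈ᴹ-sym (expansion (v ⊙ basis))) j

      coordinates≈0⇒≈0 : ∀ {x} → (∀ j → coordinate j ⟨$⟩ x ≈ 0#) → x ≈ᴹ 0ᴹ
      coordinates≈0⇒≈0 {x} e = ≈ᴹ-trans (expansion x) (⊙-zero basis e)

      ≈0-stable : ∀ {x} → ¬ ¬ x ≈ᴹ 0ᴹ → x ≈ᴹ 0ᴹ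
      ≈0-stable ¬¬e = coordinates≈0⇒≈0 λ j → ≈-stable λ d → ¬¬e λ e → d (zero-homo (coordinate j) e)

      *ₗ-cancel : ∀ {r x} → ¬ r ≈ 0# → r *ₗ x ≈ᴹ 0ᴹ → x ≈ᴹ 0ᴹ
      *ₗ-cancel r≉0 e = coordinates≈0⇒≈0 λ j → *-cancel r≉0
        (R.trans (R.sym (*-homo (coordinate j) _ _)) (zero-homo (coordinate j) e))

      -- Either all coordinates are divisible by π, or one of them is a unit and rescaling it gives
      -- the functional.
      multiple-or-functional : ∀ x → ¬ ¬ ((∃ λ y → x ≈ᴹ π *ₗ y) ⊎ ∃ λ (f : Functional M) → f ⟨$⟩ x ≈ 1#)
      multiple-or-functional x κ = ¬¬-∀⊎∃ (λ j ι → unit-or-multiple (coordinate j ⟨$⟩ x) λ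
        { (inj₁ u) → ι (inj₂ u) ; (inj₂ y) → ι (inj₁ y) }) λ
        { (inj₁ multiples)    → κ (inj₁ ((proj₁ ∘ multiples) ⊙ basis ,
            ≈ᴹ-trans (expansion x) (≈ᴹ-trans (⊙-congʳ basis (proj₂ ∘ multiples)) (⊙-* π _ basis))))
        ; (inj₂ (j , u , e)) → κ (inj₂ (u *ᴸ coordinate j , e)) }

      dependent-free : ∀ {l} (x : Fin l → Carrierᴹ) → rank ℕ.< l →
                       ¬ ¬ ∃ λ v → ¬ (∀ j → v j ≈ 0#) × v ⊙ x ≈ᴹ 0ᴹ
      dependent-free x r<l κ = dependent M coordinate x r<l λ { (v , v≉0 , h) → κ (v , v≉0 , coordinates≈0⇒≈0 h) }

-- The filtration

open import Data.Integer.Base using (_+_; _*_; _<_)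

prime∤⇒coprime : ∀ {p d} → Prime p → ¬ p ∣ d → Coprime p d
prime∤⇒coprime pp p∤d (e∣p , e∣d) with prime⇒irreducible pp e∣p
... | inj₁ e≡1    = e≡1
... | inj₂ ≡.refl = ⊥-elim (p∤d e∣d)

-- Integers as scalars

module IntegerScalars (R : CommutativeRing c ℓ) where
  open CommutativeRing R hiding (_+_; _*_)
  open CommutativeRing R using () renaming (_+_ to _⊹_; _*_ to _⋆_)
  open import Algebra.Properties.Semiring.Mult semiring using (×1-homo-*) renaming (_×_ to _·_)
  open import Algebra.Properties.Ring ring using (-‿distribˡ-*)
  open import Algebra.Properties.AbelianGroup +-abelianGroup using (⁻¹-∙-comm)
  open import Algebra.Properties.CommutativeSemigroup +-commutativeSemigroup using (x∙yz≈y∙xz)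
  open import Relation.Binary.Reasoning.Setoid setoid

  ⟦_⟧ : ℤ → Carrier
  ⟦ + n ⟧      = n · 1#
  ⟦ -[1+ n ] ⟧ = - (suc n · 1#)

  ⟦⟧-suc : ∀ z → ⟦ 1ℤ + z ⟧ ≈ 1# ⊹ ⟦ z ⟧
  ⟦⟧-suc (+ n)          = refl
  ⟦⟧-suc -[1+ zero ]    = sym (trans (+-congˡ (-‿cong (+-identityʳ 1#))) (-‿inverseʳ 1#))
  ⟦⟧-suc -[1+ suc n ]   = sym (begin
    1# ⊹ - (1# ⊹ suc n · 1#)       ≈⟨ +-congˡ (⁻¹-∙-comm 1# (suc n · 1#)) ⟨
    1# ⊹ (- 1# ⊹ - (suc n · 1#))   ≈⟨ +-assoc _ _ _ ⟨
    1# ⊹ - 1# ⊹ - (suc n · 1#)     ≈⟨ +-congʳ (-‿inverseʳ 1#) ⟩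
    0# ⊹ - (suc n · 1#)            ≈⟨ +-identityˡ _ ⟩
    - (suc n · 1#)                 ∎)

  ⟦⟧-+ : ∀ z d → ⟦ z + + d ⟧ ≈ ⟦ z ⟧ ⊹ d · 1#
  ⟦⟧-+ z zero    = trans (reflexive (≡.cong ⟦_⟧ (ℤ.+-identityʳ z))) (sym (+-identityʳ _))
  ⟦⟧-+ z (suc d) = begin
    ⟦ z + + suc d ⟧           ≈⟨ reflexive (≡.cong ⟦_⟧ (swap z (+ d))) ⟩
    ⟦ 1ℤ + (z + + d) ⟧        ≈⟨ ⟦⟧-suc (z + + d) ⟩
    1# ⊹ ⟦ z + + d ⟧          ≈⟨ +-congˡ (⟦⟧-+ z d) ⟩
    1# ⊹ (⟦ z ⟧ ⊹ d · 1#)     ≈⟨ x∙yz≈y∙xz _ _ _ ⟩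
    ⟦ z ⟧ ⊹ (1# ⊹ d · 1#)     ∎
    where
    swap : ∀ z e → z + (1ℤ + e) ≡ 1ℤ + (z + e)
    swap = ℤ.solve-∀

  Comaximal : Carrier → Carrier → Set _
  Comaximal x y = ∃₂ λ α β → α ⋆ x ⊹ β ⋆ y ≈ 1#

  coprime⇒comaximal : ∀ {m n} → Coprime m n → Comaximal (m · 1#) (n · 1#)
  coprime⇒comaximal {m} {n} coprime with coprime-Bézout coprime
  ... | Bézout.+- x y eq = x · 1# , - (y · 1#) , (begin
    (x · 1#) ⋆ (m · 1#) ⊹ - (y · 1#) ⋆ (n · 1#)      ≈⟨ +-cong (×1-homo-* x m) (trans (-‿cong (×1-homo-* y n)) (-‿distribˡ-* _ _)) ⟨
    (x ℕ.* m) · 1# ⊹ - ((y ℕ.* n) · 1#)              ≈⟨ +-congʳ (reflexive (≡.cong (_· 1#) eq)) ⟨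
    1# ⊹ (y ℕ.* n) · 1# ⊹ - ((y ℕ.* n) · 1#)         ≈⟨ +-assoc _ _ _ ⟩
    1# ⊹ ((y ℕ.* n) · 1# ⊹ - ((y ℕ.* n) · 1#))       ≈⟨ trans (+-congˡ (-‿inverseʳ _)) (+-identityʳ 1#) ⟩
    1#                                               ∎)
  ... | Bézout.-+ x y eq = - (x · 1#) , y · 1# , (begin
    - (x · 1#) ⋆ (m · 1#) ⊹ (y · 1#) ⋆ (n · 1#)      ≈⟨ +-comm _ _ ⟩
    (y · 1#) ⋆ (n · 1#) ⊹ - (x · 1#) ⋆ (m · 1#)      ≈⟨ +-cong (×1-homo-* y n) (trans (-‿cong (×1-homo-* x m)) (-‿distribˡ-* _ _)) ⟨
    (y ℕ.* n) · 1# ⊹ - ((x ℕ.* m) · 1#)              ≈⟨ +-congʳ (reflexive (≡.cong (_· 1#) eq)) ⟨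
    1# ⊹ (x ℕ.* m) · 1# ⊹ - ((x ℕ.* m) · 1#)         ≈⟨ +-assoc _ _ _ ⟩
    1# ⊹ ((x ℕ.* m) · 1# ⊹ - ((x ℕ.* m) · 1#))       ≈⟨ trans (+-congˡ (-‿inverseʳ _)) (+-identityʳ 1#) ⟩
    1#                                               ∎)

  module _ (M : Module R m ℓm) where
    open Module M
    open import Algebra.Properties.Monoid.Mult +ᴹ-monoid using () renaming (_×_ to _·ᴹ_)
    open import Algebra.Properties.Group +ᴹ-group using (⁻¹-involutive; ε⁻¹≈ε; inverseʳ-unique)

    ·ᴹ≈*ₗ : ∀ n x → n ·ᴹ x ≈ᴹ (n · 1#) *ₗ x
    ·ᴹ≈*ₗ zero    x = ≈ᴹ-sym (*ₗ-zeroˡ x)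
    ·ᴹ≈*ₗ (suc n) x = ≈ᴹ-trans (+ᴹ-cong (≈ᴹ-sym (*ₗ-identityˡ x)) (·ᴹ≈*ₗ n x)) (≈ᴹ-sym (*ₗ-distribʳ x _ _))

    -*ₗ : ∀ r x → (- r) *ₗ x ≈ᴹ -ᴹ (r *ₗ x)
    -*ₗ r x = inverseʳ-unique (r *ₗ x) ((- r) *ₗ x)
      (≈ᴹ-trans (≈ᴹ-sym (*ₗ-distribʳ x r (- r))) (≈ᴹ-trans (*ₗ-congʳ (-‿inverseʳ r)) (*ₗ-zeroˡ x)))

    -- The hypothesis on Θ concerns the difference Θ x - (-i)·x in the coset relation of gr i; this
    -- turns its double sign into the scalar of Θ + i.
    -[-i·x]≈i*x : ∀ i x → -ᴹ (_·ℤ_ M (ℤ.- i) x) ≈ᴹ ⟦ i ⟧ *ₗ x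
    -[-i·x]≈i*x (+ zero)  x = ≈ᴹ-trans ε⁻¹≈ε (≈ᴹ-sym (*ₗ-zeroˡ x))
    -[-i·x]≈i*x (+ suc n) x = ≈ᴹ-trans (⁻¹-involutive _) (·ᴹ≈*ₗ (suc n) x)
    -[-i·x]≈i*x -[1+ n ]  x = ≈ᴹ-trans (-ᴹ‿cong (·ᴹ≈*ₗ (suc n) x)) (≈ᴹ-sym (-*ₗ _ x))

open LinearMap using (_⟨$⟩_; cong; +-homo; *-homo; 0-homo; zero-homo; ⊙-homo)

module _ {R : CommutativeRing c ℓ} {π : CommutativeRing.Carrier R} (dvr : IsStableDVR R π) where
  open CommutativeRing R using (Carrier; _≈_; 0#; 1#; -_)
  private module R = CommutativeRing R
  open IsStableDVR dvr
  open StableDVR dvr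

  -- Injective maps between finite free modules

  module Embedding (M : Module R m₁ ℓm₁) (N : Module R m₂ ℓm₂) (freeM : IsFiniteFree M) (freeN : IsFiniteFree N)
                   (f : LinearMap M N)
                   (injective : ∀ {x y} → Module._≈ᴹ_ N (f ⟨$⟩ x) (f ⟨$⟩ y) → Module._≈ᴹ_ M x y) where
    private
      module M = Module M
      module N = Module N
      module freeM = Free M freeM
      module freeN = Free N freeN
      module CM = Combination M
      module CN = Combination N
      rankM = proj₁ freeM
      rankN = proj₁ freeN

    injective₀ : ∀ {x} → f ⟨$⟩ x N.≈ᴹ N.0ᴹ → x M.≈ᴹ M.0ᴹ
    injective₀ e = injective (N.≈ᴹ-trans e (N.≈ᴹ-sym (0-homo f)))

    TorsionCokernel : Set _
    TorsionCokernel = ∀ y → ∃₂ λ s x → ¬ s ≈ 0# × s N.*ₗ y N.≈ᴹ f ⟨$⟩ x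

    rank-≤ : rankM ℕ.≤ rankN
    rank-≤ = ℕ.≮⇒≥ λ N<M → freeN.dependent-free (λ j → f ⟨$⟩ freeM.basis j) N<M
      λ { (v , v≉0 , e) → v≉0 λ j → R.trans (R.sym (freeM.coordinate-⊙ v j))
        (zero-homo (freeM.coordinate j) (injective₀ (N.≈ᴹ-trans (⊙-homo f v freeM.basis) e))) }

    -- Let x_j be the preimage of a nonzero multiple s_j e_j of a basis vector. A dependency v among
    -- too many x_j gives the relation with coefficients v_j s_j among the e_j, whence v = 0.
    torsionCokernel⇒rank-≥ : TorsionCokernel → rankN ℕ.≤ rankM
    torsionCokernel⇒rank-≥ torsion = ℕ.≮⇒≥ λ M<N → freeM.dependent-free x M<N
      λ { (v , v≉0 , e) → v≉0 λ j → *-cancel (s≉0 j) (R.trans (R.*-comm _ _) (R.trans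
        (R.sym (freeN.coordinate-⊙ (λ j → v j R.* s j) j)) (zero-homo (freeN.coordinate j) (begin
          (λ j → v j R.* s j) CN.⊙ freeN.basis   ≈⟨ sum-cong-≋ (λ j → N.*ₗ-assoc (v j) (s j) (freeN.basis j)) ⟩
          v CN.⊙ (λ j → s j N.*ₗ freeN.basis j)  ≈⟨ CN.⊙-cong (λ _ → R.refl) (λ j → proj₂ (proj₂ (proj₂ (torsion (freeN.basis j))))) ⟩
          v CN.⊙ (λ j → f ⟨$⟩ x j)               ≈⟨ ⊙-homo f v x ⟨
          f ⟨$⟩ v CM.⊙ x                         ≈⟨ zero-homo f e ⟩
          N.0ᴹ                                   ∎)))) }
      where
      open import Algebra.Properties.Monoid.Sum N.+ᴹ-monoid using (sum-cong-≋)
      open import Relation.Binary.Reasoning.Setoid N.≈ᴹ-setoid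
      s : Fin rankN → Carrier
      s j = proj₁ (torsion (freeN.basis j))
      x : Fin rankN → M.Carrierᴹ
      x j = proj₁ (proj₂ (torsion (freeN.basis j)))
      s≉0 : ∀ j → ¬ s j ≈ 0#
      s≉0 j = proj₁ (proj₂ (proj₂ (torsion (freeN.basis j))))

    -- Together with y, the images of the basis of M are one vector too many, hence dependent. The
    -- coefficient of y is nonzero, as injectivity would otherwise make the basis of M dependent.
    rank-≡⇒torsion : rankM ≡ rankN → ∀ y → ¬ ¬ ∃₂ λ s x → ¬ s ≈ 0# × s N.*ₗ y N.≈ᴹ f ⟨$⟩ x
    rank-≡⇒torsion M≡N y κ = freeN.dependent-free (y Vector.∷ λ j → f ⟨$⟩ freeM.basis j)
      (s≤s (ℕ.≤-reflexive (≡.sym M≡N)))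
      λ { (v , v≉0 , e) → κ (v Fin.zero , - 1# M.*ₗ (v ∘ Fin.suc) CM.⊙ freeM.basis ,
        (λ v₀≈0 → v≉0 λ { Fin.zero → v₀≈0 ; (Fin.suc j) →
          R.trans (R.sym (freeM.coordinate-⊙ (v ∘ Fin.suc) j)) (zero-homo (freeM.coordinate j) (injective₀
            (N.≈ᴹ-trans (⊙-homo f (v ∘ Fin.suc) freeM.basis) (N.≈ᴹ-trans (N.≈ᴹ-sym (N.≈ᴹ-trans
              (N.+ᴹ-congʳ (N.≈ᴹ-trans (N.*ₗ-congʳ v₀≈0) (N.*ₗ-zeroˡ y))) (N.+ᴹ-identityˡ _))) e)))) }) ,
        N.≈ᴹ-trans (inverseˡ-unique _ _ e) (N.≈ᴹ-sym (N.≈ᴹ-trans (*-homo f _ _)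
          (N.≈ᴹ-trans (N.*ₗ-congˡ (⊙-homo f (v ∘ Fin.suc) freeM.basis)) (CN.-1*≈- _))))) }
      where open import Algebra.Properties.Group N.+ᴹ-group using (inverseˡ-unique)

    Saturated : Set _
    Saturated = ∀ {s x y} → ¬ s ≈ 0# → s N.*ₗ y N.≈ᴹ f ⟨$⟩ x → ∃ λ z → y N.≈ᴹ f ⟨$⟩ z

    NonsaturatedModπ : Set _
    NonsaturatedModπ = ∃₂ λ x y → f ⟨$⟩ x N.≈ᴹ π N.*ₗ y × ¬ ∃ λ z → x M.≈ᴹ π M.*ₗ z

    -- The functionals assemble to a linear left inverse ρ of f. From s y = f x follows s (y - f ρ
    -- y) = 0, and s cancels in the free module N.
    retraction⇒saturated : Retraction N freeN.multiple-or-functional (λ j → f ⟨$⟩ freeM.basis j) → Saturated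
    retraction⇒saturated (g , inv) {s} {x} {y} s≉0 e = ρ ⟨$⟩ y , CN.x-y≈0⇒x≈y (freeN.*ₗ-cancel s≉0 (begin
      s N.*ₗ (y N.+ᴹ - 1# N.*ₗ (f ⟨$⟩ ρ ⟨$⟩ y))                ≈⟨ *-homo (idᴸ +ᴸ - 1# *ᴸ (f ∘ᴸ ρ)) s y ⟨
      s N.*ₗ y N.+ᴹ - 1# N.*ₗ (f ⟨$⟩ ρ ⟨$⟩ s N.*ₗ y)           ≈⟨ cong (idᴸ +ᴸ - 1# *ᴸ (f ∘ᴸ ρ)) e ⟩
      (f ⟨$⟩ x) N.+ᴹ - 1# N.*ₗ (f ⟨$⟩ ρ ⟨$⟩ f ⟨$⟩ x)           ≈⟨ N.+ᴹ-congˡ (N.*ₗ-congˡ (cong f (ρf≈id x))) ⟩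
      (f ⟨$⟩ x) N.+ᴹ - 1# N.*ₗ (f ⟨$⟩ x)                       ≈⟨ CN.x-x≈0 _ ⟩
      N.0ᴹ                                                     ∎))
      where
      open import Relation.Binary.Reasoning.Setoid N.≈ᴹ-setoid
      ρ : LinearMap N M
      ρ = combine g freeM.basis
      ρf≈id : ∀ x → ρ ⟨$⟩ f ⟨$⟩ x M.≈ᴹ x
      ρf≈id x = M.≈ᴹ-trans (combine-⊙ {N = M} g freeM.basis (f ⟨$⟩ x)) (M.≈ᴹ-trans
        (CM.⊙-congʳ freeM.basis λ j → R.trans
          (cong (g j) (N.≈ᴹ-trans (cong f (freeM.expansion x)) (⊙-homo f (freeM.coordinates x) freeM.basis)))
          (inv (freeM.coordinates x) j))
        (M.≈ᴹ-sym (freeM.expansion x)))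

    saturated-or-not : ¬ ¬ (Saturated ⊎ NonsaturatedModπ)
    saturated-or-not κ = retraction-or-dependent N freeN.multiple-or-functional (λ j → f ⟨$⟩ freeM.basis j) λ
      { (inj₁ retraction) → κ (inj₁ λ {s} {x} {y} → retraction⇒saturated retraction {s} {x} {y})
      ; (inj₂ (v , y , v≢0 , e)) → κ (inj₂ (v CM.⊙ freeM.basis , y , N.≈ᴹ-trans (⊙-homo f v freeM.basis) e ,
          λ { (z , d) → v≢0 λ j → freeM.coordinates z j , R.trans (R.sym (freeM.coordinate-⊙ v j))
            (R.trans (cong (freeM.coordinate j) d) (*-homo (freeM.coordinate j) π z)) })) }

module _ {R : CommutativeRing c ℓ} {p : ℕ} (pp : Prime p) where
  open CommutativeRing R using (Carrier; _≈_; 0#; 1#; -_)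
  open import Algebra.Properties.Semiring.Mult (CommutativeRing.semiring R) using () renaming (_×_ to _·_)
  open import Algebra.Properties.Semiring.Exp (CommutativeRing.semiring R) using (_^_)
  private
    module R = CommutativeRing R
    π = p · 1#

  -- Annihilating products on the filtration

  module ConjugateFiltration (dvr : IsStableDVR R π) (F : Filtration R m ℓm) (Θ : FilteredEndomorphism F)
                             (acts : FilteredEndomorphism.ActsOnGrByMinusIndex Θ) where
    open Filtration F
    open FilteredEndomorphism Θ using (Θ-hom; Θ-ι)
    open IntegerScalars R
    open StableDVR dvr
    open IsStableDVR dvr

    private
      module Fil i = Module (Fil i)
      module Free′ i = Free (Fil i) (finiteFree i)

    rank : ℤ → ℕ
    rank i = proj₁ (finiteFree i)

    ιᴸ : ∀ i → LinearMap (Fil (ℤ.pred i)) (Fil i)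
    ιᴸ i = linearMap (IsModuleMonomorphism.isModuleHomomorphism (ι-mono i))

    Θᴸ : ∀ i → LinearMap (Fil i) (Fil i)
    Θᴸ i = linearMap (Θ-hom i)

    module Emb i = Embedding dvr (Fil (ℤ.pred i)) (Fil i) (finiteFree (ℤ.pred i)) (finiteFree i) (ιᴸ i)
                             (IsModuleMonomorphism.injective (ι-mono i))

    cokernel-zero : ∀ i {x y} → Fil._≈ᴹ_ i y (Fil.0ᴹ i) → Module._≈ᴹ_ (gr i) x y → ∃ λ z → Fil._≈ᴹ_ i x (ι i z)
    cokernel-zero i {x} {y} y≈0 (z , e) = z , ≈ᴹ-trans (≈ᴹ-sym (≈ᴹ-trans
      (+ᴹ-congˡ (≈ᴹ-trans (-ᴹ‿cong y≈0) ε⁻¹≈ε)) (+ᴹ-identityʳ x))) e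
      where
      open Module (Fil i)
      open import Algebra.Properties.Group +ᴹ-group using (ε⁻¹≈ε)

    π^≉0 : ∀ n → ¬ π ^ n ≈ 0#
    π^≉0 zero    = 1≉0
    π^≉0 (suc n) = π^≉0 n ∘ *-cancel π≉0

    -- If gr i [1/p] vanishes, a power of p moves every y into the previous step, so the inclusion
    -- has torsion cokernel and both rank inequalities hold.
    rankJump⇒HT : ∀ i → ¬ rank (ℤ.pred i) ≡ rank i → HT F p i
    rankJump⇒HT i jump vanish = jump (ℕ.≤-antisym (Emb.rank-≤ i) (Emb.torsionCokernel⇒rank-≥ i λ y →
      let (n , e) = vanish (y , 0)
          (x , d) = cokernel-zero i (Fil.*ₗ-zeroʳ i _) e
      in π ^ (n ℕ.+ 0) , x , π^≉0 (n ℕ.+ 0) , d))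

    shift : ∀ j → ℤ → LinearMap (Fil j) (Fil j)
    shift j r = Θᴸ j +ᴸ ⟦ r ⟧ *ᴸ idᴸ

    shift-ι : ∀ j r x → Fil._≈ᴹ_ j (shift j r ⟨$⟩ ιᴸ j ⟨$⟩ x) (ιᴸ j ⟨$⟩ shift (ℤ.pred j) r ⟨$⟩ x)
    shift-ι j r x = ≈ᴹ-trans (+ᴹ-cong (Θ-ι j x) (≈ᴹ-sym (*-homo (ιᴸ j) ⟦ r ⟧ x))) (≈ᴹ-sym (+-homo (ιᴸ j) _ _))
      where open Module (Fil j)

    -- Both sides use the same addition, but iterate it in two different monoid structures, so
    -- agreement takes an induction.
    ·ℤ-gr : ∀ j z x → _·ℤ_ (gr j) z x ≡ _·ℤ_ (Fil j) z x
    ·ℤ-gr j z x = integer z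
      where
      open Module (Fil j)
      open import Algebra.Properties.Monoid.Mult +ᴹ-monoid using () renaming (_×_ to _·ᶠ_)
      open import Algebra.Properties.Monoid.Mult (Module.+ᴹ-monoid (gr j)) using () renaming (_×_ to _·ᵍ_)
      natural : ∀ n → n ·ᵍ x ≡ n ·ᶠ x
      natural zero    = ≡.refl
      natural (suc n) = ≡.cong (x +ᴹ_) (natural n)
      integer : ∀ z → _·ℤ_ (gr j) z x ≡ _·ℤ_ (Fil j) z x
      integer (+ n)    = natural n
      integer -[1+ n ] = ≡.cong -ᴹ_ (natural (suc n))

    shift-gr : ∀ j x → ∃ λ z → Fil._≈ᴹ_ j (shift j j ⟨$⟩ x) (ι j z)
    shift-gr j x with acts j x
    ... | z , e = z , ≈ᴹ-trans (+ᴹ-congˡ (≈ᴹ-trans (≈ᴹ-sym (-[-i·x]≈i*x (Fil j) j x))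
      (-ᴹ‿cong (≈ᴹ-reflexive (≡.sym (·ℤ-gr j (ℤ.- j) x)))))) e
      where open Module (Fil j)

    shift-+ : ∀ j r d {i} → r + + d ≡ i → ∀ x →
              Fil._≈ᴹ_ j (shift j i ⟨$⟩ x) (Fil._+ᴹ_ j (shift j r ⟨$⟩ x) (Fil._*ₗ_ j (d · 1#) x))
    shift-+ j r d ≡.refl x = ≈ᴹ-trans (+ᴹ-congˡ (≈ᴹ-trans (*ₗ-congʳ (⟦⟧-+ r d)) (*ₗ-distribʳ x _ _))) (≈ᴹ-sym (+ᴹ-assoc _ _ _))
      where open Module (Fil j)

    -- The head of the list acts first: the factor adjoined last moves Fil j into the previous step,
    -- where the older factors annihilate.
    shifts : ∀ j → List ℤ → LinearMap (Fil j) (Fil j)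
    shifts j []       = idᴸ
    shifts j (r ∷ rs) = shifts j rs ∘ᴸ shift j r

    shifts-ι : ∀ j rs x → Fil._≈ᴹ_ j (shifts j rs ⟨$⟩ ιᴸ j ⟨$⟩ x) (ιᴸ j ⟨$⟩ shifts (ℤ.pred j) rs ⟨$⟩ x)
    shifts-ι j []       x = Fil.≈ᴹ-refl j
    shifts-ι j (r ∷ rs) x = Fil.≈ᴹ-trans j (cong (shifts j rs) (shift-ι j r x)) (shifts-ι j rs _)

    Annihilates : List ℤ → ℤ → Set _
    Annihilates rs j = ∀ x → Fil._≈ᴹ_ j (shifts j rs ⟨$⟩ x) (Fil.0ᴹ j)

    annihilates-ι : ∀ {rs} j → Annihilates rs (ℤ.pred j) → ∀ x → Fil._≈ᴹ_ j (shifts j rs ⟨$⟩ ιᴸ j ⟨$⟩ x) (Fil.0ᴹ j)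
    annihilates-ι {rs} j ann x = Fil.≈ᴹ-trans j (shifts-ι j rs x) (zero-homo (ιᴸ j) (ann x))

    annihilates-∷ : ∀ {rs} j → Annihilates rs (ℤ.pred j) → Annihilates (j ∷ rs) j
    annihilates-∷ {rs} j ann x = let (z , e) = shift-gr j x in
      Fil.≈ᴹ-trans j (cong (shifts j rs) e) (annihilates-ι {rs} j ann z)

    -- The product kills a nonzero multiple of x coming from the previous step, hence x itself. That
    -- multiple exists only up to double negation, which is enough because vanishing in a free
    -- module is stable.
    annihilates-rank-≡ : ∀ {rs} j → rank (ℤ.pred j) ≡ rank j → Annihilates rs (ℤ.pred j) → Annihilates rs j
    annihilates-rank-≡ {rs} j eq ann x = Free′.≈0-stable j λ ≉0 → Emb.rank-≡⇒torsion j eq x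
      λ { (s , z , s≉0 , e) → ≉0 (Free′.*ₗ-cancel j s≉0 (≈ᴹ-trans (≈ᴹ-sym (*-homo (shifts j rs) s x))
        (≈ᴹ-trans (cong (shifts j rs) e) (annihilates-ι {rs} j ann z)))) }
      where open Module (Fil j)

    module _ (i : ℤ) where

      -- The factors come from steps below i, so the distance is a natural number; non-divisibility
      -- by p also excludes 0.
      PrimeToDistance : ℤ → Set
      PrimeToDistance r = ∃ λ d → ¬ p ∣ d × r + + d ≡ i

      Multiple : ∀ j → Fil.Carrierᴹ j → Set _
      Multiple j x = ∃ λ y → Fil._≈ᴹ_ j x (Fil._*ₗ_ j π y)

      module _ (j : ℤ) where
        open Module (Fil j)
        open Combination (Fil j) using (x-x≈0)
        open import Relation.Binary.Reasoning.Setoid ≈ᴹ-setoid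

        multiple-resp : ∀ {x y} → x ≈ᴹ y → Multiple j x → Multiple j y
        multiple-resp e (z , d) = z , ≈ᴹ-trans (≈ᴹ-sym e) d

        multiple-+ : ∀ {x y} → Multiple j x → Multiple j y → Multiple j (x +ᴹ y)
        multiple-+ (z , e) (w , d) = z +ᴹ w , ≈ᴹ-trans (+ᴹ-cong e d) (≈ᴹ-sym (*ₗ-distribˡ _ _ _))

        multiple-map : ∀ (f : LinearMap (Fil j) (Fil j)) {x} → Multiple j x → Multiple j (f ⟨$⟩ x)
        multiple-map f (z , e) = (f ⟨$⟩ z) , ≈ᴹ-trans (cong f e) (*-homo f π z)

        -- p and d are comaximal in R, so x is a combination of π x and d x.
        multiple-cancel : ∀ {d x} → ¬ p ∣ d → Multiple j ((d · 1#) *ₗ x) → Multiple j x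
        multiple-cancel {d} {x} p∤d mult = let (α , β , e) = coprime⇒comaximal (prime∤⇒coprime pp p∤d) in
          multiple-resp (begin
            α *ₗ π *ₗ x +ᴹ β *ₗ (d · 1#) *ₗ x       ≈⟨ +ᴹ-cong (*ₗ-assoc α π x) (*ₗ-assoc β (d · 1#) x) ⟨
            (α R.* π) *ₗ x +ᴹ (β R.* (d · 1#)) *ₗ x ≈⟨ *ₗ-distribʳ x _ _ ⟨
            (α R.* π R.+ β R.* (d · 1#)) *ₗ x       ≈⟨ *ₗ-congʳ e ⟩
            1# *ₗ x                                 ≈⟨ *ₗ-identityˡ x ⟩
            x                                       ∎)
            (multiple-+ (multiple-map (α *ᴸ idᴸ) (x , ≈ᴹ-refl)) (multiple-map (β *ᴸ idᴸ) mult))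

        subtract : ∀ {x y z} → x ≈ᴹ y +ᴹ z → x +ᴹ - 1# *ₗ z ≈ᴹ y
        subtract {x} {y} {z} e = ≈ᴹ-trans (+ᴹ-congʳ e) (≈ᴹ-trans (+ᴹ-assoc y z _)
          (≈ᴹ-trans (+ᴹ-congˡ (x-x≈0 z)) (+ᴹ-identityʳ y)))

        -- Where Θ + i vanishes modulo π, Θ + r acts as -(i - r), which is prime to p.
        multiple-shifts : ∀ {rs} → All PrimeToDistance rs → ∀ y →
                          Multiple j (shift j i ⟨$⟩ y) → Multiple j (shifts j rs ⟨$⟩ y) → Multiple j y
        multiple-shifts []                               y mᵢ mₛ = mₛ
        multiple-shifts {r ∷ rs} ((d , p∤d , eq) ∷ dist) y mᵢ mₛ = multiple-cancel p∤d
          (multiple-resp (subtract (≈ᴹ-trans (shift-+ j r d eq y) (+ᴹ-comm _ _)))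
            (multiple-+ mᵢ (multiple-map (- 1# *ᴸ idᴸ) (multiple-shifts dist y′ mᵢ′ mₛ))))
          where
          y′ = shift j r ⟨$⟩ y
          scale : LinearMap (Fil j) (Fil j)
          scale = - 1# *ᴸ (d · 1#) *ᴸ idᴸ
          -- As y′ = (Θ + i) y - d y, applying Θ + i gives a multiple of π again, so the recursion
          -- applies to y′.
          mᵢ′ : Multiple j (shift j i ⟨$⟩ y′)
          mᵢ′ = multiple-resp (≈ᴹ-trans (+ᴹ-congˡ (≈ᴹ-sym (≈ᴹ-trans (*-homo (shift j i) _ _) (*ₗ-congˡ (*-homo (shift j i) _ _)))))
              (≈ᴹ-trans (≈ᴹ-sym (+-homo (shift j i) _ _)) (cong (shift j i) (subtract (shift-+ j r d eq y)))))
            (multiple-+ (multiple-map (shift j i) mᵢ) (multiple-map scale mᵢ))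

      Translate : Set _
      Translate = ∃₂ λ (r q : ℤ) → HT F p r × 0ℤ < q × i ≡ r + q * + p

      -- `n` bounds the height of j above the vanishing range, where the empty product annihilates.
      -- The distance to i is `suc d`, as only steps strictly below i occur. Descending by one step
      -- lowers n and raises d.
      translate-or-annihilator : ∀ n d j → j + + suc d ≡ i → j ℤ.≤ proj₁ vanishes + + n →
        Translate ⊎ ∃ λ rs → All PrimeToDistance rs × Annihilates rs j
      translate-or-annihilator zero    d j eq j≤a = inj₂ ([] , [] ,
        proj₂ vanishes j (≡.subst (j ℤ.≤_) (ℤ.+-identityʳ _) j≤a))
      translate-or-annihilator (suc n) d j eq j≤a
        with translate-or-annihilator n (suc d) (ℤ.pred j) (≡.trans (lower j (+ suc d)) eq)
               (≡.subst (ℤ.pred j ℤ.≤_) (pred-bound (proj₁ vanishes) (+ n)) (ℤ.pred-mono j≤a))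
           | p ∣? suc d | rank (ℤ.pred j) ℕ.≟ rank j
        where
        lower : ∀ j e → (-1ℤ + j) + (1ℤ + e) ≡ j + e
        lower = ℤ.solve-∀
        pred-bound : ∀ a e → -1ℤ + (a + (1ℤ + e)) ≡ a + e
        pred-bound = ℤ.solve-∀
      ... | inj₁ translate            | _       | _        = inj₁ translate
      ... | inj₂ (rs , dist , ann) | no p∤d  | _        = inj₂ (j ∷ rs , (suc d , p∤d , eq) ∷ dist , annihilates-∷ {rs} j ann)
      ... | inj₂ (rs , dist , ann) | yes _   | yes same = inj₂ (rs , dist , annihilates-rank-≡ {rs} j same ann)
      -- The quotient is a successor because the distance `suc d` is nonzero; this is the positivity
      -- of m.
      ... | inj₂ _                 | yes (divides (suc q) d≡qp) | no jump = inj₁ (j , + suc q , rankJump⇒HT j jump ,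
        ℤ.+<+ (s≤s z≤n) , ≡.trans (≡.sym eq) (≡.cong (λ e → j + e) (≡.trans (≡.cong +_ d≡qp) (ℤ.pos-* (suc q) p))))

      saturated⇒torsionIsZero : Emb.Saturated i → TorsionIsZero (gr i)
      saturated⇒torsionIsZero saturated x (s , s≉0 , torsion) =
        let (w , e) = cokernel-zero i ≈ᴹ-refl torsion
            (z , d) = saturated {s} {w} {x} s≉0 e
        in z , ≈ᴹ-trans (+ᴹ-congˡ ε⁻¹≈ε) (≈ᴹ-trans (+ᴹ-identityʳ x) d)
        where
        open Module (Fil i)
        open import Algebra.Properties.Group +ᴹ-group using (ε⁻¹≈ε)

      annihilator⇒¬nonsaturated : ∀ {rs} → All PrimeToDistance rs → Annihilates rs (ℤ.pred i) → ¬ Emb.NonsaturatedModπ i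
      annihilator⇒¬nonsaturated {rs} dist ann (y , x , e , y∤) =
        let (z , d) = shift-gr i x in
        y∤ (multiple-shifts (ℤ.pred i) dist y
          -- Divisibility of (Θ + i) y is required inside Fil (i - 1): Θ + i carries the quotient x
          -- into Fil (i - 1), and injectivity of `ι` descends the equation.
          (z , IsModuleMonomorphism.injective (ι-mono i) (begin
            ιᴸ i ⟨$⟩ shift (ℤ.pred i) i ⟨$⟩ y    ≈⟨ shift-ι i i y ⟨
            shift i i ⟨$⟩ ιᴸ i ⟨$⟩ y             ≈⟨ cong (shift i i) e ⟩
            shift i i ⟨$⟩ π *ₗ x                 ≈⟨ *-homo (shift i i) π x ⟩
            π *ₗ (shift i i ⟨$⟩ x)               ≈⟨ *ₗ-congˡ d ⟩
            π *ₗ ι i z                           ≈⟨ *-homo (ιᴸ i) π z ⟨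
            ιᴸ i ⟨$⟩ Fil._*ₗ_ (ℤ.pred i) π z     ∎))
          (Fil.0ᴹ (ℤ.pred i) , Fil.≈ᴹ-trans (ℤ.pred i) (ann y) (Fil.≈ᴹ-sym (ℤ.pred i) (Fil.*ₗ-zeroʳ (ℤ.pred i) π))))
        where
        open Module (Fil i)
        open import Relation.Binary.Reasoning.Setoid ≈ᴹ-setoid

      torsion⇒translate : ¬ TorsionIsZero (gr i) → Translate
      -- The absolute value dominates the height of i - 1 above the vanishing bound, which may be
      -- negative; d = 0 encodes the distance 1 from i - 1 to i.
      torsion⇒translate torsion with translate-or-annihilator ℤ.∣ ℤ.pred i ℤ.- proj₁ vanishes ∣ 0 (ℤ.pred i) (cancel i) bound
        where
        cancel : ∀ i → (-1ℤ + i) + 1ℤ ≡ i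
        cancel = ℤ.solve-∀
        bound : ℤ.pred i ℤ.≤ proj₁ vanishes + + ℤ.∣ ℤ.pred i ℤ.- proj₁ vanishes ∣
        bound = ℤ.≤-trans (ℤ.≤-reflexive (≡.sym (difference (proj₁ vanishes) (ℤ.pred i))))
          (ℤ.+-monoʳ-≤ (proj₁ vanishes) (≤∣∣ (ℤ.pred i ℤ.- proj₁ vanishes)))
          where
          ≤∣∣ : ∀ z → z ℤ.≤ + ℤ.∣ z ∣
          ≤∣∣ (+ n)    = ℤ.≤-refl
          ≤∣∣ -[1+ n ] = ℤ.-≤+
          difference : ∀ a j → a + (j ℤ.- a) ≡ j
          difference = ℤ.solve-∀
      ... | inj₁ translate            = translate
      -- The goal is now absurdity, so the doubly negated dichotomy can be split.
      ... | inj₂ (rs , dist , ann) = ⊥-elim (Emb.saturated-or-not i λ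
        { (inj₁ saturated)    → torsion (saturated⇒torsionIsZero λ {s} {x} {y} → saturated {s} {x} {y})
        ; (inj₂ nonsaturated) → annihilator⇒¬nonsaturated {rs} dist ann nonsaturated })

proposition2p1 :
    ∀ {c ℓ₁ ℓ₂ ℓa ℓm} (k : HeytingField c ℓ₁ ℓ₂) {p : ℕ} (pp : Prime p) →
    HasCharacteristic (fieldRing k) p → IsPerfect (fieldRing k) p →
    (F : Filtration (Witt.W pp (fieldRing k)) ℓa ℓm) (Θ : FilteredEndomorphism F) →
    FilteredEndomorphism.ActsOnGrByMinusIndex Θ →
    (i : ℤ) → ¬ TorsionIsZero (Filtration.gr F i) →
    ∃₂ λ (r m : ℤ) → HT F p r × 0ℤ < m × i ≡ r + m * + p
proposition2p1 k pp char perfect F Θ acts =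
  ConjugateFiltration.torsion⇒translate pp (wittStableDVR k pp char perfect) F Θ acts
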